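{- Let $\Delta$ be the strongly regular graph with parameters $(105,32,4,12)$ and let $D$ be the fundamental group of $\Delta$ (regarded as a 2-complex) with respect to a fixed spanning tree. Then the abelianisation $D/[D,D]$ is isomorphic to $C_2^{16}\times C_3^2$.
   Context: Up to isomorphism there is a unique strongly regular graph with parameters $(105,32,4,12)$, equivalently a unique distance-regular graph with intersection array $\{32,27;1,12\}$; this is $\Delta$. A graph is regarded as an abstract 2-dimensional simplicial complex whose 0-, 1-, 2-simplices are its vertices, edges and triangles. For a connected graph $\Gamma$ with spanning tree $T$, its fundamental group is the finitely presented group with a generator $g_{v,w}$ for each ordered pair $(v,w)$ of adjacent vertices, and relations $g_{s,t}=1$ for each arc $(s,t)$ of $T$, $g_{v,w}g_{w,v}=1$ for each edge $\{v,w\}$, and $g_{x,y}g_{y,z}g_{z,x}=1$ for each triangle $\{x,y,z\}$ (its isomorphism class does not depend on $T$). $[D,D]$ is the commutator subgroup, $C_p^k$ the elementary abelian group of order $p^k$. -}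

module Defs where

open import Level using (0ℓ; _⊔_)
open import Data.Nat using (ℕ; zero; suc; _<_)
open import Data.Bool using (Bool; true; false; not; _∧_; _xor_; T)
open import Data.Bool.Properties using (not-involutive; xor-assoc; xor-identityʳ; xor-same)
open import Data.Fin using (Fin)
open import Data.List using (List; []; _∷_; _++_; [_]; length; filterᵇ; allFin; reverse; map)
open import Data.List.Properties using (++-assoc; ++-identityʳ; reverse-++; reverse-involutive; map-++; reverse-map; map-∘)
open import Data.Product using (Σ; Σ-syntax; _×_; _,_; proj₁; proj₂)
open import Relation.Binary.PropositionalEquality as P using (_≡_; _≢_; refl)
open import Relation.Nullary using (¬_)
open import Relation.Binary.Structures using (IsEquivalence)
open import Algebra.Bundles using (Group; RawGroup)
open import Algebra.Morphism.Structures using (module GroupMorphisms)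
import Algebra.Properties.Group as GroupProps
import Algebra.Construct.DirectProduct as DirectProduct
import Algebra.Construct.Terminal as Terminal
import Relation.Binary.Reasoning.Setoid as SetoidReasoning

record SimpleGraph (n : ℕ) : Set where
  field
    adj     : Fin n → Fin n → Bool
    adj-sym : ∀ v w → adj v w ≡ adj w v
    irrefl  : ∀ v → adj v v ≡ false

  Adj : Fin n → Fin n → Set
  Adj v w = T (adj v w)

  degree : Fin n → ℕ
  degree v = length (filterᵇ (adj v) (allFin n))

  common : Fin n → Fin n → ℕ
  common v w = length (filterᵇ (λ x → adj v x ∧ adj w x) (allFin n))

record IsSRG {n : ℕ} (Γ : SimpleGraph n) (k λ' μ : ℕ) : Set where
  open SimpleGraph Γ
  field
    regular   : ∀ v → degree v ≡ k
    adjacent  : ∀ v w → v ≢ w → Adj v w → common v w ≡ λ'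
    nonadj    : ∀ v w → v ≢ w → ¬ Adj v w → common v w ≡ μ

-- A spanning tree of Γ, presented as a rooted tree: each non-root vertex v
-- has a parent adjacent to it, and a depth function strictly decreasing
-- towards the root (so following parents always reaches the root).
-- The edges of the tree are the {v , parent v} with v ≢ root.
record SpanningTree {n : ℕ} (Γ : SimpleGraph n) : Set where
  open SimpleGraph Γ
  field
    root      : Fin n
    parent    : Fin n → Fin n
    depth     : Fin n → ℕ
    parentAdj : ∀ v → v ≢ root → Adj v (parent v)
    depthDec  : ∀ v → v ≢ root → depth (parent v) < depth v

module Presentation (X : Set) (Relator : List (X × Bool) → Set) where

  -- (x , false) is the generator x, (x , true) its formal inverse
  Letter : Set
  Letter = X × Bool

  Word : Set
  Word = List Letter

  flipL : Letter → Letter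
  flipL (x , b) = (x , not b)

  invW : Word → Word
  invW w = reverse (map flipL w)

  infix 4 _≈_
  data _≈_ : Word → Word → Set where
    ≈-refl  : ∀ {u} → u ≈ u
    ≈-sym   : ∀ {u v} → u ≈ v → v ≈ u
    ≈-trans : ∀ {u v w} → u ≈ v → v ≈ w → u ≈ w
    ≈-cong  : ∀ {u u′ v v′} → u ≈ u′ → v ≈ v′ → u ++ v ≈ u′ ++ v′
    cancel  : ∀ (l : Letter) → l ∷ flipL l ∷ [] ≈ []
    relator : ∀ {r} → Relator r → r ≈ []

  ≡⇒≈ : ∀ {u v} → u ≡ v → u ≈ v
  ≡⇒≈ refl = ≈-refl

  flipL-inv : ∀ l → flipL (flipL l) ≡ l
  flipL-inv (x , b) = P.cong (x ,_) (not-involutive b)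

  invW-++ : ∀ u v → invW (u ++ v) ≡ invW v ++ invW u
  invW-++ u v = P.trans (P.cong reverse (map-++ flipL u v))
                        (reverse-++ (map flipL u) (map flipL v))

  map-id : ∀ (w : Word) → map (λ l → flipL (flipL l)) w ≡ w
  map-id [] = refl
  map-id (l ∷ w) = P.cong₂ _∷_ (flipL-inv l) (map-id w)

  invW-inv : ∀ w → invW (invW w) ≡ w
  invW-inv w = P.trans (P.cong reverse (reverse-map flipL (map flipL w)))
               (P.trans (reverse-involutive (map flipL (map flipL w)))
               (P.trans (P.sym (map-∘ w)) (map-id w)))

  invʳ : ∀ w → w ++ invW w ≈ []
  invʳ [] = ≈-refl
  invʳ (l ∷ w) = ≈-trans (≡⇒≈ eq) (≈-trans (≈-cong (≈-refl {[ l ]}) (≈-cong (invʳ w) (≈-refl {[ flipL l ]})))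
                   (cancel l))
    where
      eq : (l ∷ w) ++ invW (l ∷ w) ≡ [ l ] ++ ((w ++ invW w) ++ [ flipL l ])
      eq = P.cong (l ∷_) (P.trans (P.cong (w ++_) (invW-++ [ l ] w)) (P.sym (++-assoc w (invW w) [ flipL l ])))

  invˡ : ∀ w → invW w ++ w ≈ []
  invˡ w = ≈-trans (≡⇒≈ (P.cong (invW w ++_) (P.sym (invW-inv w)))) (invʳ (invW w))

  invW-cong : ∀ {u v} → u ≈ v → invW u ≈ invW v
  invW-cong ≈-refl = ≈-refl
  invW-cong (≈-sym p) = ≈-sym (invW-cong p)
  invW-cong (≈-trans p q) = ≈-trans (invW-cong p) (invW-cong q)
  invW-cong (≈-cong {u} {u′} {v} {v′} p q) =
    ≈-trans (≡⇒≈ (invW-++ u v)) (≈-trans (≈-cong (invW-cong q) (invW-cong p)) (≡⇒≈ (P.sym (invW-++ u′ v′))))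
  invW-cong (cancel l) = P.subst (λ m → flipL (flipL l) ∷ m ∷ [] ≈ []) (P.cong flipL (flipL-inv l))
                           (cancel (flipL (flipL l)))
  invW-cong (relator {r} x) =
    ≈-trans (≡⇒≈ (P.sym (++-identityʳ (invW r)))) (≈-trans (≈-cong (≈-refl {invW r}) (≈-sym (relator x))) (invˡ r))

  group : Group 0ℓ 0ℓ
  group = record
    { Carrier = Word
    ; _≈_ = _≈_
    ; _∙_ = _++_
    ; ε = []
    ; _⁻¹ = invW
    ; isGroup = record
      { isMonoid = record
        { isSemigroup = record
          { isMagma = record
            { isEquivalence = record { refl = ≈-refl ; sym = ≈-sym ; trans = ≈-trans }
            ; ∙-cong = ≈-cong }
          ; assoc = λ x y z → ≡⇒≈ (++-assoc x y z) }
        ; identity = (λ x → ≈-refl) , (λ x → ≡⇒≈ (++-identityʳ x)) }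
      ; inverse = invˡ , invʳ
      ; ⁻¹-cong = invW-cong
      }
    }

module Abelianisation {c ℓ} (G : Group c ℓ) where
  open Group G hiding (refl; sym; trans)
  open Group G using () renaming (refl to ≈refl; sym to sym; trans to trans)
  open GroupProps G
  open SetoidReasoning setoid

  ⟦_,_⟧ : Carrier → Carrier → Carrier
  ⟦ x , y ⟧ = ((x ⁻¹ ∙ y ⁻¹) ∙ x) ∙ y

  data InComm : Carrier → Set (c ⊔ ℓ) where
    comm : ∀ x y → InComm ⟦ x , y ⟧
    unit : InComm ε
    mul  : ∀ {a b} → InComm a → InComm b → InComm (a ∙ b)
    inv  : ∀ {a} → InComm a → InComm (a ⁻¹)
    resp : ∀ {a b} → a ≈ b → InComm a → InComm b

  private
    lemL : ∀ x y → x ⁻¹ ∙ (x ∙ y) ≈ y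
    lemL x y = begin
      x ⁻¹ ∙ (x ∙ y) ≈⟨ sym (assoc _ _ _) ⟩
      (x ⁻¹ ∙ x) ∙ y ≈⟨ ∙-congʳ (inverseˡ x) ⟩
      ε ∙ y          ≈⟨ identityˡ y ⟩
      y ∎

    lemR : ∀ x y → x ∙ (x ⁻¹ ∙ y) ≈ y
    lemR x y = begin
      x ∙ (x ⁻¹ ∙ y) ≈⟨ sym (assoc _ _ _) ⟩
      (x ∙ x ⁻¹) ∙ y ≈⟨ ∙-congʳ (inverseʳ x) ⟩
      ε ∙ y          ≈⟨ identityˡ y ⟩
      y ∎

  conj : ∀ g {a} → InComm a → InComm ((g ∙ a) ∙ g ⁻¹)
  conj g {a} h = resp eq (mul h (comm a (g ⁻¹)))
    where
      eq : a ∙ ⟦ a , g ⁻¹ ⟧ ≈ (g ∙ a) ∙ g ⁻¹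
      eq = begin
        a ∙ (((a ⁻¹ ∙ g ⁻¹ ⁻¹) ∙ a) ∙ g ⁻¹) ≈⟨ sym (assoc _ _ _) ⟩
        (a ∙ ((a ⁻¹ ∙ g ⁻¹ ⁻¹) ∙ a)) ∙ g ⁻¹ ≈⟨ ∙-congʳ (sym (assoc _ _ _)) ⟩
        ((a ∙ (a ⁻¹ ∙ g ⁻¹ ⁻¹)) ∙ a) ∙ g ⁻¹ ≈⟨ ∙-congʳ (∙-congʳ (lemR a _)) ⟩
        (g ⁻¹ ⁻¹ ∙ a) ∙ g ⁻¹               ≈⟨ ∙-congʳ (∙-congʳ (⁻¹-involutive g)) ⟩
        (g ∙ a) ∙ g ⁻¹ ∎

  infix 4 _∼_
  _∼_ : Carrier → Carrier → Set (c ⊔ ℓ)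
  a ∼ b = InComm (a ∙ b ⁻¹)

  ≈⇒∼ : ∀ {a b} → a ≈ b → a ∼ b
  ≈⇒∼ p = resp (sym (x≈y⇒x∙y⁻¹≈ε p)) unit

  ∼-sym : ∀ {a b} → a ∼ b → b ∼ a
  ∼-sym {a} {b} h = resp (trans (⁻¹-anti-homo-∙ a (b ⁻¹)) (∙-congʳ (⁻¹-involutive b))) (inv h)

  ∼-trans : ∀ {a b d} → a ∼ b → b ∼ d → a ∼ d
  ∼-trans {a} {b} {d} h k = resp eq (mul h k)
    where
      eq : (a ∙ b ⁻¹) ∙ (b ∙ d ⁻¹) ≈ a ∙ d ⁻¹
      eq = trans (assoc _ _ _) (∙-congˡ (lemL b (d ⁻¹)))

  ∼-cong : ∀ {a b x y} → a ∼ b → x ∼ y → (a ∙ x) ∼ (b ∙ y)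
  ∼-cong {a} {b} {x} {y} h k = resp eq (mul (conj a k) h)
    where
      eq : ((a ∙ (x ∙ y ⁻¹)) ∙ a ⁻¹) ∙ (a ∙ b ⁻¹) ≈ (a ∙ x) ∙ (b ∙ y) ⁻¹
      eq = begin
        ((a ∙ (x ∙ y ⁻¹)) ∙ a ⁻¹) ∙ (a ∙ b ⁻¹) ≈⟨ assoc _ _ _ ⟩
        (a ∙ (x ∙ y ⁻¹)) ∙ (a ⁻¹ ∙ (a ∙ b ⁻¹)) ≈⟨ ∙-congˡ (lemL a (b ⁻¹)) ⟩
        (a ∙ (x ∙ y ⁻¹)) ∙ b ⁻¹                ≈⟨ assoc _ _ _ ⟩
        a ∙ ((x ∙ y ⁻¹) ∙ b ⁻¹)                ≈⟨ ∙-congˡ (assoc _ _ _) ⟩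
        a ∙ (x ∙ (y ⁻¹ ∙ b ⁻¹))                ≈⟨ sym (assoc _ _ _) ⟩
        (a ∙ x) ∙ (y ⁻¹ ∙ b ⁻¹)                ≈⟨ ∙-congˡ (sym (⁻¹-anti-homo-∙ b y)) ⟩
        (a ∙ x) ∙ (b ∙ y) ⁻¹ ∎

  ∼-inv : ∀ {a b} → a ∼ b → (a ⁻¹) ∼ (b ⁻¹)
  ∼-inv {a} {b} h = resp eq (inv (conj (a ⁻¹) h))
    where
      eq : ((a ⁻¹ ∙ (a ∙ b ⁻¹)) ∙ a ⁻¹ ⁻¹) ⁻¹ ≈ a ⁻¹ ∙ b ⁻¹ ⁻¹
      eq = begin
        ((a ⁻¹ ∙ (a ∙ b ⁻¹)) ∙ a ⁻¹ ⁻¹) ⁻¹ ≈⟨ ⁻¹-cong (∙-cong (lemL a (b ⁻¹)) (⁻¹-involutive a)) ⟩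
        (b ⁻¹ ∙ a) ⁻¹                     ≈⟨ ⁻¹-anti-homo-∙ (b ⁻¹) a ⟩
        a ⁻¹ ∙ b ⁻¹ ⁻¹ ∎

  abelianisation : Group c (c ⊔ ℓ)
  abelianisation = record
    { Carrier = Carrier
    ; _≈_ = _∼_
    ; _∙_ = _∙_
    ; ε = ε
    ; _⁻¹ = _⁻¹
    ; isGroup = record
      { isMonoid = record
        { isSemigroup = record
          { isMagma = record
            { isEquivalence = record { refl = ≈⇒∼ ≈refl ; sym = ∼-sym ; trans = ∼-trans }
            ; ∙-cong = ∼-cong }
          ; assoc = λ x y z → ≈⇒∼ (assoc x y z) }
        ; identity = (λ x → ≈⇒∼ (identityˡ x)) , (λ x → ≈⇒∼ (identityʳ x)) }
      ; inverse = (λ x → ≈⇒∼ (inverseˡ x)) , (λ x → ≈⇒∼ (inverseʳ x))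
      ; ⁻¹-cong = ∼-inv
      }
    }

_≅_ : ∀ {a ℓa b ℓb} → Group a ℓa → Group b ℓb → Set _
G ≅ H = Σ[ f ∈ (Group.Carrier G → Group.Carrier H) ]
          GroupMorphisms.IsGroupIsomorphism (Group.rawGroup G) (Group.rawGroup H) f

C₂ : Group 0ℓ 0ℓ
C₂ = record
  { Carrier = Bool ; _≈_ = _≡_ ; _∙_ = _xor_ ; ε = false ; _⁻¹ = λ x → x
  ; isGroup = record
    { isMonoid = record
      { isSemigroup = record
        { isMagma = record { isEquivalence = P.isEquivalence ; ∙-cong = P.cong₂ _xor_ }
        ; assoc = xor-assoc }
      ; identity = (λ _ → refl) , xor-identityʳ }
    ; inverse = xor-same , xor-same
    ; ⁻¹-cong = λ p → p }
  }

data Z3 : Set where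
  c0 c1 c2 : Z3

_+3_ : Z3 → Z3 → Z3
c0 +3 y = y
c1 +3 c0 = c1
c1 +3 c1 = c2
c1 +3 c2 = c0
c2 +3 c0 = c2
c2 +3 c1 = c0
c2 +3 c2 = c1

neg3 : Z3 → Z3
neg3 c0 = c0
neg3 c1 = c2
neg3 c2 = c1

c3-assoc : ∀ x y z → (x +3 y) +3 z ≡ x +3 (y +3 z)
c3-assoc c0 c0 c0 = refl
c3-assoc c0 c0 c1 = refl
c3-assoc c0 c0 c2 = refl
c3-assoc c0 c1 c0 = refl
c3-assoc c0 c1 c1 = refl
c3-assoc c0 c1 c2 = refl
c3-assoc c0 c2 c0 = refl
c3-assoc c0 c2 c1 = refl
c3-assoc c0 c2 c2 = refl
c3-assoc c1 c0 c0 = refl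
c3-assoc c1 c0 c1 = refl
c3-assoc c1 c0 c2 = refl
c3-assoc c1 c1 c0 = refl
c3-assoc c1 c1 c1 = refl
c3-assoc c1 c1 c2 = refl
c3-assoc c1 c2 c0 = refl
c3-assoc c1 c2 c1 = refl
c3-assoc c1 c2 c2 = refl
c3-assoc c2 c0 c0 = refl
c3-assoc c2 c0 c1 = refl
c3-assoc c2 c0 c2 = refl
c3-assoc c2 c1 c0 = refl
c3-assoc c2 c1 c1 = refl
c3-assoc c2 c1 c2 = refl
c3-assoc c2 c2 c0 = refl
c3-assoc c2 c2 c1 = refl
c3-assoc c2 c2 c2 = refl

C₃ : Group 0ℓ 0ℓ
C₃ = record
  { Carrier = Z3 ; _≈_ = _≡_ ; _∙_ = _+3_ ; ε = c0 ; _⁻¹ = neg3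
  ; isGroup = record
    { isMonoid = record
      { isSemigroup = record
        { isMagma = record { isEquivalence = P.isEquivalence ; ∙-cong = P.cong₂ _+3_ }
        ; assoc = c3-assoc }
      ; identity = (λ _ → refl) , idʳ }
    ; inverse = invl , invr
    ; ⁻¹-cong = P.cong neg3 }
  }
  where
    idʳ : ∀ x → x +3 c0 ≡ x
    idʳ c0 = refl
    idʳ c1 = refl
    idʳ c2 = refl
    invl : ∀ x → neg3 x +3 x ≡ c0
    invl c0 = refl
    invl c1 = refl
    invl c2 = refl
    invr : ∀ x → x +3 neg3 x ≡ c0
    invr c0 = refl
    invr c1 = refl
    invr c2 = refl

_^ᴳ_ : Group 0ℓ 0ℓ → ℕ → Group 0ℓ 0ℓ
G ^ᴳ zero  = Terminal.group {0ℓ} {0ℓ}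
G ^ᴳ suc k = DirectProduct.group G (G ^ᴳ k)

_×ᴳ_ : Group 0ℓ 0ℓ → Group 0ℓ 0ℓ → Group 0ℓ 0ℓ
G ×ᴳ H = DirectProduct.group G H

-- The fundamental group of a graph (as a 2-complex of vertices, edges,
-- triangles) with respect to a spanning tree T.

module FundamentalGroup {n : ℕ} (Γ : SimpleGraph n) (Tr : SpanningTree Γ) where
  open SimpleGraph Γ
  open SpanningTree Tr

  Arc : Set
  Arc = Σ[ p ∈ Fin n × Fin n ] Adj (proj₁ p) (proj₂ p)

  g : ∀ v w → Adj v w → List (Arc × Bool)
  g v w a = [ (((v , w) , a) , false) ]

  adj-sym′ : ∀ {v w} → Adj v w → Adj w v
  adj-sym′ {v} {w} a = P.subst T (adj-sym v w) a

  data Relator : List (Arc × Bool) → Set where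
    tree↑  : ∀ v (nr : v ≢ root) → Relator (g v (parent v) (parentAdj v nr))
    tree↓  : ∀ v (nr : v ≢ root) → Relator (g (parent v) v (adj-sym′ (parentAdj v nr)))
    edge   : ∀ v w (a : Adj v w) (b : Adj w v) → Relator (g v w a ++ g w v b)
    tri    : ∀ x y z (a : Adj x y) (b : Adj y z) (c : Adj z x) →
             Relator (g x y a ++ g y z b ++ g z x c)

  π₁ : Group 0ℓ 0ℓ
  π₁ = Presentation.group Arc Relator

π₁-ab : ∀ {n} (Γ : SimpleGraph n) (Tr : SpanningTree Γ) → Group 0ℓ 0ℓ
π₁-ab Γ Tr = Abelianisation.abelianisation (FundamentalGroup.π₁ Γ Tr)

{-# OPTIONS --safe #-}

-- Let A be the adjacency matrix.  From A² = 20 I − 8 A + 12 J one gets, for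
-- c : V → ℤ with k = (2 I − A) c and t = ∑ c, that ∑ k = −30 t and
-- ∑ k² = 12 (c · k + t²); since the k z are integers, this excludes many
-- configurations and identifies others.  It shows that Δ has no K₄ and, above
-- all, that every edge x a has a midpoint y, the vertex with
-- y = 2 x + 2 a + ∑ (common neighbours of x and a) modulo the kernel of
-- 2 I − A + (2/7) J.  In the graph of flags of a projective plane, y is the
-- flag joining x to a.  Call x, y special when y is the midpoint of an edge at
-- x.  The specials of a vertex form two cocliques of size 4, which yields the
-- points and lines; coordinates around one flag turn them into a table that is
-- forced to be that of the plane of order 4.  So Δ is the graph of the 105
-- flags of PG(2,4), two flags being adjacent iff they are disjoint and joined
-- by a flag.
--
-- The abelianised fundamental group is then found from 16 arcs that, together
-- with a spanning tree, determine every other arc by triangles.  Integer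
-- combinations of the remaining triangles give the orders of generators, and
-- an explicit cocycle with values in C₂¹⁶ × C₃² shows that nothing else
-- collapses.
module Submission where

open import Algebra.Bundles using (Group; AbelianGroup)
import Algebra.Construct.DirectProduct as DirectProduct
import Algebra.Properties.AbelianGroup as AbelianGroupProps
import Algebra.Properties.CommutativeSemigroup as CommutativeSemigroupProps
import Algebra.Properties.Group as GroupProps
import Algebra.Properties.Monoid.Mult as Mult
import Algebra.Properties.Semiring.Sum as SemiringSum
open import Data.Bool using (Bool; true; false; _∧_; _∨_; _xor_; not; if_then_else_)
import Data.Bool as Bool
import Data.Bool.Properties as Boolₚ
open import Data.Empty using (⊥; ⊥-elim)
open import Data.Fin using (Fin; zero; suc; toℕ; #_)
open import Data.Fin.Patterns using (0F; 1F; 2F; 3F; 4F)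
open import Data.Fin.Properties using (_≟_)
import Data.Fin.Properties as Finₚ
open import Data.Integer
  using (ℤ; +_; -_; -[1+_]; _+_; _*_; _-_; _≤_; 0ℤ; 1ℤ; _⊖_; +≤+; -≤-)
import Data.Integer.Properties as ℤₚ
open import Data.Integer.Tactic.RingSolver using (solve-∀)
open import Data.List using (List; []; _∷_; length; filterᵇ; allFin)
import Data.List as List
open import Data.Maybe using (Maybe; just; nothing; is-just; fromMaybe)
import Data.Maybe.Properties as Maybeₚ
open import Data.Nat using (ℕ; zero; suc; z≤n; s≤s; NonZero)
import Data.Nat as ℕ
open import Data.Nat.DivMod using (_/_; _%_; _mod_)
import Data.Nat.Properties as ℕₚ
open import Data.Product using (Σ; Σ-syntax; ∃; _×_; _,_; proj₁; proj₂)
open import Data.Sum using (_⊎_; inj₁; inj₂)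
open import Data.Vec using (Vec; []; _∷_)
import Data.Vec as Vec
import Data.Vec.Properties as Vecₚ
open import Function using (_∘_; id)
open import Function.Definitions using (Injective)
open import Level using (0ℓ; _⊔_)
open import Relation.Binary.PropositionalEquality
  using (_≡_; _≢_; refl; sym; trans; cong; cong₂; subst; subst₂; module ≡-Reasoning)
import Relation.Binary.Reasoning.Setoid as SetoidReasoning
open import Relation.Nullary using (¬_; yes; no; does; contradiction)

open import Defs

-- The eigenvalues of A are 32, 2 and -10, and 14 I - 7 A + 2 J is 84 times the projection onto the
-- 20-dimensional eigenspace for -10. The vertices span a lattice there in which c has norm 7 (c ·
-- k) + 2 t²: 16 for a vertex, 14 for the vector excluded by `no-root`, 0 for a relation between
-- vertices. Semidefiniteness alone does not give midpoints. What is used instead is that ∑ (k z +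
-- a)(k z + a + 1) ≥ 0 for every integer a. In that half the number of vertices is a variable equal
-- to 105, so nothing is evaluated. The second half evaluates tables over the 105 flags, and its
-- numerals are certificates that are only verified. The given graph has its own numbering and an
-- arbitrary spanning tree, while the labels belong to one fixed tree of the flag graph. Potentials
-- on the vertices translate between the two trees, and most of the work after the evaluations is to
-- show that these translations cancel. The group splits because the generators satisfy 6 s = 0:
-- then s = 3 s + 4 s, where 3 s has order dividing 2 and 4 s order dividing 3.

open SemiringSum ℤₚ.+-*-semiring using (sum; sum-cong-≗; ∑-distrib-+; ∑-comm; *-distribˡ-sum)

-- Finite sums of integers and 0/1-valued functions.

opaque
  ∑ : ∀ {n} → (Fin n → ℤ) → ℤ
  ∑ = sum

  ∑-cong : ∀ {n} {f g : Fin n → ℤ} → (∀ i → f i ≡ g i) → ∑ f ≡ ∑ g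
  ∑-cong {f = f} {g} = sum-cong-≗ {x = f} {g}

  ∑-+ : ∀ {n} (f g : Fin n → ℤ) → ∑ (λ i → f i + g i) ≡ ∑ f + ∑ g
  ∑-+ = ∑-distrib-+

  ∑-* : ∀ {n} a (f : Fin n → ℤ) → ∑ (λ i → a * f i) ≡ a * ∑ f
  ∑-* a f = sym (*-distribˡ-sum a f)

  ∑-lin : ∀ {n} a (f : Fin n → ℤ) b (g : Fin n → ℤ) →
          ∑ (λ i → a * f i + b * g i) ≡ a * ∑ f + b * ∑ g
  ∑-lin a f b g = trans (∑-+ (λ i → a * f i) (λ i → b * g i)) (cong₂ _+_ (∑-* a f) (∑-* b g))

  ∑-lin₃ : ∀ {n} a (f : Fin n → ℤ) b (g : Fin n → ℤ) c (h : Fin n → ℤ) →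
           ∑ (λ i → a * f i + b * g i + c * h i) ≡ a * ∑ f + b * ∑ g + c * ∑ h
  ∑-lin₃ a f b g c h =
    trans (∑-+ (λ i → a * f i + b * g i) (λ i → c * h i)) (cong₂ _+_ (∑-lin a f b g) (∑-* c h))

  ∑-swap : ∀ {m n} (f : Fin m → Fin n → ℤ) → ∑ (λ i → ∑ (f i)) ≡ ∑ (λ j → ∑ (λ i → f i j))
  ∑-swap = ∑-comm

  ∑-≤ : ∀ {n} {f g : Fin n → ℤ} → (∀ i → f i ≤ g i) → ∑ f ≤ ∑ g
  ∑-≤ {zero}  f≤g = ℤₚ.≤-refl
  ∑-≤ {suc n} f≤g = ℤₚ.+-mono-≤ (f≤g zero) (∑-≤ (f≤g ∘ suc))

  ∑0 : ∀ n → ∑ {n} (λ _ → 0ℤ) ≡ 0ℤ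
  ∑0 zero    = refl
  ∑0 (suc n) = trans (ℤₚ.+-identityˡ _) (∑0 n)

  ∑1 : ∀ n → ∑ {n} (λ _ → 1ℤ) ≡ + n
  ∑1 zero    = refl
  ∑1 (suc n) = cong (_+_ 1ℤ) (∑1 n)

  ∑-≥0 : ∀ {n} {f : Fin n → ℤ} → (∀ i → 0ℤ ≤ f i) → 0ℤ ≤ ∑ f
  ∑-≥0 {n} {f} 0≤f = subst (_≤ ∑ f) (∑0 n) (∑-≤ 0≤f)

  term≤∑ : ∀ {n} {f : Fin n → ℤ} → (∀ i → 0ℤ ≤ f i) → ∀ i → f i ≤ ∑ f
  term≤∑ {f = f} 0≤f zero    =
    subst (_≤ ∑ f) (ℤₚ.+-identityʳ _) (ℤₚ.+-monoʳ-≤ (f zero) (∑-≥0 (0≤f ∘ suc)))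
  term≤∑ {f = f} 0≤f (suc i) =
    subst (_≤ ∑ f) (ℤₚ.+-identityˡ _) (ℤₚ.+-mono-≤ (0≤f zero) (term≤∑ (0≤f ∘ suc) i))

  0≤∧≤0 : ∀ {a} → 0ℤ ≤ a → a ≤ 0ℤ → a ≡ 0ℤ
  0≤∧≤0 p q = ℤₚ.≤-antisym q p

  ∑≡0⇒≡0 : ∀ {n} {f : Fin n → ℤ} → (∀ i → 0ℤ ≤ f i) → ∑ f ≡ 0ℤ → ∀ i → f i ≡ 0ℤ
  ∑≡0⇒≡0 0≤f e i = 0≤∧≤0 (0≤f i) (subst (_ ≤_) e (term≤∑ 0≤f i))

  -- Equality case of a double count: the differences are nonnegative and add up to 0. The
  -- classification uses it to turn counting inequalities into exact local statements.
  ≤∧∑≡⇒≡ : ∀ {n} {f g : Fin n → ℤ} → (∀ i → f i ≤ g i) → ∑ f ≡ ∑ g → ∀ i → f i ≡ g i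
  ≤∧∑≡⇒≡ {f = f} {g} f≤g e i =
    sym (ℤₚ.i-j≡0⇒i≡j (g i) (f i)
      (∑≡0⇒≡0 (λ j → ℤₚ.i≤j⇒0≤j-i (f≤g j))
        (trans (∑-cong (λ j → ar (g j) (f j)))
        (trans (∑-lin 1ℤ g (- 1ℤ) f)
        (trans (cong (λ s → 1ℤ * ∑ g + - 1ℤ * s) e) (ar′ (∑ g))))) i))
    where
    ar : ∀ a b → a - b ≡ 1ℤ * a + - 1ℤ * b
    ar = solve-∀
    ar′ : ∀ a → 1ℤ * a + - 1ℤ * a ≡ 0ℤ
    ar′ = solve-∀

  ∑≢0⇒∃ : ∀ {n} {f : Fin n → ℤ} → ∑ f ≢ 0ℤ → ∃ λ i → f i ≢ 0ℤ
  ∑≢0⇒∃ {zero}      ne = contradiction refl ne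
  ∑≢0⇒∃ {suc n} {f} ne with f zero ℤₚ.≟ 0ℤ
  ... | no  f₀≢0 = zero , f₀≢0
  ... | yes f₀≡0 with ∑≢0⇒∃ {f = f ∘ suc} (λ e → ne (cong₂ _+_ f₀≡0 e))
  ...   | i , fi≢0 = suc i , fi≢0

χ : Bool → ℤ
χ true  = 1ℤ
χ false = 0ℤ

δ : ∀ {n} → Fin n → Fin n → ℤ
δ i j = χ (does (i ≟ j))

δ-refl : ∀ {n} (i : Fin n) → δ i i ≡ 1ℤ
δ-refl i with i ≟ i
... | yes _  = refl
... | no  ne = contradiction refl ne

δ-≢ : ∀ {n} {i j : Fin n} → i ≢ j → δ i j ≡ 0ℤ
δ-≢ {i = i} {j} ne with i ≟ j
... | yes e = contradiction e ne
... | no  _ = refl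

δ-sym : ∀ {n} (i j : Fin n) → δ i j ≡ δ j i
δ-sym i j with i ≟ j
... | yes refl = sym (δ-refl i)
... | no  ne   = sym (δ-≢ (ne ∘ sym))

δ-suc : ∀ {n} (i j : Fin n) → δ (suc i) (suc j) ≡ δ i j
δ-suc i j with i ≟ j
... | yes refl = refl
... | no  ne   = refl

opaque
  unfolding ∑

  ∑-δ : ∀ {n} i (f : Fin n → ℤ) → ∑ (λ j → δ i j * f j) ≡ f i
  ∑-δ {suc n} zero    f =
    trans (cong₂ _+_ (ℤₚ.*-identityˡ (f zero))
                     (trans (∑-cong (λ j → ℤₚ.*-zeroˡ (f (suc j)))) (∑0 n)))
          (ℤₚ.+-identityʳ _)
  ∑-δ {suc n} (suc i) f =
    trans (cong₂ _+_ (ℤₚ.*-zeroˡ (f zero))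
                     (trans (∑-cong (λ j → cong (_* f (suc j)) (δ-suc i j))) (∑-δ i (f ∘ suc))))
          (ℤₚ.+-identityˡ _)

∑-δ1 : ∀ {n} (i : Fin n) → ∑ (δ i) ≡ 1ℤ
∑-δ1 i = trans (∑-cong (λ j → sym (ℤₚ.*-identityʳ (δ i j)))) (∑-δ i (λ _ → 1ℤ))

data Bit : ℤ → Set where
  b0 : Bit 0ℤ
  b1 : Bit 1ℤ

χ-bit : ∀ b → Bit (χ b)
χ-bit true  = b1
χ-bit false = b0

δ-bit : ∀ {n} (i j : Fin n) → Bit (δ i j)
δ-bit i j = χ-bit (does (i ≟ j))

bit-≥0 : ∀ {a} → Bit a → 0ℤ ≤ a
bit-≥0 b0 = +≤+ z≤n
bit-≥0 b1 = +≤+ z≤n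

bit-≤1 : ∀ {a} → Bit a → a ≤ 1ℤ
bit-≤1 b0 = +≤+ z≤n
bit-≤1 b1 = ℤₚ.≤-refl

bit-* : ∀ {a b} → Bit a → Bit b → Bit (a * b)
bit-* b0 b0 = b0
bit-* b0 b1 = b0
bit-* b1 b0 = b0
bit-* b1 b1 = b1

bit-idem : ∀ {a} → Bit a → a * a ≡ a
bit-idem b0 = refl
bit-idem b1 = refl

bit-≢0 : ∀ {a} → Bit a → a ≢ 0ℤ → a ≡ 1ℤ
bit-≢0 b0 ne = contradiction refl ne
bit-≢0 b1 _  = refl

0≢1 : 0ℤ ≢ 1ℤ
0≢1 ()

δ≡1⇒≡ : ∀ {n} {i j : Fin n} → δ i j ≡ 1ℤ → i ≡ j
δ≡1⇒≡ {i = i} {j} e with i ≟ j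
... | yes p = p
... | no  _ = contradiction e λ ()

*-≢0ˡ : ∀ {a b} → a * b ≢ 0ℤ → a ≢ 0ℤ
*-≢0ˡ {b = b} ne refl = ne (ℤₚ.*-zeroˡ b)

*-≢0ʳ : ∀ {a b} → a * b ≢ 0ℤ → b ≢ 0ℤ
*-≢0ʳ {a} ne refl = ne (ℤₚ.*-zeroʳ a)

*-≥0 : ∀ {a b} → 0ℤ ≤ a → 0ℤ ≤ b → 0ℤ ≤ a * b
*-≥0 {+ a} {+ b} (+≤+ _) (+≤+ _) = subst (0ℤ ≤_) (ℤₚ.pos-* a b) (+≤+ z≤n)

-- No integer lies strictly between -1 and 0. Through `∑disc` this sharpens the semidefiniteness of
-- the form to an integral inequality.
0≤m[m+1] : ∀ m → 0ℤ ≤ m * (m + 1ℤ)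
0≤m[m+1] (+ m) = *-≥0 {+ m} {+ m + 1ℤ} (+≤+ z≤n) (+≤+ z≤n)
0≤m[m+1] -[1+ 0 ] = +≤+ z≤n
0≤m[m+1] -[1+ suc m ] = +≤+ z≤n

0≤m² : ∀ m → 0ℤ ≤ m * m
0≤m² (+ m) = *-≥0 {+ m} {+ m} (+≤+ z≤n) (+≤+ z≤n)
0≤m² -[1+ m ] = +≤+ z≤n

∑-atMostOne : ∀ {n} {f : Fin n → ℤ} → (∀ i → Bit (f i)) →
              (∀ i j → f i ≡ 1ℤ → f j ≡ 1ℤ → i ≡ j) → ∑ f ≤ 1ℤ
∑-atMostOne {n} {f} bit uniq with ∑ f ℤₚ.≟ 0ℤ
... | yes e = subst (_≤ 1ℤ) (sym e) (+≤+ z≤n)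
... | no ne with ∑≢0⇒∃ {f = f} ne
...   | i , fi≢0 = subst (∑ f ≤_) (∑-δ1 i) (∑-≤ step)
  where
  step : ∀ j → f j ≤ δ i j
  step j with f j | bit j | uniq i j (bit-≢0 (bit i) fi≢0)
  ... | _ | b0 | _ = bit-≥0 (δ-bit i j)
  ... | _ | b1 | u = subst (λ k → 1ℤ ≤ δ i k) (u refl) (ℤₚ.≤-reflexive (sym (δ-refl i)))

opaque
  unfolding ∑

  length-filter : ∀ {a} {A : Set a} {n} (p : A → Bool) (g : Fin n → A) →
                  + length (filterᵇ p (List.tabulate g)) ≡ ∑ (χ ∘ p ∘ g)
  length-filter {n = zero}  p g = refl
  length-filter {n = suc n} p g with p (g zero)
  ... | true  = cong (_+_ 1ℤ) (length-filter p (g ∘ suc))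
  ... | false = trans (length-filter p (g ∘ suc)) (sym (ℤₚ.+-identityˡ _))

opaque
  unfolding ∑

  support : ∀ {n} k {f : Fin n → ℤ} → (∀ i → Bit (f i)) → ∑ f ≡ + k →
            Σ[ e ∈ (Fin k → Fin n) ] Injective _≡_ _≡_ e × (∀ i → f (e i) ≡ 1ℤ)
  support {zero}  zero bit e = (λ ()) , (λ { {()} }) , λ ()
  support {zero}  (suc k) bit ()
  support {suc n} k {f} bit e with f zero in eq | bit zero
  support {suc n} k {f} bit e | _ | b0
    with support k {f ∘ suc} (bit ∘ suc) (trans (sym (ℤₚ.+-identityˡ _)) e)
  ... | g , inj , on = suc ∘ g , inj ∘ Finₚ.suc-injective , on
  support {suc n} zero {f} bit e | _ | b1 =
    contradiction (subst (1ℤ ≤_) e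
      (ℤₚ.+-monoʳ-≤ 1ℤ (∑-≥0 {f = f ∘ suc} (bit-≥0 ∘ bit ∘ suc)))) λ { (+≤+ ()) }
  support {suc n} (suc k) {f} bit e | _ | b1
    with support k {f ∘ suc} (bit ∘ suc) (trans (ar (∑ (f ∘ suc))) (trans (cong (_- 1ℤ) e) refl))
    where
    ar : ∀ s → s ≡ 1ℤ + s - 1ℤ
    ar = solve-∀
  ... | g , inj , on = h , h-inj , h-on
    where
    h : Fin (suc k) → Fin (suc n)
    h zero    = zero
    h (suc i) = suc (g i)
    h-inj : Injective _≡_ _≡_ h
    h-inj {zero}  {zero}  _  = refl
    h-inj {suc i} {suc j} eq′ = cong suc (inj (Finₚ.suc-injective eq′))
    h-on : ∀ i → f (h i) ≡ 1ℤ
    h-on zero    = eq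
    h-on (suc i) = on i

-- The indicator of the image of e is bounded by f and has the same sum.
support-onto : ∀ {n} k {f : Fin n → ℤ} → (∀ i → Bit (f i)) → ∑ f ≡ + k →
               (e : Fin k → Fin n) → Injective _≡_ _≡_ e → (∀ i → f (e i) ≡ 1ℤ) →
               ∀ z → f z ≡ 1ℤ → ∃ λ i → e i ≡ z
support-onto k {f} bit ∑f e inj on z fz =
  let i , ne = ∑≢0⇒∃ {f = λ i → δ (e i) z} λ eq → 0≢1 (trans (sym eq) (trans (image≡f z) fz))
  in i , δ≡1⇒≡ (bit-≢0 (δ-bit (e i) z) ne)
  where
  image : _ → ℤ
  image w = ∑ λ i → δ (e i) w
  image≤f : ∀ w → image w ≤ f w
  image≤f w with f w in eq | bit w
  ... | _ | b1 = ∑-atMostOne (λ i → δ-bit (e i) w)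
                   λ i j p q → inj (trans (δ≡1⇒≡ p) (sym (δ≡1⇒≡ q)))
  ... | _ | b0 = ℤₚ.≤-reflexive (trans (∑-cong λ i → δ-≢ λ p →
                   0≢1 (trans (sym (subst (λ v → f v ≡ 0ℤ) (sym p) eq)) (on i))) (∑0 k))
  image≡f : ∀ w → image w ≡ f w
  image≡f = ≤∧∑≡⇒≡ image≤f
    (trans (∑-swap (λ w i → δ (e i) w))
    (trans (∑-cong λ i → ∑-δ1 (e i)) (trans (∑1 k) (sym ∑f))))

χ-∧ : ∀ a b → χ (a ∧ b) ≡ χ a * χ b
χ-∧ true  b = sym (ℤₚ.*-identityˡ (χ b))
χ-∧ false b = sym (ℤₚ.*-zeroˡ (χ b))

T⇒≡ : ∀ {b} → Bool.T b → b ≡ true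
T⇒≡ {true} _ = refl

-- The matrix identity and its integral quadratic form.

module Lattice {n} (Γ : SimpleGraph n) (n≡105 : n ≡ 105) (srg : IsSRG Γ 32 4 12) where
  open SimpleGraph Γ
  open IsSRG srg

  V : Set
  V = Fin n

  A : V → V → ℤ
  A x y = χ (adj x y)

  A-bit : ∀ x y → Bit (A x y)
  A-bit x y = χ-bit (adj x y)

  A-sym : ∀ x y → A x y ≡ A y x
  A-sym x y = cong χ (adj-sym x y)

  A-irr : ∀ x → A x x ≡ 0ℤ
  A-irr x = cong χ (irrefl x)

  ∑1≡105 : ∑ {n} (λ _ → 1ℤ) ≡ + 105
  ∑1≡105 = trans (∑1 n) (cong +_ n≡105)

  ∑A : ∀ x → ∑ (A x) ≡ + 32
  ∑A x = trans (sym (length-filter (adj x) id)) (cong +_ (regular x))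

  N : V → V → V → ℤ
  N x y w = A x w * A y w

  N-bit : ∀ x y w → Bit (N x y w)
  N-bit x y w = bit-* (A-bit x w) (A-bit y w)

  ∑N-common : ∀ x y → ∑ (N x y) ≡ + common x y
  ∑N-common x y = trans (∑-cong λ w → sym (χ-∧ (adj x w) (adj y w)))
                        (sym (length-filter (λ w → adj x w ∧ adj y w) id))

  -- The entries of A²: 20 + 12 on the diagonal, 12 - 8 on edges, 12 elsewhere.
  ∑N : ∀ x y → ∑ (N x y) ≡ + 20 * δ x y + - (+ 8) * A x y + + 12
  ∑N x y with x ≟ y
  ... | yes refl = trans (∑-cong λ w → bit-idem (A-bit x w))
                         (trans (∑A x) (cong (λ a → + 20 * 1ℤ + - (+ 8) * a + + 12) (sym (A-irr x))))
  ... | no  x≢y with adj x y in eq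
  ...   | true  = trans (∑N-common x y) (cong +_ (adjacent x y x≢y (subst Bool.T (sym eq) _)))
  ...   | false = trans (∑N-common x y) (cong +_ (nonadj x y x≢y (λ t → subst Bool.T eq t)))

  ap : (V → ℤ) → V → ℤ
  ap c z = ∑ λ w → A z w * c w

  -- The idempotent of the eigenvalue −10 is a multiple of 14 I − 7 A + 2 J.
  -- For c : V → ℤ the vector k c = (2 I − A) c and the number form c = c · k c
  -- therefore satisfy ∑ k c = −30 ∑ c and ∑ (k c)² = 12 (form c + (∑ c)²).
  opaque
    k : (V → ℤ) → V → ℤ
    k c z = + 2 * c z + - 1ℤ * ap c z

    form : (V → ℤ) → ℤ
    form c = ∑ λ z → c z * k c z

    k-def : ∀ c z → k c z ≡ + 2 * c z + - 1ℤ * ap c z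
    k-def c z = refl

    form-def : ∀ c → form c ≡ ∑ λ z → c z * k c z
    form-def c = refl

  ap-selfAdjoint : ∀ f g → ∑ (λ z → f z * ap g z) ≡ ∑ (λ z → ap f z * g z)
  ap-selfAdjoint f g = begin
    ∑ (λ z → f z * ap g z)                  ≡⟨ ∑-cong (λ z → sym (∑-* (f z) (λ w → A z w * g w))) ⟩
    ∑ (λ z → ∑ λ w → f z * (A z w * g w))   ≡⟨ ∑-swap (λ z w → f z * (A z w * g w)) ⟩
    ∑ (λ w → ∑ λ z → f z * (A z w * g w))   ≡⟨ ∑-cong (λ w → ∑-cong λ z →
                                                 trans (cong (λ a → f z * (a * g w)) (A-sym z w))
                                                       (ar (f z) (A w z) (g w))) ⟩
    ∑ (λ w → ∑ λ z → g w * (A w z * f z))   ≡⟨ ∑-cong (λ w → ∑-* (g w) (λ z → A w z * f z)) ⟩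
    ∑ (λ w → g w * ap f w)                  ≡⟨ ∑-cong (λ w → ℤₚ.*-comm (g w) (ap f w)) ⟩
    ∑ (λ w → ap f w * g w)                  ∎
    where
    open ≡-Reasoning
    ar : ∀ a b c → a * (b * c) ≡ c * (b * a)
    ar = solve-∀

  ∑ap : ∀ c → ∑ (ap c) ≡ + 32 * ∑ c
  ∑ap c = begin
    ∑ (ap c)                       ≡⟨ ∑-cong (λ z → sym (ℤₚ.*-identityˡ (ap c z))) ⟩
    ∑ (λ z → 1ℤ * ap c z)          ≡⟨ ap-selfAdjoint (λ _ → 1ℤ) c ⟩
    ∑ (λ z → ap (λ _ → 1ℤ) z * c z) ≡⟨ ∑-cong (λ z → cong (_* c z)
                                        (trans (∑-cong λ w → ℤₚ.*-identityʳ (A z w)) (∑A z))) ⟩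
    ∑ (λ z → + 32 * c z)           ≡⟨ ∑-* (+ 32) c ⟩
    + 32 * ∑ c                     ∎
    where open ≡-Reasoning

  ap-ap : ∀ c z → ap (ap c) z ≡ + 20 * c z + - (+ 8) * ap c z + + 12 * ∑ c
  ap-ap c z = begin
    ∑ (λ w → A z w * ap c w)       ≡⟨ ap-selfAdjoint (A z) c ⟩
    ∑ (λ v → ap (A z) v * c v)     ≡⟨ ∑-cong (λ v → cong (_* c v)
                                        (trans (∑-cong λ w → ℤₚ.*-comm (A v w) (A z w)) (∑N z v))) ⟩
    ∑ (λ v → (+ 20 * δ z v + - (+ 8) * A z v + + 12) * c v)
                                   ≡⟨ ∑-cong (λ v → ar (δ z v) (A z v) (c v)) ⟩
    ∑ (λ v → + 20 * (δ z v * c v) + - (+ 8) * (A z v * c v) + + 12 * c v)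
                                   ≡⟨ ∑-lin₃ (+ 20) _ (- (+ 8)) _ (+ 12) c ⟩
    + 20 * ∑ (λ v → δ z v * c v) + - (+ 8) * ap c z + + 12 * ∑ c
                                   ≡⟨ cong (λ a → + 20 * a + - (+ 8) * ap c z + + 12 * ∑ c) (∑-δ z c) ⟩
    + 20 * c z + - (+ 8) * ap c z + + 12 * ∑ c ∎
    where
    open ≡-Reasoning
    ar : ∀ d a c → (+ 20 * d + - (+ 8) * a + + 12) * c ≡ + 20 * (d * c) + - (+ 8) * (a * c) + + 12 * c
    ar = solve-∀

  opaque
    unfolding k form

    -- Because (A - 2 I)(A + 10 I) = 12 J, the vectors `k c` lie in the eigenspace for -10 up to a
    -- constant vector.
    ap-k : ∀ c z → ap (k c) z ≡ - (+ 10) * k c z + - (+ 12) * ∑ c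
    ap-k c z = begin
      ∑ (λ w → A z w * (+ 2 * c w + - 1ℤ * ap c w))
        ≡⟨ ∑-cong (λ w → ar (A z w) (c w) (ap c w)) ⟩
      ∑ (λ w → + 2 * (A z w * c w) + - 1ℤ * (A z w * ap c w))
        ≡⟨ ∑-lin (+ 2) (λ w → A z w * c w) (- 1ℤ) (λ w → A z w * ap c w) ⟩
      + 2 * ap c z + - 1ℤ * ap (ap c) z
        ≡⟨ cong (λ a → + 2 * ap c z + - 1ℤ * a) (ap-ap c z) ⟩
      + 2 * ap c z + - 1ℤ * (+ 20 * c z + - (+ 8) * ap c z + + 12 * ∑ c)
        ≡⟨ ar′ (c z) (ap c z) (∑ c) ⟩
      - (+ 10) * k c z + - (+ 12) * ∑ c ∎
      where
      open ≡-Reasoning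
      ar : ∀ a c p → a * (+ 2 * c + - 1ℤ * p) ≡ + 2 * (a * c) + - 1ℤ * (a * p)
      ar = solve-∀
      ar′ : ∀ c p t → + 2 * p + - 1ℤ * (+ 20 * c + - (+ 8) * p + + 12 * t)
                      ≡ - (+ 10) * (+ 2 * c + - 1ℤ * p) + - (+ 12) * t
      ar′ = solve-∀

    k-selfAdjoint : ∀ f g → ∑ (λ z → f z * k g z) ≡ ∑ (λ z → k f z * g z)
    k-selfAdjoint f g = begin
      ∑ (λ z → f z * k g z)
        ≡⟨ ∑-cong (λ z → ar (f z) (g z) (ap g z)) ⟩
      ∑ (λ z → + 2 * (f z * g z) + - 1ℤ * (f z * ap g z))
        ≡⟨ ∑-lin (+ 2) (λ z → f z * g z) (- 1ℤ) (λ z → f z * ap g z) ⟩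
      + 2 * ∑ (λ z → f z * g z) + - 1ℤ * ∑ (λ z → f z * ap g z)
        ≡⟨ cong (λ s → + 2 * ∑ (λ z → f z * g z) + - 1ℤ * s) (ap-selfAdjoint f g) ⟩
      + 2 * ∑ (λ z → f z * g z) + - 1ℤ * ∑ (λ z → ap f z * g z)
        ≡⟨ sym (∑-lin (+ 2) (λ z → f z * g z) (- 1ℤ) (λ z → ap f z * g z)) ⟩
      ∑ (λ z → + 2 * (f z * g z) + - 1ℤ * (ap f z * g z))
        ≡⟨ ∑-cong (λ z → ar′ (f z) (g z) (ap f z)) ⟩
      ∑ (λ z → k f z * g z) ∎
      where
      open ≡-Reasoning
      ar : ∀ f g p → f * (+ 2 * g + - 1ℤ * p) ≡ + 2 * (f * g) + - 1ℤ * (f * p)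
      ar = solve-∀
      ar′ : ∀ f g p → + 2 * (f * g) + - 1ℤ * (p * g) ≡ (+ 2 * f + - 1ℤ * p) * g
      ar′ = solve-∀

    ∑k : ∀ c → ∑ (k c) ≡ - (+ 30) * ∑ c
    ∑k c = trans (∑-lin (+ 2) c (- 1ℤ) (ap c))
          (trans (cong (λ s → + 2 * ∑ c + - 1ℤ * s) (∑ap c)) (ar (∑ c)))
      where
      ar : ∀ t → + 2 * t + - 1ℤ * (+ 32 * t) ≡ - (+ 30) * t
      ar = solve-∀

    ∑k² : ∀ c → ∑ (λ z → k c z * k c z) ≡ + 12 * (form c + ∑ c * ∑ c)
    ∑k² c = begin
      ∑ (λ z → k c z * k c z)      ≡⟨ sym (k-selfAdjoint c (k c)) ⟩
      ∑ (λ z → c z * k (k c) z)    ≡⟨ ∑-cong (λ z → trans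
                                        (cong (λ p → c z * (+ 2 * k c z + - 1ℤ * p)) (ap-k c z))
                                        (ar (c z) (k c z) (∑ c))) ⟩
      ∑ (λ z → + 12 * (c z * k c z) + + 12 * ∑ c * c z)
                                   ≡⟨ ∑-lin (+ 12) (λ z → c z * k c z) (+ 12 * ∑ c) c ⟩
      + 12 * form c + + 12 * ∑ c * ∑ c ≡⟨ ar′ (form c) (∑ c) ⟩
      + 12 * (form c + ∑ c * ∑ c)  ∎
      where
      open ≡-Reasoning
      ar : ∀ c k t → c * (+ 2 * k + - 1ℤ * (- (+ 10) * k + - (+ 12) * t)) ≡ + 12 * (c * k) + + 12 * t * c
      ar = solve-∀
      ar′ : ∀ f t → + 12 * f + + 12 * t * t ≡ + 12 * (f + t * t)
      ar′ = solve-∀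

  -- The value of ∑ (k z + a)(k z + a + 1) for a vector with form f and total t. As `k c` has mean
  -- -2t/7, the inequality is sharpest when -a and -a - 1 enclose that number; all choices of a
  -- below are of this kind.
  disc : ℤ → ℤ → ℤ → ℤ
  disc f t a = + 12 * (f + t * t) + (+ 2 * a + 1ℤ) * (- (+ 30) * t) + a * (a + 1ℤ) * + 105

  ∑disc : ∀ c a → ∑ (λ z → (k c z + a) * (k c z + a + 1ℤ)) ≡ disc (form c) (∑ c) a
  ∑disc c a = begin
    ∑ (λ z → (k c z + a) * (k c z + a + 1ℤ))
      ≡⟨ ∑-cong (λ z → ar (k c z) a) ⟩
    ∑ (λ z → 1ℤ * (k c z * k c z) + (+ 2 * a + 1ℤ) * k c z + a * (a + 1ℤ) * 1ℤ)
      ≡⟨ ∑-lin₃ 1ℤ (λ z → k c z * k c z) (+ 2 * a + 1ℤ) (k c) (a * (a + 1ℤ)) (λ _ → 1ℤ) ⟩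
    1ℤ * ∑ (λ z → k c z * k c z) + (+ 2 * a + 1ℤ) * ∑ (k c) + a * (a + 1ℤ) * ∑ (λ _ → 1ℤ)
      ≡⟨ cong₂ _+_ (cong₂ _+_ (trans (ℤₚ.*-identityˡ _) (∑k² c))
                              (cong ((+ 2 * a + 1ℤ) *_) (∑k c)))
                   (cong (a * (a + 1ℤ) *_) ∑1≡105) ⟩
    disc (form c) (∑ c) a ∎
    where
    open ≡-Reasoning
    ar : ∀ k a → (k + a) * (k + a + 1ℤ) ≡ 1ℤ * (k * k) + (+ 2 * a + 1ℤ) * k + a * (a + 1ℤ) * 1ℤ
    ar = solve-∀

  0≤disc : ∀ c a {f t} → form c ≡ f → ∑ c ≡ t → 0ℤ ≤ disc f t a
  0≤disc c a refl refl = subst (0ℤ ≤_) (∑disc c a) (∑-≥0 λ z → 0≤m[m+1] (k c z + a))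

  opaque
    unfolding k form

    shift : (V → ℤ) → ℤ → V → V → ℤ
    shift c ε z w = c w + ε * δ z w

    ∑shift : ∀ c ε z → ∑ (shift c ε z) ≡ ∑ c + ε
    ∑shift c ε z = trans (∑-+ c (λ w → ε * δ z w))
      (cong (_+_ (∑ c)) (trans (∑-* ε (δ z)) (trans (cong (ε *_) (∑-δ1 z)) (ℤₚ.*-identityʳ ε))))

    k-shift : ∀ c ε z w → k (shift c ε z) w ≡ k c w + ε * (+ 2 * δ z w + - 1ℤ * A z w)
    k-shift c ε z w = trans (cong (λ p → + 2 * (c w + ε * δ z w) + - 1ℤ * p) ap-shift)
                            (ar (c w) ε (δ z w) (ap c w) (A z w))
      where
      ar₀ : ∀ a c e d → a * (c + e * d) ≡ 1ℤ * (a * c) + e * (d * a)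
      ar₀ = solve-∀
      ap-shift : ap (shift c ε z) w ≡ 1ℤ * ap c w + ε * A z w
      ap-shift = trans (∑-cong λ v → ar₀ (A w v) (c v) ε (δ z v))
        (trans (∑-lin 1ℤ (λ v → A w v * c v) ε (λ v → δ z v * A w v))
               (cong (λ s → 1ℤ * ap c w + ε * s) (trans (∑-δ z (A w)) (A-sym w z))))
      ar : ∀ c e d p a → + 2 * (c + e * d) + - 1ℤ * (1ℤ * p + e * a)
                         ≡ + 2 * c + - 1ℤ * p + e * (+ 2 * d + - 1ℤ * a)
      ar = solve-∀

    -- Polarisation: `k` is self-adjoint and a single vertex has form 2.
    form-shift : ∀ c ε z → form (shift c ε z) ≡ form c + + 2 * ε * k c z + + 2 * ε * ε
    form-shift c ε z = begin
      ∑ (λ w → shift c ε z w * k (shift c ε z) w)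
        ≡⟨ ∑-cong (λ w → ar (c w) ε (δ z w) (k (shift c ε z) w)) ⟩
      ∑ (λ w → 1ℤ * (c w * k (shift c ε z) w) + ε * (δ z w * k (shift c ε z) w))
        ≡⟨ ∑-lin 1ℤ (λ w → c w * k (shift c ε z) w) ε (λ w → δ z w * k (shift c ε z) w) ⟩
      1ℤ * ∑ (λ w → c w * k (shift c ε z) w) + ε * ∑ (λ w → δ z w * k (shift c ε z) w)
        ≡⟨ cong₂ (λ s u → 1ℤ * s + ε * u) inner
             (trans (∑-δ z (k (shift c ε z)))
                    (trans (k-shift c ε z z)
                           (cong₂ (λ d a → k c z + ε * (+ 2 * d + - 1ℤ * a)) (δ-refl z) (A-irr z)))) ⟩
      1ℤ * (form c + ε * k c z) + ε * (k c z + ε * (+ 2 * 1ℤ + - 1ℤ * 0ℤ))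
        ≡⟨ ar′ (form c) ε (k c z) ⟩
      form c + + 2 * ε * k c z + + 2 * ε * ε ∎
      where
      open ≡-Reasoning
      ar : ∀ c e d k → (c + e * d) * k ≡ 1ℤ * (c * k) + e * (d * k)
      ar = solve-∀
      ar′ : ∀ f e k → 1ℤ * (f + e * k) + e * (k + e * (+ 2 * 1ℤ + - 1ℤ * 0ℤ)) ≡ f + + 2 * e * k + + 2 * e * e
      ar′ = solve-∀
      ar₁ : ∀ c k e d a → c * (k + e * (+ 2 * d + - 1ℤ * a))
                          ≡ 1ℤ * (c * k) + + 2 * e * (d * c) + - e * (a * c)
      ar₁ = solve-∀
      ar₂ : ∀ f e c p → 1ℤ * f + + 2 * e * c + - e * p ≡ f + e * (+ 2 * c + - 1ℤ * p)
      ar₂ = solve-∀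
      inner : ∑ (λ w → c w * k (shift c ε z) w) ≡ form c + ε * k c z
      inner = trans (∑-cong λ w → trans (cong (c w *_) (k-shift c ε z w))
                                        (ar₁ (c w) (k c w) ε (δ z w) (A z w)))
             (trans (∑-lin₃ 1ℤ (λ w → c w * k c w) (+ 2 * ε) (λ w → δ z w * c w) (- ε) (λ w → A z w * c w))
             (trans (cong (λ s → 1ℤ * form c + + 2 * ε * s + - ε * ap c z) (∑-δ z c))
                    (ar₂ (form c) ε (c z) (ap c z))))

-- Configurations excluded by integrality: four-cliques and roots.

absurd-≤ : ∀ {a b} {ℓ} {X : Set ℓ} → + a ≤ -[1+ b ] → X
absurd-≤ ()

0≤+ : ∀ {m} → 0ℤ ≤ + m
0≤+ = +≤+ z≤n

≤-gap : ∀ {a b} → ¬ (b ≤ a) → a + 1ℤ ≤ b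
≤-gap {a} {b} ¬p = subst (_≤ b) (ℤₚ.+-comm 1ℤ a) (ℤₚ.i<j⇒suc[i]≤j (ℤₚ.≰⇒> ¬p))

module Midpoints {n} (Γ : SimpleGraph n) (n≡105 : n ≡ 105) (srg : IsSRG Γ 32 4 12) where
  open Lattice Γ n≡105 srg public

  infix 4 _~_ _≁_
  _~_ _≁_ : V → V → Set
  x ~ y = A x y ≡ 1ℤ
  x ≁ y = A x y ≡ 0ℤ

  ~-sym : ∀ {x y} → x ~ y → y ~ x
  ~-sym {x} {y} e = trans (A-sym y x) e

  ≁-sym : ∀ {x y} → x ≁ y → y ≁ x
  ≁-sym {x} {y} e = trans (A-sym y x) e

  ~? : ∀ x y → x ~ y ⊎ x ≁ y
  ~? x y with A x y | A-bit x y
  ... | _ | b1 = inj₁ refl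
  ... | _ | b0 = inj₂ refl

  ~∧≁ : ∀ {x y} {ℓ} {X : Set ℓ} → x ~ y → x ≁ y → X
  ~∧≁ e f = contradiction (trans (sym f) e) 0≢1

  ~⇒≢ : ∀ {x y} → x ~ y → x ≢ y
  ~⇒≢ {x} e refl = ~∧≁ e (A-irr x)

  -- The number of common neighbours of three vertices, hence symmetric in all of them.
  T : V → V → V → ℤ
  T x a z = ap (N x a) z

  T-swap₁₂ : ∀ x a z → T x a z ≡ T a x z
  T-swap₁₂ x a z = ∑-cong λ w → cong (A z w *_) (ℤₚ.*-comm (A x w) (A a w))

  T-swap₂₃ : ∀ x a z → T x a z ≡ T x z a
  T-swap₂₃ x a z = ∑-cong λ w → ar (A x w) (A a w) (A z w)
    where
    ar : ∀ p q r → r * (p * q) ≡ q * (p * r)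
    ar = solve-∀

  T-swap₁₃ : ∀ x a z → T x a z ≡ T z a x
  T-swap₁₃ x a z = trans (T-swap₂₃ x a z) (trans (T-swap₁₂ x z a) (T-swap₂₃ z x a))

  T-bit : ∀ x a z w → Bit (A z w * N x a w)
  T-bit x a z w = bit-* (A-bit z w) (N-bit x a w)

  0≤T : ∀ x a z → 0ℤ ≤ T x a z
  0≤T x a z = ∑-≥0 λ w → bit-≥0 (T-bit x a z w)

  N≡1 : ∀ {x a w} → x ~ w → a ~ w → N x a w ≡ 1ℤ
  N≡1 e f = cong₂ _*_ e f

  N≡1⇒~ : ∀ {x a w} → N x a w ≡ 1ℤ → x ~ w × a ~ w
  N≡1⇒~ {x} {a} {w} e with A x w | A-bit x w | A a w | A-bit a w
  ... | _ | b1 | _ | b1 = refl , refl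
  ... | _ | b0 | _ | b1 = contradiction e 0≢1
  ... | _ | b0 | _ | b0 = contradiction e 0≢1
  ... | _ | b1 | _ | b0 = contradiction e 0≢1

  T≡0⇒ : ∀ {x a z} → T x a z ≡ 0ℤ → ∀ {w} → x ~ w → a ~ w → ¬ (z ~ w)
  T≡0⇒ {x} {a} {z} t≡0 {w} e f g = 0≢1
    (trans (sym (∑≡0⇒≡0 (λ v → bit-≥0 (T-bit x a z v)) t≡0 w)) (cong₂ _*_ g (N≡1 e f)))

  T≢0⇒ : ∀ {x a z} → T x a z ≢ 0ℤ → ∃ λ w → x ~ w × a ~ w × z ~ w
  T≢0⇒ {x} {a} {z} ne with ∑≢0⇒∃ ne
  ... | w , ne′ with N≡1⇒~ {x} {a} {w} (bit-≢0 (N-bit x a w) (*-≢0ʳ {A z w} ne′))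
  ...   | e , f = w , e , f , bit-≢0 (A-bit z w) (*-≢0ˡ {A z w} ne′)

  ⇒T≡0 : ∀ {x a z} → (∀ w → x ~ w → a ~ w → z ~ w → ⊥) → T x a z ≡ 0ℤ
  ⇒T≡0 {x} {a} {z} none with T x a z ℤₚ.≟ 0ℤ
  ... | yes e = e
  ... | no ne with T≢0⇒ ne
  ...   | w , e , f , g = ⊥-elim (none w e f g)

  T≥1 : ∀ {x a z w} → x ~ w → a ~ w → z ~ w → 1ℤ ≤ T x a z
  T≥1 {x} {a} {z} {w} e f g = subst (_≤ T x a z) (cong₂ _*_ g (N≡1 e f))
    (term≤∑ (λ v → bit-≥0 (T-bit x a z v)) w)

  ∑N-~ : ∀ {x a} → x ~ a → ∑ (N x a) ≡ + 4
  ∑N-~ {x} {a} e = trans (∑N x a)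
    (cong₂ (λ d b → + 20 * d + - (+ 8) * b + + 12) (δ-≢ (~⇒≢ e)) e)

  ∑N-≁ : ∀ {x a} → x ≢ a → x ≁ a → ∑ (N x a) ≡ + 12
  ∑N-≁ {x} {a} x≢a e = trans (∑N x a)
    (cong₂ (λ d b → + 20 * d + - (+ 8) * b + + 12) (δ-≢ x≢a) e)

  T-self : ∀ x a → T x a x ≡ ∑ (N x a)
  T-self x a = ∑-cong λ w → ar (A-bit x w) (A a w)
    where
    ar : ∀ {p} → Bit p → ∀ q → p * (p * q) ≡ p * q
    ar {p} b q = trans (sym (ℤₚ.*-assoc p p q)) (cong (_* q) (bit-idem b))

  k-at : ∀ c ε z w {κ d b} → k c w ≡ κ → δ z w ≡ d → A z w ≡ b →
         k (shift c ε z) w ≡ κ + ε * (+ 2 * d + - 1ℤ * b)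
  k-at c ε z w refl refl refl = k-shift c ε z w

  form-at : ∀ c ε z {f κ} → form c ≡ f → k c z ≡ κ →
            form (shift c ε z) ≡ f + + 2 * ε * κ + + 2 * ε * ε
  form-at c ε z refl refl = form-shift c ε z

  ∑-at : ∀ c ε z {t} → ∑ c ≡ t → ∑ (shift c ε z) ≡ t + ε
  ∑-at c ε z refl = ∑shift c ε z

  disc-mono : ∀ {f f′} t a → f ≤ f′ → disc f t a ≤ disc f′ t a
  disc-mono t a p = ℤₚ.+-monoˡ-≤ (a * (a + 1ℤ) * + 105)
    (ℤₚ.+-monoˡ-≤ ((+ 2 * a + 1ℤ) * (- (+ 30) * t))
      (ℤₚ.*-monoˡ-≤-nonNeg (+ 12) (ℤₚ.+-monoˡ-≤ (t * t) p)))

  -- Adding a vertex z to c changes the form by 2 (k c z) + 2, and `disc` is monotone in the form.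
  -- So a very negative `k c z` is impossible; `0≤disc⁻` excludes large values in the same way by
  -- subtracting z.
  0≤disc⁺ : ∀ c {f t} → form c ≡ f → ∑ c ≡ t → ∀ z {κ} → k c z ≤ κ → ∀ a →
            0ℤ ≤ disc (f + + 2 * κ + + 2) (t + 1ℤ) a
  0≤disc⁺ c {f} {t} ef et z {κ} p a = ℤₚ.≤-trans
    (0≤disc (shift c 1ℤ z) a (form-at c 1ℤ z ef refl) (∑-at c 1ℤ z et))
    (disc-mono (t + 1ℤ) a (ℤₚ.+-monoˡ-≤ (+ 2) (ℤₚ.+-monoʳ-≤ f (ℤₚ.*-monoˡ-≤-nonNeg (+ 2) p))))

  0≤disc⁻ : ∀ c {f t} → form c ≡ f → ∑ c ≡ t → ∀ z {κ} → κ ≤ k c z → ∀ a →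
            0ℤ ≤ disc (f + - (+ 2) * κ + + 2) (t + - 1ℤ) a
  0≤disc⁻ c {f} {t} ef et z {κ} p a = ℤₚ.≤-trans
    (0≤disc (shift c (- 1ℤ) z) a (form-at c (- 1ℤ) z ef refl) (∑-at c (- 1ℤ) z et))
    (disc-mono (t + - 1ℤ) a (ℤₚ.+-monoˡ-≤ (+ 2) (ℤₚ.+-monoʳ-≤ f (ℤₚ.*-monoˡ-≤-nonPos (- (+ 2)) p))))

  -- The sum of four pairwise adjacent vertices has form 4 * 2 - 12 = -4 and total 4, but `disc` is
  -- -6 at -4, 4, 1.
  no-K₄ : ∀ {x y z w} → x ~ y → x ~ z → x ~ w → y ~ z → y ~ w → z ~ w → ⊥
  no-K₄ {x} {y} {z} {w} xy xz xw yz yw zw = absurd-≤ (0≤disc c₄ 1ℤ f₄ t₄)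
    where
    c₀ c₁ c₂ c₃ c₄ : V → ℤ
    c₀ _ = 0ℤ
    c₁ = shift c₀ 1ℤ x
    c₂ = shift c₁ 1ℤ y
    c₃ = shift c₂ 1ℤ z
    c₄ = shift c₃ 1ℤ w
    d : ∀ {u v} → u ~ v → δ u v ≡ 0ℤ
    d e = δ-≢ (~⇒≢ e)
    k₀ : ∀ v → k c₀ v ≡ 0ℤ
    k₀ v = trans (k-def c₀ v) (cong (λ s → + 2 * 0ℤ + - 1ℤ * s) (trans (∑-cong λ u → ℤₚ.*-zeroʳ (A v u)) (∑0 n)))
    f₀ : form c₀ ≡ 0ℤ
    f₀ = trans (form-def c₀) (trans (∑-cong λ v → ℤₚ.*-zeroˡ (k c₀ v)) (∑0 n))
    k₁ : ∀ {v} → x ~ v → k c₁ v ≡ - 1ℤ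
    k₁ {v} e = k-at c₀ 1ℤ x v (k₀ v) (d e) e
    k₂ : ∀ {v} → x ~ v → y ~ v → k c₂ v ≡ - (+ 2)
    k₂ {v} e f = k-at c₁ 1ℤ y v (k₁ e) (d f) f
    k₃ : k c₃ w ≡ - (+ 3)
    k₃ = k-at c₂ 1ℤ z w (k₂ xw yw) (d zw) zw
    f₁ : form c₁ ≡ + 2
    f₁ = form-at c₀ 1ℤ x f₀ (k₀ x)
    f₂ : form c₂ ≡ + 2
    f₂ = form-at c₁ 1ℤ y f₁ (k₁ xy)
    f₃ : form c₃ ≡ 0ℤ
    f₃ = form-at c₂ 1ℤ z f₂ (k₂ xz yz)
    f₄ : form c₄ ≡ - (+ 4)
    f₄ = form-at c₃ 1ℤ w f₃ k₃
    t₄ : ∑ c₄ ≡ + 4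
    t₄ = ∑-at c₃ 1ℤ w (∑-at c₂ 1ℤ z (∑-at c₁ 1ℤ y (∑-at c₀ 1ℤ x (∑0 n))))

  -- A vector with form −12 and total 7 would be a root of the lattice: its
  -- inner products with the vertices are 1 on a set P, −1 on a set M and 0
  -- elsewhere, with |P| = |M| = 12, and 1_P − 1_M is an eigenvector for −10.
  -- This makes P and M so densely joined that ∑disc fails for 1_P.
  no-root : ∀ c → form c ≡ - (+ 12) → ∑ c ≡ + 7 → ⊥
  no-root c f≡ t≡ = absurd-≤ (ℤₚ.≤-trans (ℤₚ.i≤j⇒0≤j-i final) bound)
    where
    data Trit : ℤ → ℤ → ℤ → Set where
      pos : Trit (- 1ℤ) 1ℤ 0ℤ
      nul : Trit (- (+ 2)) 0ℤ 0ℤ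
      neg : Trit (- (+ 3)) 0ℤ 1ℤ

    P′ M′ : ℤ → ℤ
    P′ -[1+ 0 ] = 1ℤ
    P′ _        = 0ℤ
    M′ -[1+ 2 ] = 1ℤ
    M′ _        = 0ℤ

    P M p : V → ℤ
    P z = P′ (k c z)
    M z = M′ (k c z)
    p = ap P

    trit : ∀ z → Trit (k c z) (P z) (M z)
    trit z with k c z in eq
    -- Subtracting such a z leaves form at most -10 and total 6; in the last case, adding z gives
    -- form at most -18 and total 8. `disc` is at most -18 both times.
    ... | + m = absurd-≤ (0≤disc⁻ c f≡ t≡ z {0ℤ} (subst (0ℤ ≤_) (sym eq) 0≤+) 1ℤ)
    ... | -[1+ 0 ] = pos
    ... | -[1+ 1 ] = nul
    ... | -[1+ 2 ] = neg
    ... | -[1+ suc (suc (suc m)) ] =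
      absurd-≤ (0≤disc⁺ c f≡ t≡ z { - (+ 4)} (subst (_≤ - (+ 4)) (sym eq) (-≤- (s≤s (s≤s (s≤s z≤n))))) (+ 2))

    half : ∀ {s} → + 2 * s ≡ + 24 → s ≡ + 12
    half {s} e = ℤₚ.*-cancelˡ-≡ (+ 2) s (+ 12) e

    ∑P : ∑ P ≡ + 12
    ∑P = half (trans (sym (∑-* (+ 2) P)) (trans (∑-cong λ z → lem (trit z))
           (trans (∑disc c (+ 2)) (cong₂ (λ f t → disc f t (+ 2)) f≡ t≡))))
      where
      lem : ∀ {κ P M} → Trit κ P M → + 2 * P ≡ (κ + + 2) * (κ + + 2 + 1ℤ)
      lem pos = refl
      lem nul = refl
      lem neg = refl

    ∑M : ∑ M ≡ + 12
    ∑M = half (trans (sym (∑-* (+ 2) M)) (trans (∑-cong λ z → lem (trit z))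
           (trans (∑disc c 1ℤ) (cong₂ (λ f t → disc f t 1ℤ) f≡ t≡))))
      where
      lem : ∀ {κ P M} → Trit κ P M → + 2 * M ≡ (κ + 1ℤ) * (κ + 1ℤ + 1ℤ)
      lem pos = refl
      lem nul = refl
      lem neg = refl

    -- The eigenvector equation for `P` minus `M`: as `k c` = P - M - 2, the constants in `ap-k`
    -- cancel by -64 = 20 - 84.
    p-eq : ∀ z → p z ≡ ap M z + - (+ 10) * P z + + 10 * M z
    p-eq z = begin
      ∑ (λ w → A z w * P w)
        ≡⟨ ∑-cong (λ w → trans (cong (A z w *_) (lem (trit w))) (ar (A z w) (k c w) (M w))) ⟩
      ∑ (λ w → 1ℤ * (A z w * k c w) + + 2 * A z w + 1ℤ * (A z w * M w))
        ≡⟨ ∑-lin₃ 1ℤ (λ w → A z w * k c w) (+ 2) (A z) 1ℤ (λ w → A z w * M w) ⟩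
      1ℤ * ap (k c) z + + 2 * ∑ (A z) + 1ℤ * ap M z
        ≡⟨ cong₂ (λ s u → 1ℤ * s + + 2 * u + 1ℤ * ap M z)
                 (trans (ap-k c z) (cong₂ (λ u t → - (+ 10) * u + - (+ 12) * t) (lem′ (trit z)) t≡)) (∑A z) ⟩
      1ℤ * (- (+ 10) * (P z + - 1ℤ * M z + - (+ 2)) + - (+ 12) * + 7) + + 2 * + 32 + 1ℤ * ap M z
        ≡⟨ ar′ (P z) (M z) (ap M z) ⟩
      ap M z + - (+ 10) * P z + + 10 * M z ∎
      where
      open ≡-Reasoning
      lem : ∀ {κ P M} → Trit κ P M → P ≡ κ + + 2 + M
      lem pos = refl
      lem nul = refl
      lem neg = refl
      lem′ : ∀ {κ P M} → Trit κ P M → κ ≡ P + - 1ℤ * M + - (+ 2)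
      lem′ pos = refl
      lem′ nul = refl
      lem′ neg = refl
      ar : ∀ a k m → a * (k + + 2 + m) ≡ 1ℤ * (a * k) + + 2 * a + 1ℤ * (a * m)
      ar = solve-∀
      ar′ : ∀ P M m → 1ℤ * (- (+ 10) * (P + - 1ℤ * M + - (+ 2)) + - (+ 12) * + 7) + + 2 * + 32 + 1ℤ * m
                      ≡ m + - (+ 10) * P + + 10 * M
      ar′ = solve-∀

    -- Twice the number of edges inside `P`. By `∑Mp` there are then `g + 120` edges between `P` and
    -- `M`, out of 144 possible ones.
    g : ℤ
    g = ∑ λ z → P z * p z

    0≤g : 0ℤ ≤ g
    0≤g = ∑-≥0 λ z → *-≥0 (0≤P z) (∑-≥0 λ w → *-≥0 (bit-≥0 (A-bit z w)) (0≤P w))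
      where
      lem : ∀ {κ P M} → Trit κ P M → 0ℤ ≤ P
      lem pos = 0≤+
      lem nul = 0≤+
      lem neg = 0≤+
      0≤P : ∀ z → 0ℤ ≤ P z
      0≤P z = lem (trit z)

    ∑Mp : ∑ (λ z → M z * p z) ≡ g + + 120
    ∑Mp = begin
      ∑ (λ z → M z * p z)      ≡⟨ ap-selfAdjoint M P ⟩
      ∑ (λ z → ap M z * P z)   ≡⟨ ∑-cong (λ z → trans (lem (trit z) (ap M z)) (cong (λ q → 1ℤ * (P z * q) + + 10 * P z) (sym (p-eq z)))) ⟩
      ∑ (λ z → 1ℤ * (P z * p z) + + 10 * P z) ≡⟨ ∑-lin 1ℤ (λ z → P z * p z) (+ 10) P ⟩
      1ℤ * g + + 10 * ∑ P      ≡⟨ cong₂ _+_ (ℤₚ.*-identityˡ g) (cong (+ 10 *_) ∑P) ⟩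
      g + + 120                ∎
      where
      open ≡-Reasoning
      ar₁ : ∀ m → m * 1ℤ ≡ 1ℤ * (1ℤ * (m + - (+ 10) * 1ℤ + + 10 * 0ℤ)) + + 10 * 1ℤ
      ar₁ = solve-∀
      ar₂ : ∀ m → m * 0ℤ ≡ 1ℤ * (0ℤ * (m + - (+ 10) * 0ℤ + + 10 * 0ℤ)) + + 10 * 0ℤ
      ar₂ = solve-∀
      ar₃ : ∀ m → m * 0ℤ ≡ 1ℤ * (0ℤ * (m + - (+ 10) * 0ℤ + + 10 * 1ℤ)) + + 10 * 0ℤ
      ar₃ = solve-∀
      lem : ∀ {κ P M} → Trit κ P M → ∀ m → m * P ≡ 1ℤ * (P * (m + - (+ 10) * P + + 10 * M)) + + 10 * P
      lem pos = ar₁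
      lem nul = ar₂
      lem neg = ar₃

    formP : form P ≡ + 24 + - 1ℤ * g
    formP = trans (form-def P) (trans (∑-cong λ z → trans (cong (P z *_) (k-def P z)) (lem (trit z) (p z)))
      (trans (∑-lin (+ 2) P (- 1ℤ) (λ z → P z * p z)) (cong (λ s → + 2 * s + - 1ℤ * g) ∑P)))
      where
      ar₁ : ∀ m → 1ℤ * (+ 2 * 1ℤ + - 1ℤ * m) ≡ + 2 * 1ℤ + - 1ℤ * (1ℤ * m)
      ar₁ = solve-∀
      ar₂ : ∀ m → 0ℤ * (+ 2 * 0ℤ + - 1ℤ * m) ≡ + 2 * 0ℤ + - 1ℤ * (0ℤ * m)
      ar₂ = solve-∀
      lem : ∀ {κ P M} → Trit κ P M → ∀ m → P * (+ 2 * P + - 1ℤ * m) ≡ + 2 * P + - 1ℤ * (P * m)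
      lem pos = ar₁
      lem nul = ar₂
      lem neg = ar₂

    -- The right-hand sides are tangent lines at p = 0 (on P) and p = 10 (on M).
    tangent : ∀ z → + 30 * P z + - (+ 11) * (P z * p z) + (+ 13 * (M z * p z) + - (+ 88) * M z)
                    ≤ (k P z + + 3) * (k P z + + 3 + 1ℤ)
    tangent z = subst (λ κ → + 30 * P z + - (+ 11) * (P z * p z) + (+ 13 * (M z * p z) + - (+ 88) * M z)
                             ≤ (κ + + 3) * (κ + + 3 + 1ℤ))
                      (sym (k-def P z)) (lem (trit z) (p z))
      where
      ar₁ : ∀ p → (+ 2 * 1ℤ + - 1ℤ * p + + 3) * (+ 2 * 1ℤ + - 1ℤ * p + + 3 + 1ℤ)
                  ≡ + 30 * 1ℤ + - (+ 11) * (1ℤ * p) + (+ 13 * (0ℤ * p) + - (+ 88) * 0ℤ) + p * p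
      ar₁ = solve-∀
      ar₂ : ∀ p → 0ℤ ≡ + 30 * 0ℤ + - (+ 11) * (0ℤ * p) + (+ 13 * (0ℤ * p) + - (+ 88) * 0ℤ)
      ar₂ = solve-∀
      ar₃ : ∀ p → (+ 2 * 0ℤ + - 1ℤ * p + + 3) * (+ 2 * 0ℤ + - 1ℤ * p + + 3 + 1ℤ)
                  ≡ + 30 * 0ℤ + - (+ 11) * (0ℤ * p) + (+ 13 * (1ℤ * p) + - (+ 88) * 1ℤ)
                    + (p + - (+ 10)) * (p + - (+ 10))
      ar₃ = solve-∀
      above : ∀ a b {c} → c ≡ a + b → 0ℤ ≤ b → a ≤ c
      above a b refl q = subst (_≤ a + b) (ℤₚ.+-identityʳ a) (ℤₚ.+-monoʳ-≤ a q)
      lem : ∀ {κ P M} → Trit κ P M → ∀ p →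
            + 30 * P + - (+ 11) * (P * p) + (+ 13 * (M * p) + - (+ 88) * M)
            ≤ (+ 2 * P + - 1ℤ * p + + 3) * (+ 2 * P + - 1ℤ * p + + 3 + 1ℤ)
      lem pos p = above _ _ (ar₁ p) (0≤m² p)
      lem nul p = subst (_≤ (+ 2 * 0ℤ + - 1ℤ * p + + 3) * (+ 2 * 0ℤ + - 1ℤ * p + + 3 + 1ℤ))
                        (ar₂ p) (0≤m[m+1] (+ 2 * 0ℤ + - 1ℤ * p + + 3))
      lem neg p = above _ _ (ar₃ p) (0≤m² (p + - (+ 10)))

    -- With the values of the four sums this reads 864 + 2 g ≤ 756 - 12 g, against g ≥ 0.
    final : + 30 * ∑ P + - (+ 11) * g + (+ 13 * ∑ (λ z → M z * p z) + - (+ 88) * ∑ M)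
            ≤ disc (form P) (∑ P) (+ 3)
    final = subst₂ _≤_
      (trans (∑-+ (λ z → + 30 * P z + - (+ 11) * (P z * p z)) (λ z → + 13 * (M z * p z) + - (+ 88) * M z))
             (cong₂ _+_ (∑-lin (+ 30) P (- (+ 11)) (λ z → P z * p z))
                        (∑-lin (+ 13) (λ z → M z * p z) (- (+ 88)) M)))
      (∑disc P (+ 3))
      (∑-≤ tangent)

    ar : ∀ g → + 12 * (+ 24 + - 1ℤ * g + + 144) + (+ 2 * + 3 + 1ℤ) * (- (+ 30) * + 12) + + 3 * (+ 3 + 1ℤ) * + 105
               - (+ 360 + - (+ 11) * g + (+ 13 * (g + + 120) + - (+ 1056)))
               ≡ - (+ 14) * g + - (+ 108)
    ar = solve-∀

    bound : disc (form P) (∑ P) (+ 3)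
            - (+ 30 * ∑ P + - (+ 11) * g + (+ 13 * ∑ (λ z → M z * p z) + - (+ 88) * ∑ M))
            ≤ - (+ 108)
    bound = subst (_≤ - (+ 108))
      (trans (sym (ar g))
             (sym (cong₂ _-_
               (cong₂ (λ f t → disc f t (+ 3)) formP ∑P)
               (cong₂ _+_ (cong (λ s → + 30 * s + - (+ 11) * g) ∑P)
                          (cong₂ (λ s u → + 13 * s + - (+ 88) * u) ∑Mp ∑M)))))
      (ℤₚ.+-monoˡ-≤ (- (+ 108)) (ℤₚ.*-monoˡ-≤-nonPos (- (+ 14)) 0≤g))

-- Existence of midpoints and the identity they satisfy.

module Edges {n} (Γ : SimpleGraph n) (n≡105 : n ≡ 105) (srg : IsSRG Γ 32 4 12) where
  open Midpoints Γ n≡105 srg public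

  κ : V → V → ℤ
  κ x z = + 2 * δ x z + - 1ℤ * A x z

  -- For an edge x a with common neighbours Q the lattice vector
  -- 2 x + 2 a + ∑ Q coincides with some vertex y; this is the coordinatewise
  -- form of that identity.
  record Mid (x a y : V) : Set where
    constructor mid
    field
      T-mid : ∀ z → T x a z ≡ + 2 * N x a z + + 2 * κ x z + + 2 * κ a z + - 1ℤ * κ y z + + 2
  open Mid public

  module _ {x a : V} (xa : x ~ a) where
    private
      δxa : δ x a ≡ 0ℤ
      δxa = δ-≢ (~⇒≢ xa)

      Q c₁ c : V → ℤ
      Q  = N x a
      c₁ = shift Q (+ 2) x
      c  = shift c₁ (+ 2) a

      Q-at : ∀ {z t} → N x a z ≡ 0ℤ → T x a z ≡ t → k Q z ≡ + 2 * 0ℤ + - 1ℤ * t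
      Q-at {z} e f = trans (k-def Q z) (cong₂ (λ s u → + 2 * s + - 1ℤ * u) e f)

      kQx : k Q x ≡ - (+ 4)
      kQx = Q-at (cong (_* A a x) (A-irr x)) (trans (T-self x a) (∑N-~ xa))

      kQa : k Q a ≡ - (+ 4)
      kQa = Q-at (trans (cong (A x a *_) (A-irr a)) (ℤₚ.*-zeroʳ (A x a)))
                 (trans (T-swap₁₂ x a a) (trans (T-self a x) (∑N-~ (~-sym xa))))

      -- By `no-K₄` the four common neighbours of an edge are pairwise nonadjacent, so they
      -- contribute only their own forms.
      kQQ : ∀ z → N x a z * k Q z ≡ + 2 * N x a z
      kQQ z = trans (cong (N x a z *_) (k-def Q z)) (go (N-bit x a z) refl)
        where
        go : ∀ {q} → Bit q → N x a z ≡ q → q * (+ 2 * q + - 1ℤ * T x a z) ≡ + 2 * q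
        go b0 _ = ℤₚ.*-zeroˡ (+ 2 * 0ℤ + - 1ℤ * T x a z)
        go b1 eq = cong (λ t → 1ℤ * (+ 2 * 1ℤ + - 1ℤ * t)) (⇒T≡0 {x} {a} {z} λ w xw aw zw →
          let xz , az = N≡1⇒~ {x} {a} {z} eq in no-K₄ xa xz xw az aw zw)

      formQ : form Q ≡ + 8
      formQ = trans (form-def Q) (trans (∑-cong kQQ) (trans (∑-* (+ 2) Q) (cong (+ 2 *_) (∑N-~ xa))))

      k₁a : k c₁ a ≡ - (+ 6)
      k₁a = k-at Q (+ 2) x a kQa δxa xa

      -- Together with `∑c` the norm is 7 * (-16) + 2 * 64 = 16, that of a single vertex, which is
      -- why c can coincide with one.
      form-c : form c ≡ - (+ 16)
      form-c = form-at c₁ (+ 2) a (form-at Q (+ 2) x formQ kQx) k₁a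

      ∑c : ∑ c ≡ + 8
      ∑c = ∑-at c₁ (+ 2) a (∑-at Q (+ 2) x (∑N-~ xa))

      ∑6 : ∑ (λ z → (k c z + + 2) * (k c z + + 2 + 1ℤ)) ≡ + 6
      ∑6 = trans (∑disc c (+ 2)) (cong₂ (λ f t → disc f t (+ 2)) form-c ∑c)

      -- The sum 6 forces a vertex whose value is neither -2 nor -3. The value -1 would make c minus
      -- that vertex a root, and positive values or values below -3 violate `0≤disc`, so only 0 is
      -- left.
      zero-of-k : ∃ λ y → k c y ≡ 0ℤ
      zero-of-k = y , go (k c y) refl ne
        where
        nonzero : ∃ λ y → (k c y + + 2) * (k c y + + 2 + 1ℤ) ≢ 0ℤ
        nonzero = ∑≢0⇒∃ (λ e → contradiction (trans (sym ∑6) e) λ ())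
        y : V
        y = proj₁ nonzero
        ne : (k c y + + 2) * (k c y + + 2 + 1ℤ) ≢ 0ℤ
        ne = proj₂ nonzero
        go : ∀ v → k c y ≡ v → (v + + 2) * (v + + 2 + 1ℤ) ≢ 0ℤ → k c y ≡ 0ℤ
        go (+ 0) eq _ = eq
        go (+ suc m) eq _ = absurd-≤ (0≤disc⁻ c form-c ∑c y {1ℤ}
          (subst (1ℤ ≤_) (sym eq) (+≤+ (s≤s z≤n))) (+ 2))
        go -[1+ 0 ] eq _ = ⊥-elim
          (no-root (shift c (- 1ℤ) y) (form-at c (- 1ℤ) y form-c eq) (∑-at c (- 1ℤ) y ∑c))
        go -[1+ 1 ] _ ne = contradiction refl ne
        go -[1+ 2 ] _ ne = contradiction refl ne
        go -[1+ suc (suc (suc m)) ] eq _ = absurd-≤ (0≤disc⁺ c form-c ∑c y { - (+ 4)}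
          (subst (_≤ - (+ 4)) (sym eq) (-≤- (s≤s (s≤s (s≤s z≤n))))) (+ 2))

    opaque
      -- Now c minus y has form -14 and total 7, hence norm 0. Accordingly `disc` vanishes for both
      -- a = 2 and a = 1, so every coordinate of k is a common root of (k + 2)(k + 3) and (k + 1)(k
      -- + 2), that is, -2.
      midpoint : ∃ λ y → Mid x a y
      midpoint with zero-of-k
      ... | y , ky≡0 = y , mid λ z → solve-T z (k′≡-2 z)
        where
        c′ : V → ℤ
        c′ = shift c (- 1ℤ) y

        form-c′ : form c′ ≡ - (+ 14)
        form-c′ = form-at c (- 1ℤ) y form-c ky≡0

        ∑c′ : ∑ c′ ≡ + 7
        ∑c′ = ∑-at c (- 1ℤ) y ∑c

        vanish : ∀ a → disc (- (+ 14)) (+ 7) a ≡ 0ℤ → ∀ z → (k c′ z + a) * (k c′ z + a + 1ℤ) ≡ 0ℤ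
        vanish a e = ∑≡0⇒≡0 (λ z → 0≤m[m+1] (k c′ z + a))
          (trans (∑disc c′ a) (trans (cong₂ (λ f t → disc f t a) form-c′ ∑c′) e))

        ar : ∀ κ → + 2 * (κ + + 2) ≡ (κ + + 2) * (κ + + 2 + 1ℤ) + - 1ℤ * ((κ + 1ℤ) * (κ + 1ℤ + 1ℤ))
        ar = solve-∀

        k′≡-2 : ∀ z → k c′ z + + 2 ≡ 0ℤ
        k′≡-2 z = ℤₚ.*-cancelˡ-≡ (+ 2) (k c′ z + + 2) 0ℤ
          (trans (ar (k c′ z)) (cong₂ (λ s u → s + - 1ℤ * u) (vanish (+ 2) refl z) (vanish 1ℤ refl z)))

        ar′ : ∀ q t u v w → t ≡ + 2 * q + + 2 * u + + 2 * v + - 1ℤ * w + + 2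
                                + - 1ℤ * (+ 2 * q + - 1ℤ * t + + 2 * u + + 2 * v + - 1ℤ * w + + 2)
        ar′ = solve-∀

        expand : ∀ z → k c′ z ≡ + 2 * N x a z + - 1ℤ * T x a z + + 2 * κ x z + + 2 * κ a z + - 1ℤ * κ y z
        expand z = trans (k-shift c (- 1ℤ) y z) (cong (_+ - 1ℤ * κ y z)
          (trans (k-shift c₁ (+ 2) a z) (cong (_+ + 2 * κ a z) (trans (k-shift Q (+ 2) x z) (cong (_+ + 2 * κ x z) (k-def Q z))))))

        solve-T : ∀ z → k c′ z + + 2 ≡ 0ℤ →
          T x a z ≡ + 2 * N x a z + + 2 * κ x z + + 2 * κ a z + - 1ℤ * κ y z + + 2
        solve-T z e = trans (ar′ (N x a z) (T x a z) (κ x z) (κ a z) (κ y z))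
          (trans (cong (λ s → rhs + - 1ℤ * s) (trans (cong (_+ + 2) (sym (expand z))) e)) (ℤₚ.+-identityʳ rhs))
          where
          rhs : ℤ
          rhs = + 2 * N x a z + + 2 * κ x z + + 2 * κ a z + - 1ℤ * κ y z + + 2

  module _ {x a y : V} (xa : x ~ a) (m : Mid x a y) where
    mid-swap : Mid a x y
    mid-swap = mid λ z → trans (T-swap₁₂ a x z) (trans (T-mid m z) (trans
      (cong (λ q → + 2 * q + + 2 * κ x z + + 2 * κ a z + - 1ℤ * κ y z + + 2) (ℤₚ.*-comm (A x z) (A a z)))
      (ar (N a x z) (κ x z) (κ a z) (κ y z))))
      where
      ar : ∀ q u v w → + 2 * q + + 2 * u + + 2 * v + - 1ℤ * w + + 2
                       ≡ + 2 * q + + 2 * v + + 2 * u + - 1ℤ * w + + 2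
      ar = solve-∀

    private
      κ-at : ∀ {x z d b} → δ x z ≡ d → A x z ≡ b → κ x z ≡ + 2 * d + - 1ℤ * b
      κ-at = cong₂ λ d b → + 2 * d + - 1ℤ * b

      mid-at : ∀ z {q u v w} → N x a z ≡ q → κ x z ≡ u → κ a z ≡ v → κ y z ≡ w →
        T x a z ≡ + 2 * q + + 2 * u + + 2 * v + - 1ℤ * w + + 2
      mid-at z refl refl refl refl = T-mid m z

    -- At z = x the identity of `Mid` reads 4 = 4 - κ y x, and κ y x would be 2 for y = x and -1 for
    -- y adjacent to x.
    mid-≁ˡ×≢ : y ≁ x × y ≢ x
    mid-≁ˡ×≢ = lem (A-bit y x) (δ-bit y x) refl
      (trans (sym (trans (T-self x a) (∑N-~ xa)))
             (mid-at x (cong (_* A a x) (A-irr x)) (κ-at {x} (δ-refl x) (A-irr x))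
                       (κ-at {a} (δ-≢ (~⇒≢ (~-sym xa))) (~-sym xa)) refl))
      where
      lem : ∀ {Y d} → Bit Y → Bit d → δ y x ≡ d →
            + 4 ≡ + 2 * 0ℤ + + 2 * + 2 + + 2 * - 1ℤ + - 1ℤ * (+ 2 * d + - 1ℤ * Y) + + 2 →
            Y ≡ 0ℤ × y ≢ x
      lem b0 b0 e _ = refl , λ { refl → 0≢1 (trans (sym e) (δ-refl y)) }
      lem b0 b1 e ()
      lem b1 b0 e ()
      lem b1 b1 e ()

    mid-≁ˡ : y ≁ x
    mid-≁ˡ = proj₁ mid-≁ˡ×≢

    mid-≢ˡ : y ≢ x
    mid-≢ˡ = proj₂ mid-≁ˡ×≢

    -- For z adjacent to x the terms in `A a z` cancel. Whether x, a and z have a common neighbour,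
    -- which is then unique, is thus decided by one vertex y.
    T-near : ∀ {z} → x ~ z → z ≢ a → T x a z ≡ A y z
    T-near {z} xz z≢a = trans
      (mid-at z (cong (_* A a z) xz) (κ-at {x} (δ-≢ (~⇒≢ xz)) xz) (κ-at {a} (δ-≢ (z≢a ∘ sym)) refl)
                (κ-at {y} (δ-≢ {i = y} {z} λ { refl → ~∧≁ xz (≁-sym mid-≁ˡ) }) refl))
      (lem (A-bit a z) (A-bit y z))
      where
      lem : ∀ {B Y} → Bit B → Bit Y →
            + 2 * (1ℤ * B) + + 2 * - 1ℤ + + 2 * (+ 2 * 0ℤ + - 1ℤ * B) + - 1ℤ * (+ 2 * 0ℤ + - 1ℤ * Y) + + 2 ≡ Y
      lem b0 b0 = refl
      lem b0 b1 = refl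
      lem b1 b0 = refl
      lem b1 b1 = refl

    -- Away from x and a the identity reads T = 2 - κ y z; the indices of the constructors are the
    -- values of T.
    data Far (z : V) (t : ℤ) : Set where
      far₀ : y ≡ z → t ≡ 0ℤ → Far z t
      far₃ : y ≢ z → y ~ z → t ≡ + 3 → Far z t
      far₂ : y ≢ z → y ≁ z → t ≡ + 2 → Far z t

    opaque
      far : ∀ {z} → x ≁ z → a ≁ z → z ≢ x → z ≢ a → Far z (T x a z)
      far {z} xz az z≢x z≢a with y ≟ z
      ... | yes refl = far₀ refl (on refl (κ-at {y} (δ-refl y) (A-irr y)))
        where
        on : ∀ {w} → y ≡ z → κ y z ≡ w → T x a z ≡ + 2 * 0ℤ + + 2 * 0ℤ + + 2 * 0ℤ + - 1ℤ * w + + 2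
        on _ = mid-at z (cong₂ _*_ xz az) (κ-at {x} (δ-≢ (z≢x ∘ sym)) xz) (κ-at {a} (δ-≢ (z≢a ∘ sym)) az)
      ... | no  y≢z with ~? y z
      ...   | inj₁ yz = far₃ y≢z yz (mid-at z (cong₂ _*_ xz az) (κ-at {x} (δ-≢ (z≢x ∘ sym)) xz)
                          (κ-at {a} (δ-≢ (z≢a ∘ sym)) az) (κ-at {y} (δ-≢ y≢z) yz))
      ...   | inj₂ yz = far₂ y≢z yz (mid-at z (cong₂ _*_ xz az) (κ-at {x} (δ-≢ (z≢x ∘ sym)) xz)
                          (κ-at {a} (δ-≢ (z≢a ∘ sym)) az) (κ-at {y} (δ-≢ y≢z) yz))

  mid-≁ʳ : ∀ {x a y} → x ~ a → Mid x a y → y ≁ a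
  mid-≁ʳ xa m = mid-≁ˡ (~-sym xa) (mid-swap xa m)

  mid-≢ʳ : ∀ {x a y} → x ~ a → Mid x a y → y ≢ a
  mid-≢ʳ xa m = mid-≢ˡ (~-sym xa) (mid-swap xa m)

-- Common neighbours of a vertex and a midpoint.

module Specials {n} (Γ : SimpleGraph n) (n≡105 : n ≡ 105) (srg : IsSRG Γ 32 4 12) where
  open Edges Γ n≡105 srg public

  T-mid≡0 : ∀ {x a y} → x ~ a → Mid x a y → T x a y ≡ 0ℤ
  T-mid≡0 xa m with far xa m (≁-sym (mid-≁ˡ xa m)) (≁-sym (mid-≁ʳ xa m)) (mid-≢ˡ xa m) (mid-≢ʳ xa m)
  ... | far₀ _ e = e
  ... | far₃ ne _ _ = contradiction refl ne
  ... | far₂ ne _ _ = contradiction refl ne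

  -- Of the three values in `Far` only that at the midpoint is 0. This characterises the midpoint
  -- and gives its uniqueness in `Mid⇒m`.
  far-T≡0 : ∀ {x a y z} → x ~ a → Mid x a y → x ≁ z → a ≁ z → z ≢ x → z ≢ a → T x a z ≡ 0ℤ → y ≡ z
  far-T≡0 xa m xz az z≢x z≢a e with far xa m xz az z≢x z≢a
  ... | far₀ p _ = p
  ... | far₃ _ _ f = contradiction (trans (sym e) f) λ ()
  ... | far₂ _ _ f = contradiction (trans (sym e) f) λ ()

  opaque
    m : V → V → V
    m x a with ~? x a
    ... | inj₁ xa = proj₁ (midpoint xa)
    -- A dummy value: `F` and `Sp` consult `m` only together with an adjacency.
    ... | inj₂ _  = x

    m-mid : ∀ {x a} → x ~ a → Mid x a (m x a)
    m-mid {x} {a} xa with ~? x a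
    ... | inj₁ xa′ = proj₂ (midpoint xa′)
    ... | inj₂ nxa = ~∧≁ xa nxa

  Mid⇒m : ∀ {x a y} → x ~ a → Mid x a y → m x a ≡ y
  Mid⇒m xa μ = far-T≡0 xa (m-mid xa) (≁-sym (mid-≁ˡ xa μ)) (≁-sym (mid-≁ʳ xa μ))
                        (mid-≢ˡ xa μ) (mid-≢ʳ xa μ) (T-mid≡0 xa μ)

  m⇒Mid : ∀ {x a y} → x ~ a → m x a ≡ y → Mid x a y
  m⇒Mid xa refl = m-mid xa

  m-comm : ∀ {x a} → x ~ a → m x a ≡ m a x
  m-comm xa = Mid⇒m xa (mid-swap (~-sym xa) (m-mid (~-sym xa)))

  -- If y were adjacent to q, then by `T-near` the triangle x a q would have a common neighbour,
  -- completing a four-clique.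
  ≁-mid-common : ∀ {x a y q} → x ~ a → Mid x a y → x ~ q → a ~ q → y ≁ q
  ≁-mid-common {x} {a} {y} {q} xa μ xq aq = trans (sym (T-near xa μ xq (~⇒≢ (~-sym aq))))
    (⇒T≡0 λ w xw aw qw → no-K₄ xa xq xw aq aw qw)

  -- Besides a, the edge x q has three common neighbours w. Each has q as a common neighbour with x
  -- and a, so `T-near` makes w adjacent to y.
  T-mid-common≥3 : ∀ {x a y q} → x ~ a → Mid x a y → x ~ q → a ~ q → + 3 ≤ T x q y
  T-mid-common≥3 {x} {a} {y} {q} xa μ xq aq = subst (_≤ T x q y) total (∑-≤ λ w → step w (N-bit x q w) refl)
    where
    total : ∑ (λ w → 1ℤ * N x q w + - 1ℤ * (δ a w * N x q w)) ≡ + 3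
    total = trans (∑-lin 1ℤ (N x q) (- 1ℤ) (λ w → δ a w * N x q w))
      (cong₂ (λ s u → 1ℤ * s + - 1ℤ * u) (∑N-~ xq) (trans (∑-δ a (N x q)) (N≡1 xa (~-sym aq))))
    step : ∀ w {q′} → Bit q′ → N x q w ≡ q′ →
           1ℤ * q′ + - 1ℤ * (δ a w * q′) ≤ A y w * q′
    step w b0 _ = ℤₚ.≤-reflexive (trans (cong (λ s → 0ℤ + - 1ℤ * s) (ℤₚ.*-zeroʳ (δ a w))) (sym (ℤₚ.*-zeroʳ (A y w))))
    step w b1 e with N≡1⇒~ {x} {q} {w} e
    ... | xw , qw with a ≟ w
    ...   | yes refl = bit-≥0 (bit-* (A-bit y w) b1)
    ...   | no  a≢w  = ℤₚ.≤-trans (ℤₚ.≤-trans (T≥1 xq aq (~-sym qw)) (ℤₚ.≤-reflexive (T-near xa μ xw (a≢w ∘ sym))))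
                                  (ℤₚ.≤-reflexive (sym (ℤₚ.*-identityʳ (A y w))))

  opaque
    -- Two counts of the adjacent pairs between the common neighbours of x, y and those of x, s. An
    -- edge s s′ makes w = `m x s` adjacent to y. The first count is then T x y w + 4, at most 7. In
    -- the second, each of the four common neighbours t of x and s contributes at least 2, or at
    -- least 1 for the single t adjacent to y; but the one also adjacent to a contributes at least
    -- 3, which makes 8.
    mid-independent : ∀ {x a y s s′} → x ~ a → Mid x a y → x ~ s → x ~ s′ → y ~ s → y ~ s′ → s ~ s′ → ⊥
    mid-independent {x} {a} {y} {s} {s′} xa μ xs xs′ ys ys′ ss′ = contra
      where
      w : V
      w = m x s

      ν : Mid x s w
      ν = m-mid xs

      y≁x : y ≁ x
      y≁x = mid-≁ˡ xa μ

      y≢x : y ≢ x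
      y≢x = mid-≢ˡ xa μ

      Txsy≡Awy : T x s y ≡ A w y
      Txsy≡Awy = trans (T-swap₁₂ x s y) (T-near (~-sym xs) (mid-swap xs ν) (~-sym ys) y≢x)

      w~y : w ~ y
      w~y with ~? w y
      ... | inj₁ e = e
      ... | inj₂ e = contradiction (ℤₚ.≤-trans (T≥1 xs′ ss′ ys′) (ℤₚ.≤-reflexive (trans Txsy≡Awy e))) λ { (+≤+ ()) }

      T≤3 : T w y x ≤ + 3
      T≤3 with far w~y (m-mid w~y) (mid-≁ˡ xs ν) y≁x (mid-≢ˡ xs ν ∘ sym) (y≢x ∘ sym)
      ... | far₀ _ e   = subst (_≤ + 3) (sym e) (+≤+ z≤n)
      ... | far₃ _ _ e = ℤₚ.≤-reflexive e
      ... | far₂ _ _ e = subst (_≤ + 3) (sym e) (+≤+ (s≤s (s≤s z≤n)))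

      q-exists : ∃ λ q → x ~ q × a ~ q × s ~ q
      q-exists = T≢0⇒ λ e → 0≢1 (trans (trans (sym e) (T-near xa μ xs λ { refl → ~∧≁ ys (mid-≁ʳ xa μ) })) ys)

      q : V
      q = proj₁ q-exists

      xq : x ~ q
      xq = proj₁ (proj₂ q-exists)

      aq : a ~ q
      aq = proj₁ (proj₂ (proj₂ q-exists))

      sq : s ~ q
      sq = proj₂ (proj₂ (proj₂ q-exists))

      lower : ∀ t → + 2 * N x s t + - 1ℤ * (A y t * N x s t) + 1ℤ * (δ q t * N x s t) ≤ T x y t * N x s t
      lower t = go (N-bit x s t) refl
        where
        Goal : ℤ → Set
        Goal u = + 2 * u + - 1ℤ * (A y t * u) + 1ℤ * (δ q t * u) ≤ T x y t * u
        ar₀ : ∀ a d → + 2 * 0ℤ + - 1ℤ * (a * 0ℤ) + 1ℤ * (d * 0ℤ) ≡ 0ℤ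
        ar₀ = solve-∀
        go : ∀ {u} → Bit u → N x s t ≡ u → Goal u
        go b0 _ = ℤₚ.≤-reflexive (trans (ar₀ (A y t) (δ q t)) (sym (ℤₚ.*-zeroʳ (T x y t))))
        go b1 e with N≡1⇒~ {x} {s} {t} e
        ... | xt , st with q ≟ t in eq
        ...   | yes refl = ℤₚ.≤-trans (ℤₚ.≤-reflexive (cong (λ b → + 2 * 1ℤ + - 1ℤ * (b * 1ℤ) + 1ℤ * (1ℤ * 1ℤ)) (≁-mid-common xa μ xq aq)))
                      (ℤₚ.≤-trans (ℤₚ.≤-trans (T-mid-common≥3 xa μ xq aq) (ℤₚ.≤-reflexive (T-swap₂₃ x q y)))
                                  (ℤₚ.≤-reflexive (sym (ℤₚ.*-identityʳ (T x y q)))))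
        ...   | no  q≢t with ~? y t
        ...     | inj₁ yt = ℤₚ.≤-trans (ℤₚ.≤-reflexive (cong (λ b → + 2 * 1ℤ + - 1ℤ * (b * 1ℤ) + 1ℤ * (0ℤ * 1ℤ)) yt))
                      (ℤₚ.≤-trans (T≥1 xs ys (~-sym st)) (ℤₚ.≤-reflexive (sym (ℤₚ.*-identityʳ (T x y t)))))
        ...     | inj₂ y≁t = ℤₚ.≤-trans (ℤₚ.≤-reflexive (cong (λ b → + 2 * 1ℤ + - 1ℤ * (b * 1ℤ) + 1ℤ * (0ℤ * 1ℤ)) y≁t))
                      (ℤₚ.≤-trans (subst (+ 2 ≤_) (T-swap₂₃ x t y) two) (ℤₚ.≤-reflexive (sym (ℤₚ.*-identityʳ (T x y t)))))
          where
          two : + 2 ≤ T x t y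
          two with far xt (m-mid xt) (≁-sym y≁x) (≁-sym y≁t) y≢x (λ { refl → ~∧≁ xt (≁-sym y≁x) })
          ... | far₀ _ e′   = contradiction (ℤₚ.≤-trans (T≥1 xs (~-sym st) ys) (ℤₚ.≤-reflexive e′)) λ { (+≤+ ()) }
          ... | far₃ _ _ e′ = subst (+ 2 ≤_) (sym e′) (+≤+ (s≤s (s≤s z≤n)))
          ... | far₂ _ _ e′ = ℤₚ.≤-reflexive (sym e′)

      total : ∑ (λ t → + 2 * N x s t + - 1ℤ * (A y t * N x s t) + 1ℤ * (δ q t * N x s t)) ≡ + 8
      total = trans (∑-lin₃ (+ 2) (N x s) (- 1ℤ) (λ t → A y t * N x s t) 1ℤ (λ t → δ q t * N x s t))
        (trans (cong₂ (λ u v → + 2 * u + - 1ℤ * T x s y + 1ℤ * v) (∑N-~ xs) (trans (∑-δ q (N x s)) (N≡1 xq sq)))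
               (cong (λ t → + 8 + - 1ℤ * t + + 1) (trans Txsy≡Awy w~y)))

      pointwise : ∀ z → N x y z * T x s z ≡ 1ℤ * (A w z * N x y z) + + 4 * (δ s z * N x y z)
      pointwise z = go (N-bit x y z) refl
        where
        ar₀ : ∀ t a d → 0ℤ * t ≡ 1ℤ * (a * 0ℤ) + + 4 * (d * 0ℤ)
        ar₀ = solve-∀
        ar₁ : ∀ a → 1ℤ * a ≡ 1ℤ * (a * 1ℤ) + + 4 * (0ℤ * 1ℤ)
        ar₁ = solve-∀
        go : ∀ {u} → Bit u → N x y z ≡ u → u * T x s z ≡ 1ℤ * (A w z * u) + + 4 * (δ s z * u)
        go b0 _ = ar₀ (T x s z) (A w z) (δ s z)
        go b1 e with N≡1⇒~ {x} {y} {z} e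
        ... | xz , yz with s ≟ z
        ...   | yes refl = trans (cong (1ℤ *_) (trans (T-swap₁₂ x s s) (trans (T-self s x) (∑N-~ (~-sym xs)))))
                                 (sym (cong (λ a → 1ℤ * (a * 1ℤ) + + 4 * (1ℤ * 1ℤ)) (mid-≁ʳ xs ν)))
        ...   | no  s≢z  = trans (cong (1ℤ *_) (T-near xs ν xz (s≢z ∘ sym))) (ar₁ (A w z))

      T+4 : ∑ (λ t → T x y t * N x s t) ≡ 1ℤ * T x y w + + 4
      T+4 = trans (sym (ap-selfAdjoint (N x y) (N x s)))
        (trans (∑-cong pointwise)
        (trans (∑-lin 1ℤ (λ z → A w z * N x y z) (+ 4) (λ z → δ s z * N x y z))
               (cong (λ u → 1ℤ * T x y w + + 4 * u) (trans (∑-δ s (N x y)) (N≡1 xs ys)))))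

      contra : ⊥
      contra = contradiction
        (ℤₚ.≤-trans (subst₂ _≤_ total (trans T+4 (cong (_+ + 4) (ℤₚ.*-identityˡ (T x y w)))) (∑-≤ lower))
          (ℤₚ.+-monoˡ-≤ (+ 4) (ℤₚ.≤-trans (ℤₚ.≤-reflexive (T-swap₁₃ x y w)) T≤3)))
        λ { (+≤+ (s≤s (s≤s (s≤s (s≤s (s≤s (s≤s (s≤s ())))))))) }

-- Counting at distance two.

module Counting {n} (Γ : SimpleGraph n) (n≡105 : n ≡ 105) (srg : IsSRG Γ 32 4 12) where
  open Specials Γ n≡105 srg public

  -- Twice the number of edges among the common neighbours of x and y.
  E : V → V → ℤ
  E x y = ∑ λ b → N x y b * T x y b

  F : V → V → V → ℤ
  F x y a = A x a * δ (m x a) y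

  -- The size of the fibre of y under `m x`, which will turn out to be 4 or 0.
  h : V → V → ℤ
  h x y = ∑ (F x y)

  F-bit : ∀ x y a → Bit (F x y a)
  F-bit x y a = bit-* (A-bit x a) (δ-bit (m x a) y)

  F≡1⇒ : ∀ {x y a} → F x y a ≡ 1ℤ → x ~ a × m x a ≡ y
  F≡1⇒ {x} {y} {a} e = go (A-bit x a) (δ-bit (m x a) y) refl refl e
    where
    go : ∀ {p q} → Bit p → Bit q → A x a ≡ p → δ (m x a) y ≡ q → p * q ≡ 1ℤ → x ~ a × m x a ≡ y
    go b1 b1 e f _ = e , δ≡1⇒≡ f
    go b0 b0 _ _ ()
    go b0 b1 _ _ ()
    go b1 b0 _ _ ()

  ⇒F≡1 : ∀ {x y a} → x ~ a → m x a ≡ y → F x y a ≡ 1ℤ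
  ⇒F≡1 {x} {y} {a} xa refl = cong₂ _*_ xa (δ-refl (m x a))

  E-sym : ∀ x y → E x y ≡ E y x
  E-sym x y = ∑-cong λ b → cong₂ _*_ (ℤₚ.*-comm (A x b) (A y b)) (T-swap₁₂ x y b)

  N*T≥0 : ∀ x y b → 0ℤ ≤ N x y b * T x y b
  N*T≥0 x y b = *-≥0 (bit-≥0 (N-bit x y b)) (0≤T x y b)

  ⇒E≡0 : ∀ {x y} → (∀ {s s′} → x ~ s → x ~ s′ → y ~ s → y ~ s′ → s ~ s′ → ⊥) → E x y ≡ 0ℤ
  ⇒E≡0 {x} {y} none = trans (∑-cong λ b → go b (N-bit x y b) refl) (∑0 n)
    where
    go : ∀ b {u} → Bit u → N x y b ≡ u → u * T x y b ≡ 0ℤ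
    go b b0 _ = ℤₚ.*-zeroˡ (T x y b)
    go b b1 e with N≡1⇒~ {x} {y} {b} e
    ... | xb , yb = cong (1ℤ *_) (⇒T≡0 {x} {y} {b} λ w xw yw bw → none xb xw yb yw bw)

  E≡0⇒ : ∀ {x y s s′} → E x y ≡ 0ℤ → x ~ s → x ~ s′ → y ~ s → y ~ s′ → s ~ s′ → ⊥
  E≡0⇒ {x} {y} {s} e xs xs′ ys ys′ ss′ = T≡0⇒ {x} {y} {s}
    (trans (trans (sym (ℤₚ.*-identityˡ (T x y s))) (cong (_* T x y s) (sym (N≡1 xs ys))))
           (∑≡0⇒≡0 (N*T≥0 x y) e s))
    xs′ ys′ ss′

  E-~ : ∀ {x y} → x ~ y → E x y ≡ 0ℤ
  E-~ xy = ⇒E≡0 λ xs xs′ ys ys′ ss′ → no-K₄ xy xs xs′ ys ys′ ss′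

  E-refl : ∀ x → E x x ≡ + 128
  E-refl x = trans (∑-cong λ b → go b (A-bit x b) refl) (trans (∑-* (+ 4) (A x)) (cong (+ 4 *_) (∑A x)))
    where
    go : ∀ b {u} → Bit u → A x b ≡ u → u * u * T x x b ≡ + 4 * u
    go b b0 _ = ℤₚ.*-zeroˡ (T x x b)
    go b b1 xb = cong (1ℤ * 1ℤ *_) (trans (T-swap₂₃ x x b) (trans (T-self x b) (∑N-~ xb)))

  -- 32 choices of a neighbour b, 4 of a common neighbour w of x and b, and 4 of a common neighbour
  -- y of b and w.
  ∑E : ∀ x → ∑ (E x) ≡ + 512
  ∑E x = begin
    ∑ (λ y → ∑ λ b → N x y b * T x y b)
      ≡⟨ ∑-swap (λ y b → N x y b * T x y b) ⟩
    ∑ (λ b → ∑ λ y → N x y b * T x y b)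
      ≡⟨ ∑-cong (λ b → ∑-cong λ y → trans (ar (A x b) (A y b) (T x y b)) (cong (λ t → A x b * (A y b * t)) (T-swap₂₃ x y b))) ⟩
    ∑ (λ b → ∑ λ y → A x b * (A y b * ap (N x b) y))
      ≡⟨ ∑-cong (λ b → trans (∑-* (A x b) (λ y → A y b * ap (N x b) y)) (go b (A-bit x b) refl)) ⟩
    ∑ (λ b → + 16 * A x b)
      ≡⟨ trans (∑-* (+ 16) (A x)) (cong (+ 16 *_) (∑A x)) ⟩
    + 512 ∎
    where
    open ≡-Reasoning
    ar : ∀ a b t → a * b * t ≡ a * (b * t)
    ar = solve-∀
    inner : ∀ b → x ~ b → ∑ (λ y → A y b * ap (N x b) y) ≡ + 16
    inner b xb = begin
      ∑ (λ y → A y b * ap (N x b) y)            ≡⟨ ap-selfAdjoint (λ y → A y b) (N x b) ⟩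
      ∑ (λ w → ap (λ y → A y b) w * N x b w)    ≡⟨ ∑-cong (λ w → at w (N-bit x b w) refl) ⟩
      ∑ (λ w → + 4 * N x b w)                   ≡⟨ trans (∑-* (+ 4) (N x b)) (cong (+ 4 *_) (∑N-~ xb)) ⟩
      + 16 ∎
      where
      at : ∀ w {u} → Bit u → N x b w ≡ u → ap (λ y → A y b) w * u ≡ + 4 * u
      at w b0 _ = ℤₚ.*-zeroʳ (ap (λ y → A y b) w)
      at w b1 e = cong (_* 1ℤ) (trans (∑-cong λ v → cong (A w v *_) (A-sym v b))
                                      (∑N-~ (~-sym (proj₂ (N≡1⇒~ {x} {b} {w} e)))))
    go : ∀ b {u} → Bit u → A x b ≡ u → u * ∑ (λ y → A y b * ap (N x b) y) ≡ + 16 * u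
    go b b0 _  = ℤₚ.*-zeroˡ (∑ (λ y → A y b * ap (N x b) y))
    go b b1 xb = cong (1ℤ *_) (inner b xb)

  ∑h : ∀ x → ∑ (h x) ≡ + 32
  ∑h x = trans (∑-swap (λ y a → A x a * δ (m x a) y))
    (trans (∑-cong λ a → trans (∑-* (A x a) (δ (m x a))) (trans (cong (A x a *_) (∑-δ1 (m x a))) (ℤₚ.*-identityʳ (A x a))))
           (∑A x))

  module _ {x y : V} (x≢y : x ≢ y) (x≁y : x ≁ y) where

    -- Take c to be the sum S of the common neighbours plus 3 x + 3 y. On S one has k c z = -4 - T,
    -- so the summand of `disc` at a = 5 is 2 - 2 T + T (T - 1), at least 2 - 2 T. Summation gives
    -- 24 - 2 E ≤ 90 - 12 E, hence E < 7.
    E≤6 : E x y ≤ + 6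
    E≤6 with E x y ℤₚ.≤? + 6
    ... | yes p = p
    ... | no ¬p = absurd-≤ (ℤₚ.≤-trans (ℤₚ.i≤j⇒0≤j-i le) (subst (_≤ - (+ 4)) (ar′ (E x y))
                    (ℤₚ.+-monoˡ-≤ (+ 66) (ℤₚ.*-monoˡ-≤-nonPos (- (+ 10)) (≤-gap ¬p)))))
      where
      S c₁ c : V → ℤ
      S  = N x y
      c₁ = shift S (+ 3) x
      c  = shift c₁ (+ 3) y
      kSx : k S x ≡ - (+ 12)
      kSx = trans (k-def S x) (cong₂ (λ s t → + 2 * s + - 1ℤ * t)
              (cong (_* A y x) (A-irr x)) (trans (T-self x y) (∑N-≁ x≢y x≁y)))
      kSy : k S y ≡ - (+ 12)
      kSy = trans (k-def S y) (cong₂ (λ s t → + 2 * s + - 1ℤ * t)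
              (trans (cong (A x y *_) (A-irr y)) (ℤₚ.*-zeroʳ (A x y)))
              (trans (T-swap₁₂ x y y) (trans (T-self y x) (∑N-≁ (x≢y ∘ sym) (≁-sym x≁y)))))
      formS : form S ≡ + 24 + - 1ℤ * E x y
      formS = trans (form-def S) (trans (∑-cong λ z → trans (cong (N x y z *_) (k-def S z)) (go (N-bit x y z) (T x y z)))
        (trans (∑-lin (+ 2) S (- 1ℤ) (λ z → N x y z * T x y z)) (cong (λ s → + 2 * s + - 1ℤ * E x y) (∑N-≁ x≢y x≁y))))
        where
        ar₀ : ∀ t → 0ℤ * (+ 2 * 0ℤ + - 1ℤ * t) ≡ + 2 * 0ℤ + - 1ℤ * (0ℤ * t)
        ar₀ = solve-∀
        ar₁ : ∀ t → 1ℤ * (+ 2 * 1ℤ + - 1ℤ * t) ≡ + 2 * 1ℤ + - 1ℤ * (1ℤ * t)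
        ar₁ = solve-∀
        go : ∀ {u} → Bit u → ∀ t → u * (+ 2 * u + - 1ℤ * t) ≡ + 2 * u + - 1ℤ * (u * t)
        go b0 = ar₀
        go b1 = ar₁
      form-c : form c ≡ + 24 + - 1ℤ * E x y + - (+ 108)
      form-c = trans (form-at c₁ (+ 3) y (form-at S (+ 3) x formS kSx) (k-at S (+ 3) x y kSy (δ-≢ x≢y) x≁y))
                     (ar (E x y))
        where
        ar : ∀ e → + 24 + - 1ℤ * e + + 2 * + 3 * - (+ 12) + + 2 * + 3 * + 3 + + 2 * + 3 * - (+ 12) + + 2 * + 3 * + 3
                   ≡ + 24 + - 1ℤ * e + - (+ 108)
        ar = solve-∀
      ∑c : ∑ c ≡ + 18
      ∑c = ∑-at c₁ (+ 3) y (∑-at S (+ 3) x (∑N-≁ x≢y x≁y))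
      pointwise : ∀ z → + 2 * N x y z + - (+ 2) * (N x y z * T x y z) ≤ (k c z + + 5) * (k c z + + 5 + 1ℤ)
      pointwise z = go (N-bit x y z) refl
        where
        Goal : ℤ → Set
        Goal u = + 2 * u + - (+ 2) * (u * T x y z) ≤ (k c z + + 5) * (k c z + + 5 + 1ℤ)
        ar : ∀ t → (+ 2 * 1ℤ + - 1ℤ * t + + 3 * (+ 2 * 0ℤ + - 1ℤ * 1ℤ) + + 3 * (+ 2 * 0ℤ + - 1ℤ * 1ℤ) + + 5)
                   * (+ 2 * 1ℤ + - 1ℤ * t + + 3 * (+ 2 * 0ℤ + - 1ℤ * 1ℤ) + + 3 * (+ 2 * 0ℤ + - 1ℤ * 1ℤ) + + 5 + 1ℤ)
                   ≡ + 2 * 1ℤ + - (+ 2) * (1ℤ * t) + (t + - 1ℤ) * (t + - 1ℤ + 1ℤ)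
        ar = solve-∀
        go : ∀ {u} → Bit u → N x y z ≡ u → Goal u
        go b0 _ = ℤₚ.≤-trans (ℤₚ.≤-reflexive (cong (- (+ 2) *_) (ℤₚ.*-zeroˡ (T x y z)))) (0≤m[m+1] (k c z + + 5))
        go b1 e with N≡1⇒~ {x} {y} {z} e
        ... | xz , yz = subst (λ κ → + 2 * 1ℤ + - (+ 2) * (1ℤ * T x y z) ≤ (κ + + 5) * (κ + + 5 + 1ℤ))
          (sym (k-at c₁ (+ 3) y z (k-at S (+ 3) x z (trans (k-def S z) (cong (λ u → + 2 * u + - 1ℤ * T x y z) e))
                 (δ-≢ (~⇒≢ xz)) xz) (δ-≢ (~⇒≢ yz)) yz))
          (subst (base ≤_) (sym (ar (T x y z)))
            (subst (_≤ base + (T x y z + - 1ℤ) * (T x y z + - 1ℤ + 1ℤ)) (ℤₚ.+-identityʳ base)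
                   (ℤₚ.+-monoʳ-≤ base (0≤m[m+1] (T x y z + - 1ℤ)))))
          where
          base : ℤ
          base = + 2 * 1ℤ + - (+ 2) * (1ℤ * T x y z)
      le : + 24 + - (+ 2) * E x y ≤ disc (+ 24 + - 1ℤ * E x y + - (+ 108)) (+ 18) (+ 5)
      le = subst₂ _≤_
        (trans (∑-lin (+ 2) S (- (+ 2)) (λ z → N x y z * T x y z)) (cong (λ s → + 2 * s + - (+ 2) * E x y) (∑N-≁ x≢y x≁y)))
        (trans (∑disc c (+ 5)) (cong₂ (λ f t → disc f t (+ 5)) form-c ∑c))
        (∑-≤ pointwise)
      ar′ : ∀ e → - (+ 10) * e + + 66
                  ≡ + 12 * (+ 24 + - 1ℤ * e + - (+ 108) + + 324) + (+ 2 * + 5 + 1ℤ) * (- (+ 30) * + 18) + + 5 * (+ 5 + 1ℤ) * + 105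
                    - (+ 24 + - (+ 2) * e)
      ar′ = solve-∀

    -- A neighbour b of x not adjacent to y has T x b y ≤ 3, with T x b y = 0
    -- when m x b = y.
    3h≤12+E : + 3 * h x y ≤ + 12 + E x y
    3h≤12+E = ℤₚ.0≤i-j⇒j≤i (subst (0ℤ ≤_) (ar′ (E x y) (h x y)) (ℤₚ.i≤j⇒0≤j-i summed))
      where
      ar′ : ∀ e h → 1ℤ * e + + 3 * (1ℤ * + 32 + - 1ℤ * + 12 + - 1ℤ * h) - + 48 ≡ + 12 + e - + 3 * h
      ar′ = solve-∀
      G : V → ℤ
      G b = 1ℤ * A x b + - 1ℤ * N x y b + - 1ℤ * F x y b
      pointwise : ∀ b → A x b * ap (N x y) b ≤ 1ℤ * (N x y b * T x y b) + + 3 * G b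
      pointwise b = go (A-bit x b) (A-bit y b) (F-bit x y b) refl refl refl
        where
        t : ℤ
        t = T x y b
        ar₀ : ∀ t q → 0ℤ * t ≡ 1ℤ * (0ℤ * q * t) + + 3 * (1ℤ * 0ℤ + - 1ℤ * (0ℤ * q) + - 1ℤ * 0ℤ)
        ar₀ = solve-∀
        ar₁ : ∀ t → 1ℤ * t ≡ 1ℤ * (1ℤ * 1ℤ * t) + + 3 * (1ℤ * 1ℤ + - 1ℤ * (1ℤ * 1ℤ) + - 1ℤ * 0ℤ)
        ar₁ = solve-∀
        Goal : ℤ → ℤ → ℤ → Set
        Goal p q f = p * t ≤ 1ℤ * (p * q * t) + + 3 * (1ℤ * p + - 1ℤ * (p * q) + - 1ℤ * f)
        near : ∀ f {r} → t ≡ r → 1ℤ * r ≤ 1ℤ * (1ℤ * 0ℤ * r) + + 3 * (1ℤ * 1ℤ + - 1ℤ * (1ℤ * 0ℤ) + - 1ℤ * f) → Goal 1ℤ 0ℤ f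
        near _ refl p = p
        F≢1 : F x y b ≡ 1ℤ → m x b ≢ y → ⊥
        F≢1 e ne = ne (proj₂ (F≡1⇒ {x} {y} {b} e))
        go : ∀ {p q f} → Bit p → Bit q → Bit f → A x b ≡ p → A y b ≡ q → F x y b ≡ f → Goal p q f
        go {q = q} b0 _ _ eA _ eF = subst (Goal 0ℤ q) (trans (sym (cong (_* δ (m x b) y) eA)) eF) (ℤₚ.≤-reflexive (ar₀ t q))
        go b1 b1 b0 _ _ _ = ℤₚ.≤-reflexive (ar₁ t)
        go b1 b1 b1 xb yb eF = ⊥-elim (F≢1 eF λ { refl → ~∧≁ yb (mid-≁ʳ xb (m-mid xb)) })
        go b1 b0 bf xb y≁b eF
          with far xb (m-mid xb) x≁y (≁-sym y≁b) (x≢y ∘ sym) (λ { refl → ~∧≁ xb x≁y })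
        go b1 b0 b0 xb _ eF | far₀ p e = contradiction (trans (sym eF) (⇒F≡1 xb p)) 0≢1
        go b1 b0 b1 xb _ eF | far₀ p e = near 1ℤ (trans (T-swap₂₃ x y b) e) ℤₚ.≤-refl
        go b1 b0 b0 xb _ eF | far₃ _ _ e = near 0ℤ (trans (T-swap₂₃ x y b) e) ℤₚ.≤-refl
        go b1 b0 b0 xb _ eF | far₂ _ _ e = near 0ℤ (trans (T-swap₂₃ x y b) e) (+≤+ (s≤s (s≤s z≤n)))
        go b1 b0 b1 xb _ eF | far₃ ne _ e = ⊥-elim (F≢1 eF ne)
        go b1 b0 b1 xb _ eF | far₂ ne _ e = ⊥-elim (F≢1 eF ne)
      -- The left side is 12 * 4: pairs of a common neighbour w of x and y and a common neighbour of
      -- x and w.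
      summed : + 48 ≤ 1ℤ * E x y + + 3 * (1ℤ * + 32 + - 1ℤ * + 12 + - 1ℤ * h x y)
      summed = subst₂ _≤_
        (trans (ap-selfAdjoint (A x) (N x y)) (trans (∑-cong λ w → at w (N-bit x y w) refl)
          (trans (∑-* (+ 4) (N x y)) (cong (+ 4 *_) (∑N-≁ x≢y x≁y)))))
        (trans (∑-lin 1ℤ (λ b → N x y b * T x y b) (+ 3) G)
               (cong (λ s → 1ℤ * E x y + + 3 * s)
                 (trans (∑-lin₃ 1ℤ (A x) (- 1ℤ) (N x y) (- 1ℤ) (F x y))
                        (cong₂ (λ s u → 1ℤ * s + - 1ℤ * u + - 1ℤ * h x y) (∑A x) (∑N-≁ x≢y x≁y)))))
        (∑-≤ pointwise)
        where
        at : ∀ w {u} → Bit u → N x y w ≡ u → ap (A x) w * u ≡ + 4 * u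
        at w b0 _ = ℤₚ.*-zeroʳ (ap (A x) w)
        at w b1 e = cong (_* 1ℤ) (∑N-~ (~-sym (proj₁ (N≡1⇒~ {x} {y} {w} e))))

    -- The two bounds combine because one of E and h vanishes: if y is the midpoint of an edge at x,
    -- then E is 0 by `mid-independent`.
    2E+3h≤12 : + 2 * E x y + + 3 * h x y ≤ + 12
    2E+3h≤12 with h x y ℤₚ.≟ 0ℤ
    ... | yes e = subst (λ s → + 2 * E x y + + 3 * s ≤ + 12) (sym e)
                    (subst (_≤ + 12) (sym (ℤₚ.+-identityʳ (+ 2 * E x y))) (ℤₚ.*-monoˡ-≤-nonNeg (+ 2) E≤6))
    ... | no ne with ∑≢0⇒∃ {f = F x y} ne
    ...   | a , ne′ with F≡1⇒ {x} {y} {a} (bit-≢0 (F-bit x y a) ne′)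
    ...     | xa , ma = subst (λ s → + 2 * s + + 3 * h x y ≤ + 12) (sym none)
                          (subst (_≤ + 12) (sym (ℤₚ.+-identityˡ (+ 3 * h x y))) (subst (λ s → + 3 * h x y ≤ + 12 + s) none 3h≤12+E))
      where
      none : E x y ≡ 0ℤ
      none = ⇒E≡0 λ xs xs′ ys ys′ ss′ → mid-independent xa (m⇒Mid xa ma) xs xs′ ys ys′ ss′

  h≢0⇒ : ∀ {x y} → h x y ≢ 0ℤ → ∃ λ a → x ~ a × m x a ≡ y
  h≢0⇒ {x} {y} ne with ∑≢0⇒∃ {f = F x y} ne
  ... | a , ne′ = a , F≡1⇒ {x} {y} {a} (bit-≢0 (F-bit x y a) ne′)

  h≡0 : ∀ {x y} → (∀ {a} → x ~ a → m x a ≢ y) → h x y ≡ 0ℤ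
  h≡0 {x} {y} none with h x y ℤₚ.≟ 0ℤ
  ... | yes e = e
  ... | no ne with h≢0⇒ ne
  ...   | a , xa , ma = contradiction ma (none xa)

  opaque
    -- The bound 2E+3h≤12 is attained, because both sides have the same sum over
    -- the 72 vertices y at distance 2 from x.
    2E+3h≡12 : ∀ {x y} → x ≢ y → x ≁ y → + 2 * E x y + + 3 * h x y ≡ + 12
    2E+3h≡12 {x} {y} x≢y x≁y = trans (sym (ar (+ 2 * E x y + + 3 * h x y)))
      (trans (cong₂ (λ d a → (1ℤ + - 1ℤ * d + - 1ℤ * a) * (+ 2 * E x y + + 3 * h x y)) (sym (δ-≢ x≢y)) (sym x≁y))
      (trans (≤∧∑≡⇒≡ f≤g ∑f≡∑g y)
             (cong₂ (λ d a → (1ℤ + - 1ℤ * d + - 1ℤ * a) * + 12) (δ-≢ x≢y) x≁y)))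
      where
      ar : ∀ s → (1ℤ + - 1ℤ * 0ℤ + - 1ℤ * 0ℤ) * s ≡ s
      ar = solve-∀
      D f g : V → ℤ
      D z = 1ℤ + - 1ℤ * δ x z + - 1ℤ * A x z
      f z = D z * (+ 2 * E x z + + 3 * h x z)
      g z = D z * + 12

      data Dist (z : V) : ℤ → ℤ → Set where
        same : x ≡ z → Dist z 1ℤ 0ℤ
        near : x ~ z → Dist z 0ℤ 1ℤ
        away : x ≢ z → x ≁ z → Dist z 0ℤ 0ℤ

      dist : ∀ z → Dist z (δ x z) (A x z)
      dist z with x ≟ z
      ... | yes refl = subst (Dist x 1ℤ) (sym (A-irr x)) (same refl)
      ... | no x≢z with ~? x z
      ...   | inj₁ xz = subst (Dist z 0ℤ) (sym xz) (near xz)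
      ...   | inj₂ xz = subst (Dist z 0ℤ) (sym xz) (away x≢z xz)

      f≤g : ∀ z → f z ≤ g z
      f≤g z = go (dist z)
        where
        go : ∀ {d a} → Dist z d a →
             (1ℤ + - 1ℤ * d + - 1ℤ * a) * (+ 2 * E x z + + 3 * h x z) ≤ (1ℤ + - 1ℤ * d + - 1ℤ * a) * + 12
        go (same _) = ℤₚ.≤-reflexive (ℤₚ.*-zeroˡ (+ 2 * E x z + + 3 * h x z))
        go (near _) = ℤₚ.≤-reflexive (ℤₚ.*-zeroˡ (+ 2 * E x z + + 3 * h x z))
        go (away ne na) = subst (_≤ + 12) (sym (ℤₚ.*-identityˡ (+ 2 * E x z + + 3 * h x z))) (2E+3h≤12 ne na)

      f-eq : ∀ z → f z ≡ + 2 * E x z + + 3 * h x z + - (+ 256) * δ x z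
      f-eq z = go (dist z)
        where
        go : ∀ {d a} → Dist z d a → (1ℤ + - 1ℤ * d + - 1ℤ * a) * (+ 2 * E x z + + 3 * h x z)
                                     ≡ + 2 * E x z + + 3 * h x z + - (+ 256) * d
        go (same refl) = trans (cong₂ (λ e s → 0ℤ * (+ 2 * e + + 3 * s)) (E-refl x) h0)
          (sym (cong₂ (λ e s → + 2 * e + + 3 * s + - (+ 256) * 1ℤ) (E-refl x) h0))
          where
          h0 : h x x ≡ 0ℤ
          h0 = h≡0 λ xa e → mid-≢ˡ xa (m-mid xa) e
        go (near xz) = trans (ℤₚ.*-zeroˡ (+ 2 * E x z + + 3 * h x z))
          (sym (cong₂ (λ e s → + 2 * e + + 3 * s + - (+ 256) * 0ℤ) (E-~ xz)
                 (h≡0 λ { xa refl → ~∧≁ xz (≁-sym (mid-≁ˡ xa (m-mid xa))) })))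
        go (away _ _) = ar₁ (E x z) (h x z)
          where
          ar₁ : ∀ e h → (1ℤ + - 1ℤ * 0ℤ + - 1ℤ * 0ℤ) * (+ 2 * e + + 3 * h) ≡ + 2 * e + + 3 * h + - (+ 256) * 0ℤ
          ar₁ = solve-∀

      ∑f≡∑g : ∑ f ≡ ∑ g
      ∑f≡∑g = trans (∑-cong f-eq)
        (trans (∑-lin₃ (+ 2) (E x) (+ 3) (h x) (- (+ 256)) (δ x))
        (trans (cong₂ _+_ (cong₂ (λ s u → + 2 * s + + 3 * u) (∑E x) (∑h x)) (cong (- (+ 256) *_) (∑-δ1 x)))
        (sym (trans (∑-cong λ z → ar₂ (δ x z) (A x z))
             (trans (∑-lin₃ (+ 12) (λ _ → 1ℤ) (- (+ 12)) (δ x) (- (+ 12)) (A x))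
                    (cong₂ _+_ (cong₂ (λ s u → + 12 * s + - (+ 12) * u) ∑1≡105 (∑-δ1 x)) (cong (- (+ 12) *_) (∑A x))))))))
        where
        ar₂ : ∀ d a → (1ℤ + - 1ℤ * d + - 1ℤ * a) * + 12 ≡ + 12 * 1ℤ + - (+ 12) * d + - (+ 12) * a
        ar₂ = solve-∀

-- Special pairs and the two classes of specials.

module Structure {n} (Γ : SimpleGraph n) (n≡105 : n ≡ 105) (srg : IsSRG Γ 32 4 12) where
  open Counting Γ n≡105 srg public

  -- In the flag graph: x and y are distinct flags with a common point or line.
  record Sp (x y : V) : Set where
    constructor sp
    field
      {nbr} : V
      x~nbr : x ~ nbr
      m-nbr : m x nbr ≡ y

  Sp-Mid : ∀ {x y} (s : Sp x y) → Mid x (Sp.nbr s) y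
  Sp-Mid (sp xa e) = m⇒Mid xa e

  Sp-≢ : ∀ {x y} → Sp x y → x ≢ y
  Sp-≢ s e = mid-≢ˡ (Sp.x~nbr s) (Sp-Mid s) (sym e)

  Sp-≁ : ∀ {x y} → Sp x y → x ≁ y
  Sp-≁ s = ≁-sym (mid-≁ˡ (Sp.x~nbr s) (Sp-Mid s))

  Sp-E : ∀ {x y} → Sp x y → E x y ≡ 0ℤ
  Sp-E s = ⇒E≡0 λ xs xs′ ys ys′ ss′ → mid-independent (Sp.x~nbr s) (Sp-Mid s) xs xs′ ys ys′ ss′

  h≡4 : ∀ {x y} → x ≢ y → x ≁ y → E x y ≡ 0ℤ → h x y ≡ + 4
  h≡4 {x} {y} x≢y x≁y e = ℤₚ.*-cancelˡ-≡ (+ 3) (h x y) (+ 4)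
    (trans (sym (ℤₚ.+-identityˡ (+ 3 * h x y)))
           (trans (cong (λ s → + 2 * s + + 3 * h x y) (sym e)) (2E+3h≡12 x≢y x≁y)))

  Sp-h : ∀ {x y} → Sp x y → h x y ≡ + 4
  Sp-h s = h≡4 (Sp-≢ s) (Sp-≁ s) (Sp-E s)

  opaque
    -- At distance two, being special is therefore the condition E x y = 0, which is symmetric in x
    -- and y although the definition of `Sp` is not.
    E≡0⇒Sp : ∀ {x y} → x ≢ y → x ≁ y → E x y ≡ 0ℤ → Sp x y
    E≡0⇒Sp {x} {y} x≢y x≁y e = sp (proj₁ (proj₂ found)) (proj₂ (proj₂ found))
      where
      found : ∃ λ a → x ~ a × m x a ≡ y
      found = h≢0⇒ {x} {y} λ h≡0′ → contradiction (trans (sym (h≡4 x≢y x≁y e)) h≡0′) λ ()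

  opaque
    Sp-sym : ∀ {x y} → Sp x y → Sp y x
    Sp-sym {x} {y} s = E≡0⇒Sp (Sp-≢ s ∘ sym) (≁-sym (Sp-≁ s)) (trans (E-sym y x) (Sp-E s))

  Sp-mˡ : ∀ {x a} → x ~ a → Sp x (m x a)
  Sp-mˡ xa = sp xa refl

  Sp-mʳ : ∀ {x a} → x ~ a → Sp a (m x a)
  Sp-mʳ xa = sp (~-sym xa) (sym (m-comm xa))

  data Part (x y b : V) : Set where
    adjacent  : y ~ b → Part x y b
    fibre     : m x b ≡ y → Part x y b
    nextFibre : ∀ v → x ~ v → m x v ≡ y → v ~ b → Part x y b

  opaque
    -- For special x, y the 32 neighbours of x split into the 12 common
    -- neighbours, the 4 elements of the fibre of y and the 16 neighbours of that
    -- fibre.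
    part : ∀ {x y} → Sp x y → ∀ {b} → x ~ b → Part x y b
    part {x} {y} s {b} xb = go (A-bit y b) (F-bit x y b) refl refl
      where
      cover : V → ℤ
      cover c = 1ℤ * N x y c + 1ℤ * F x y c + 1ℤ * (ap (F x y) c * A x c)

      apF≡0 : ∀ c → (∀ v → c ~ v → x ~ v → m x v ≡ y → ⊥) → ap (F x y) c ≡ 0ℤ
      apF≡0 c none with ap (F x y) c ℤₚ.≟ 0ℤ
      ... | yes e = e
      ... | no ne with ∑≢0⇒∃ {f = λ v → A c v * F x y v} ne
      ...   | v , ne′ with F≡1⇒ {x} {y} {v} (bit-≢0 (F-bit x y v) (*-≢0ʳ {A c v} ne′))
      ...     | xv , mv = ⊥-elim (none v (bit-≢0 (A-bit c v) (*-≢0ˡ {A c v} ne′)) xv mv)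

      apF≤1 : ∀ c → x ~ c → ap (F x y) c ≤ 1ℤ
      apF≤1 c xc = ∑-atMostOne (λ v → bit-* (A-bit c v) (F-bit x y v)) unique
        where
        both : ∀ v → A c v * F x y v ≡ 1ℤ → c ~ v × x ~ v × m x v ≡ y
        both v e = bit-≢0 (A-bit c v) (*-≢0ˡ {A c v} (λ z → 0≢1 (trans (sym z) e)))
                 , F≡1⇒ {x} {y} {v} (bit-≢0 (F-bit x y v) (*-≢0ʳ {A c v} (λ z → 0≢1 (trans (sym z) e))))
        unique : ∀ v v′ → A c v * F x y v ≡ 1ℤ → A c v′ * F x y v′ ≡ 1ℤ → v ≡ v′
        unique v v′ e e′ with both v e | both v′ e′ | v ≟ v′
        ... | _ | _ | yes p = p
        ... | cv , xv , mv | cv′ , xv′ , mv′ | no v≢v′ = ⊥-elim (T≡0⇒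
          (trans (T-near xv (m⇒Mid xv mv) xv′ (v≢v′ ∘ sym)) (mid-≁ʳ xv′ (m⇒Mid xv′ mv′)))
          xc (~-sym cv) (~-sym cv′))

      -- The three kinds of neighbours exclude each other: a midpoint is adjacent neither to the
      -- ends of its edge nor to their common neighbours, and `T-mid-common≥3` contradicts
      -- `T-mid≡0`. Since 12 + 4 + 16 = 32, they exhaust all neighbours of x.
      cover≤A : ∀ c → cover c ≤ A x c
      cover≤A c = step (A-bit x c) (A-bit y c) (F-bit x y c) refl refl refl
        where
        Goal : ℤ → ℤ → ℤ → Set
        Goal p q f = 1ℤ * (p * q) + 1ℤ * f + 1ℤ * (ap (F x y) c * p) ≤ p
        ar₀ : ∀ q s → 1ℤ * (0ℤ * q) + 1ℤ * 0ℤ + 1ℤ * (s * 0ℤ) ≡ 0ℤ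
        ar₀ = solve-∀
        ar₁ : ∀ s → 1ℤ * (1ℤ * 0ℤ) + 1ℤ * 0ℤ + 1ℤ * (s * 1ℤ) ≡ s
        ar₁ = solve-∀
        with-apF : ∀ {q f} → ap (F x y) c ≡ 0ℤ → 1ℤ * (1ℤ * q) + 1ℤ * f + 1ℤ * (0ℤ * 1ℤ) ≤ 1ℤ → Goal 1ℤ q f
        with-apF {q} {f} e = subst (λ s → 1ℤ * (1ℤ * q) + 1ℤ * f + 1ℤ * (s * 1ℤ) ≤ 1ℤ) (sym e)
        step : ∀ {p q f} → Bit p → Bit q → Bit f → A x c ≡ p → A y c ≡ q → F x y c ≡ f → Goal p q f
        step {q = q} b0 _ _ eA _ eF = subst (Goal 0ℤ q) (trans (cong (_* δ (m x c) y) (sym eA)) eF)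
          (ℤₚ.≤-reflexive (ar₀ q (ap (F x y) c)))
        step b1 b1 b1 xc yc eF with F≡1⇒ {x} {y} {c} eF
        ... | _ , refl = ~∧≁ yc (mid-≁ʳ xc (m-mid xc))
        step b1 b1 b0 xc yc _ = with-apF {1ℤ} {0ℤ} (apF≡0 c λ v cv xv mv → ~∧≁ yc
          (≁-mid-common xv (m⇒Mid xv mv) xc (~-sym cv))) ℤₚ.≤-refl
        step b1 b0 b1 xc _ eF = with-apF {0ℤ} {1ℤ} (apF≡0 c λ v cv xv mv → contradiction
          (ℤₚ.≤-trans (T-mid-common≥3 xv (m⇒Mid xv mv) xc (~-sym cv))
                      (ℤₚ.≤-reflexive (T-mid≡0 xc (m⇒Mid xc (proj₂ (F≡1⇒ {x} {y} {c} eF)))))) λ { (+≤+ ()) })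
          ℤₚ.≤-refl
        step b1 b0 b0 xc _ _ = ℤₚ.≤-trans (ℤₚ.≤-reflexive (ar₁ (ap (F x y) c))) (apF≤1 c xc)

      ∑cover : ∑ cover ≡ ∑ (A x)
      ∑cover = trans (∑-lin₃ 1ℤ (N x y) 1ℤ (F x y) 1ℤ (λ c → ap (F x y) c * A x c))
        (trans (cong₂ _+_ (cong₂ (λ u v → 1ℤ * u + 1ℤ * v) (∑N-≁ (Sp-≢ s) (Sp-≁ s)) (Sp-h s))
                          (cong (1ℤ *_) (trans (sym (ap-selfAdjoint (F x y) (A x)))
                            (trans (∑-cong λ v → at v (F-bit x y v) refl)
                                   (trans (∑-* (+ 4) (F x y)) (cong (+ 4 *_) (Sp-h s)))))))
               (sym (∑A x)))
        where
        at : ∀ v {f} → Bit f → F x y v ≡ f → f * ap (A x) v ≡ + 4 * f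
        at v b0 _ = ℤₚ.*-zeroˡ (ap (A x) v)
        at v b1 e = cong (1ℤ *_) (∑N-~ (~-sym (proj₁ (F≡1⇒ {x} {y} {v} e))))

      go : ∀ {q f} → Bit q → Bit f → A y b ≡ q → F x y b ≡ f → Part x y b
      go b1 _ yb _ = adjacent yb
      go b0 b1 _ e = fibre (proj₂ (F≡1⇒ {x} {y} {b} e))
      go b0 b0 yb eF with ap (F x y) b ℤₚ.≟ 0ℤ
      ... | yes z = contradiction (trans (sym (cong₂ _+_ (cong₂ (λ u v → 1ℤ * u + 1ℤ * v) (cong₂ _*_ xb yb) eF)
                                                       (cong (1ℤ *_) (cong₂ _*_ z xb))))
                                         (trans (≤∧∑≡⇒≡ cover≤A ∑cover b) xb)) 0≢1
      ... | no ne with ∑≢0⇒∃ {f = λ v → A b v * F x y v} ne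
      ...   | v , ne′ with F≡1⇒ {x} {y} {v} (bit-≢0 (F-bit x y v) (*-≢0ʳ {A b v} ne′))
      ...     | xv , mv = nextFibre v xv mv (~-sym (bit-≢0 (A-bit b v) (*-≢0ˡ {A b v} ne′)))

  -- By `T-near`, adjacency of `m x b` and y would produce a common neighbour of x, b and y, hence
  -- an edge among the common neighbours of x and y.
  cross-adjacent : ∀ {x y b} → Sp x y → x ~ b → y ~ b → m x b ≁ y × m x b ≢ y
  cross-adjacent {x} {y} {b} s xb yb =
      trans (sym (T-near (~-sym xb) (mid-swap xb (m-mid xb)) (~-sym yb) (Sp-≢ s ∘ sym)))
            (⇒T≡0 λ w bw xw yw → E≡0⇒ (Sp-E s) xb xw yb yw bw)
    , λ e → ~∧≁ yb (subst (_≁ b) e (mid-≁ʳ xb (m-mid xb)))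

  T-nextFibre≥3 : ∀ {x y v b} → x ~ v → m x v ≡ y → v ~ b → x ~ b → + 3 ≤ T x b y
  T-nextFibre≥3 xv mv vb xb = T-mid-common≥3 xv (m⇒Mid xv mv) xb vb

  -- `T x b y` is at least 3, which leaves only the case `far₃`.
  cross-nextFibre : ∀ {x y v b} → Sp x y → x ~ v → m x v ≡ y → v ~ b → x ~ b → m x b ~ y
  cross-nextFibre {x} {y} {v} {b} s xv mv vb xb
    with far xb (m-mid xb) (Sp-≁ s) (≁-sym (≁-mid-common xv (m⇒Mid xv mv) xb vb))
             (Sp-≢ s ∘ sym) (λ { refl → ~∧≁ xb (Sp-≁ s) })
  ... | far₀ _ e = contradiction (subst (+ 3 ≤_) e (T-nextFibre≥3 xv mv vb xb)) λ { (+≤+ ()) }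
  ... | far₂ _ _ e = contradiction (subst (+ 3 ≤_) e (T-nextFibre≥3 xv mv vb xb)) λ { (+≤+ (s≤s (s≤s ()))) }
  ... | far₃ _ e _ = e

  data Cross (x y b : V) : Set where
    adjacent  : y ~ b → m x b ≁ y → Cross x y b
    fibre     : m x b ≡ y → Cross x y b
    nextFibre : ∀ v → x ~ v → m x v ≡ y → v ~ b → m x b ~ y → Cross x y b

  opaque
    cross : ∀ {x y} → Sp x y → ∀ {b} → x ~ b → Cross x y b
    cross s xb with part s xb
    ... | adjacent yb = adjacent yb (proj₁ (cross-adjacent s xb yb))
    ... | fibre e = fibre e
    ... | nextFibre v xv mv vb = nextFibre v xv mv vb (cross-nextFibre s xv mv vb xb)

  opaque
    -- Together with `Sp-triangleFree` this makes the specials of a vertex a complete multipartite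
    -- graph with at most two parts: in the flag graph, the flags sharing its point and those
    -- sharing its line. Let v = `m x d`. If y and v were adjacent, d would be adjacent to some a in
    -- the fibre of y, and a d would be an edge among the common neighbours of x and w.
    Sp-≁-trans : ∀ {x y w v} → Sp x y → Sp x w → Sp x v → y ≁ w → w ≁ v → y ≁ v
    Sp-≁-trans {x} {y} {w} {v} sy sw sv@(sp {d} xd refl) yw wv with ~? y v
    ... | inj₂ p = p
    ... | inj₁ yv with cross sy xd
    ...   | adjacent _ vy = ~∧≁ yv (≁-sym vy)
    ...   | fibre refl = ~∧≁ yv (A-irr y)
    ...   | nextFibre a xa refl ad _ with cross sw xd | cross sw xa
    ...     | fibre refl | _ = ~∧≁ yv yw
    ...     | nextFibre _ _ _ _ vw | _ = ~∧≁ vw (≁-sym wv)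
    ...     | adjacent _ _ | fibre refl = ~∧≁ yv wv
    ...     | adjacent _ _ | nextFibre _ _ _ _ yw′ = ~∧≁ yw′ yw
    ...     | adjacent wd _ | adjacent wa _ = ⊥-elim (E≡0⇒ (Sp-E sw) xa xd wa wd ad)

    -- Let d lie in the fibre of v. It is adjacent to some a in the fibre of y and some c in the
    -- fibre of w. Of the four common neighbours of x and d, at least three should be adjacent to y,
    -- but neither a nor c is.
    Sp-triangleFree : ∀ {x y w v} → Sp x y → Sp x w → Sp x v → y ~ w → w ~ v → y ~ v → ⊥
    Sp-triangleFree {x} {y} {w} {v} sy sw sv@(sp {d} xd refl) yw wv yv with cross sy xd | cross sw xd
    ... | adjacent _ vy | _ = ~∧≁ yv (≁-sym vy)
    ... | fibre refl | _ = ~∧≁ yv (A-irr y)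
    ... | nextFibre _ _ _ _ _ | adjacent _ vw = ~∧≁ wv (≁-sym vw)
    ... | nextFibre _ _ _ _ _ | fibre refl = ~∧≁ wv (A-irr w)
    ... | nextFibre a xa ma ad _ | nextFibre c xc mc cd _ = contradiction
        (ℤₚ.≤-trans (T-nextFibre≥3 xa ma ad xd) (subst (T x d y ≤_) total (∑-≤ bound)))
        λ { (+≤+ (s≤s (s≤s ()))) }
      where
      y≁a : y ≁ a
      y≁a = subst (_≁ a) ma (mid-≁ʳ xa (m-mid xa))
      y≁c : y ≁ c
      y≁c with ~? y c
      ... | inj₂ p = p
      ... | inj₁ yc = ~∧≁ yw (≁-sym (subst (_≁ y) mc (proj₁ (cross-adjacent sy xc yc))))
      a≢c : a ≢ c
      a≢c e = ~⇒≢ yw (trans (sym ma) (trans (cong (m x) e) mc))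
      total : ∑ (λ t → 1ℤ * N x d t + - 1ℤ * (δ a t * N x d t) + - 1ℤ * (δ c t * N x d t)) ≡ + 2
      total = trans (∑-lin₃ 1ℤ (N x d) (- 1ℤ) (λ t → δ a t * N x d t) (- 1ℤ) (λ t → δ c t * N x d t))
        (cong₂ _+_ (cong₂ (λ u p → 1ℤ * u + - 1ℤ * p) (∑N-~ xd) (trans (∑-δ a (N x d)) (N≡1 xa (~-sym ad))))
                   (cong (- 1ℤ *_) (trans (∑-δ c (N x d)) (N≡1 xc (~-sym cd)))))
      bound : ∀ t → A y t * N x d t ≤ 1ℤ * N x d t + - 1ℤ * (δ a t * N x d t) + - 1ℤ * (δ c t * N x d t)
      bound t = go (N-bit x d t)
        where
        ar₀ : ∀ a d c → a * 0ℤ ≡ 1ℤ * 0ℤ + - 1ℤ * (d * 0ℤ) + - 1ℤ * (c * 0ℤ)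
        ar₀ = solve-∀
        Goal : ℤ → ℤ → ℤ → Set
        Goal p d c = p * 1ℤ ≤ 1ℤ * 1ℤ + - 1ℤ * (d * 1ℤ) + - 1ℤ * (c * 1ℤ)
        go : ∀ {u} → Bit u → A y t * u ≤ 1ℤ * u + - 1ℤ * (δ a t * u) + - 1ℤ * (δ c t * u)
        go b0 = ℤₚ.≤-reflexive (ar₀ (A y t) (δ a t) (δ c t))
        go b1 with a ≟ t | c ≟ t
        ... | yes refl | yes e = contradiction (sym e) a≢c
        ... | yes refl | no _ = subst (λ p → Goal p 1ℤ 0ℤ) (sym y≁a) ℤₚ.≤-refl
        ... | no _ | yes refl = subst (λ p → Goal p 0ℤ 1ℤ) (sym y≁c) ℤₚ.≤-refl
        ... | no _ | no _ = bit-≤1 (bit-* (A-bit y t) b1)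

    -- An edge among the common neighbours of x and w would have both ends adjacent to y, against E
    -- x y = 0. The other positions in `part` are excluded because no a in the fibre of y has a
    -- common neighbour with x and w.
    Sp-trans : ∀ {x y w} → Sp y x → Sp y w → x ≁ w → x ≢ w → Sp x w
    Sp-trans {x} {y} {w} yx yw x≁w x≢w = E≡0⇒Sp x≢w x≁w (⇒E≡0 λ xs xs′ ws ws′ ss′ →
      E≡0⇒ (Sp-E xy) xs xs′ (near xs ws xs′ ws′ ss′) (near xs′ ws′ xs ws (~-sym ss′)) ss′)
      where
      xy : Sp x y
      xy = Sp-sym yx
      fibre-T≡0 : ∀ {a} → x ~ a → m x a ≡ y → T x a w ≡ 0ℤ
      fibre-T≡0 {a} xa refl with ~? a w
      ... | inj₁ aw = trans (T-swap₁₂ x a w)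
            (trans (T-near (~-sym xa) (mid-swap xa (m-mid xa)) aw (x≢w ∘ sym)) (Sp-≁ yw))
      ... | inj₂ a≁w = ~∧≁ xa (≁-sym (Sp-≁-trans (Sp-sym (Sp-mʳ xa)) yw yx a≁w (≁-sym x≁w)))
      near : ∀ {s s′} → x ~ s → w ~ s → x ~ s′ → w ~ s′ → s ~ s′ → y ~ s
      near xs ws xs′ ws′ ss′ with part xy xs
      ... | adjacent ys = ys
      ... | fibre e = ⊥-elim (T≡0⇒ (fibre-T≡0 xs e) xs′ ss′ ws′)
      ... | nextFibre a xa ma as = ⊥-elim (T≡0⇒ (fibre-T≡0 xa ma) xs as ws)

-- The table of a plane of order 4 and its uniqueness.

-- The neighbours of a vertex will be labelled as a j k and b i l, with a j k
-- adjacent to b i l iff l is table i j k.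
record Table : Set where
  field
    table  : Fin 4 → Fin 4 → Fin 4 → Fin 4
    row₀   : ∀ j k → table zero j k ≡ k
    col₀   : ∀ i k → table i zero k ≡ k
    k-inj  : ∀ i j {k k′} → table i j k ≡ table i j k′ → k ≡ k′
    no-4-cycle : ∀ {i i′ j j′ k k′} → i ≢ i′ → ¬ (j ≡ j′ × k ≡ k′) →
                 table i j k ≡ table i j′ k′ → table i′ j k ≡ table i′ j′ k′ → ⊥


-- The field of order 4 on {0, 1, ω, ω²}.
infixl 6 _⊕_
infixl 7 _⊗_

_⊕_ _⊗_ : Fin 4 → Fin 4 → Fin 4
0F ⊕ y  = y
1F ⊕ 0F = 1F
1F ⊕ 1F = 0F
1F ⊕ 2F = 3F
1F ⊕ 3F = 2F
2F ⊕ 0F = 2F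
2F ⊕ 1F = 3F
2F ⊕ 2F = 0F
2F ⊕ 3F = 1F
3F ⊕ 0F = 3F
3F ⊕ 1F = 2F
3F ⊕ 2F = 1F
3F ⊕ 3F = 0F

0F ⊗ y  = 0F
1F ⊗ y  = y
2F ⊗ 0F = 0F
2F ⊗ 1F = 2F
2F ⊗ 2F = 3F
2F ⊗ 3F = 1F
3F ⊗ 0F = 0F
3F ⊗ 1F = 3F
3F ⊗ 2F = 1F
3F ⊗ 3F = 2F

any₄ all₄ : (Fin 4 → Bool) → Bool
any₄ f = f 0F ∨ f 1F ∨ f 2F ∨ f 3F
all₄ f = f 0F ∧ f 1F ∧ f 2F ∧ f 3F

∨-true : ∀ a {b} → a ∨ b ≡ true → a ≡ true ⊎ b ≡ true
∨-true true  _ = inj₁ refl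
∨-true false e = inj₂ e

∧-true : ∀ a {b} → a ∧ b ≡ true → a ≡ true × b ≡ true
∧-true true e = refl , e

any₄-true : ∀ f → any₄ f ≡ true → ∃ λ i → f i ≡ true
any₄-true f e with ∨-true (f 0F) e
... | inj₁ p = 0F , p
... | inj₂ e₁ with ∨-true (f 1F) e₁
...   | inj₁ p = 1F , p
...   | inj₂ e₂ with ∨-true (f 2F) e₂
...     | inj₁ p = 2F , p
...     | inj₂ p = 3F , p

all₄-true : ∀ f → all₄ f ≡ true → ∀ i → f i ≡ true
all₄-true f e 0F = proj₁ (∧-true (f 0F) e)
all₄-true f e 1F = proj₁ (∧-true (f 1F) (proj₂ (∧-true (f 0F) e)))
all₄-true f e 2F = proj₁ (∧-true (f 2F) (proj₂ (∧-true (f 1F) (proj₂ (∧-true (f 0F) e)))))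
all₄-true f e 3F = proj₂ (∧-true (f 2F) (proj₂ (∧-true (f 1F) (proj₂ (∧-true (f 0F) e)))))

infix 4 _==_
_==_ : ∀ {n} → Fin n → Fin n → Bool
zero  == zero  = true
suc i == suc j = i == j
_     == _     = false

==⇒≡ : ∀ {n} {i j : Fin n} → (i == j) ≡ true → i ≡ j
==⇒≡ {i = zero}  {zero}  _ = refl
==⇒≡ {i = suc i} {suc j} e = cong suc (==⇒≡ e)

==-refl : ∀ {n} (i : Fin n) → (i == i) ≡ true
==-refl zero    = refl
==-refl (suc i) = ==-refl i

not-true : ∀ {b} → not b ≡ true → b ≢ true
not-true {true} ()

-- Backtracking over partial tables: a value is discarded when it contradicts
-- k-inj or no-4-cycle for the values known so far.
module Search where
  Cell : Set
  Cell = Fin 4 × Fin 4 × Fin 4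

  Partial : Set
  Partial = Vec (Vec (Vec (Maybe (Fin 4)) 4) 4) 4

  get : Partial → Cell → Maybe (Fin 4)
  get K (i , j , k) = Vec.lookup (Vec.lookup (Vec.lookup K i) j) k

  set : Partial → Cell → Fin 4 → Partial
  set K (i , j , k) v = Vec.updateAt K i λ R → Vec.updateAt R j λ C → C Vec.[ k ]≔ just v

  is : Maybe (Fin 4) → Fin 4 → Bool
  is nothing  v = false
  is (just u) v = u == v

  repeats : Partial → Cell → Fin 4 → Fin 4 → Bool
  repeats K (i , j , k) v k′ = not (k == k′) ∧ is (get K (i , j , k′)) v

  hits : Partial → Cell → Fin 4 → Fin 4 → Fin 4 → Fin 4 → Fin 4 → Bool
  hits K (i , j , k) v i′ u j′ k′ =
    is (get K (i , j′ , k′)) v ∧ not ((j == j′) ∧ (k == k′)) ∧ is (get K (i′ , j′ , k′)) u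

  clash : Partial → Cell → Fin 4 → Fin 4 → Maybe (Fin 4) → Bool
  clash K c v i′ nothing  = false
  clash K c v i′ (just u) = any₄ λ j′ → any₄ (hits K c v i′ u j′)

  clashes : Partial → Cell → Fin 4 → Fin 4 → Bool
  clashes K (i , j , k) v i′ = not (i == i′) ∧ clash K (i , j , k) v i′ (get K (i′ , j , k))

  conflict : Partial → Cell → Fin 4 → Bool
  conflict K c v = any₄ (repeats K c v) ∨ any₄ (clashes K c v)

  target : Cell → Fin 4
  target (i , j , k) = k ⊕ i ⊗ j

  solved : Partial → Bool
  solved K = all₄ λ i → all₄ λ j → all₄ λ k → is (get K (i , j , k)) (target (i , j , k))

  solve : List Cell → Partial → Bool
  solve []       K = solved K
  solve (c ∷ cs) K = all₄ λ v → conflict K c v ∨ solve cs (set K c v)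

  -- Row 0 and column 0 are those of every `Table`. The other entries express the freedom to
  -- renumber i and j, which `Normalise` uses up.
  given : Fin 4 → Fin 4 → Fin 4 → Maybe (Fin 4)
  given 0F      j             k       = just k
  given (suc i) 0F            k       = just k
  given (suc i) 1F            0F      = just (suc i)
  given 1F      (suc (suc j)) 0F      = just (suc (suc j))
  given _       _             _       = nothing

  start : Partial
  start = Vec.tabulate λ i → Vec.tabulate λ j → Vec.tabulate (given i j)

  -- The 31 cells that `given` leaves open. The slice k = 0, which is the multiplication of the
  -- field, comes first.
  cells : List Cell
  cells = (2F , 2F , 0F) ∷ (2F , 3F , 0F) ∷ (3F , 2F , 0F) ∷ (3F , 3F , 0F) ∷
    List.concatMap (λ k → List.concatMap (λ i → List.map (λ j → i , j , k) nonzero) nonzero) nonzero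
    where
    nonzero : List (Fin 4)
    nonzero = 1F ∷ 2F ∷ 3F ∷ []

  module Sound (t : Table) where
    open Table t

    value : Cell → Fin 4
    value (i , j , k) = table i j k

    Agrees : Partial → Set
    Agrees K = ∀ c {v} → get K c ≡ just v → value c ≡ v

    is-sound : ∀ K → Agrees K → ∀ c {v} → is (get K c) v ≡ true → value c ≡ v
    is-sound K ag c e with get K c in eq
    ... | just u = trans (ag c eq) (==⇒≡ e)

    conflict-sound : ∀ K → Agrees K → ∀ c → conflict K c (value c) ≡ true → ⊥
    conflict-sound K ag c@(i , j , k) e with ∨-true (any₄ (repeats K c (value c))) e
    ... | inj₁ e₁ with any₄-true (repeats K c (value c)) e₁
    ...   | k′ , e₂ with ∧-true (not (k == k′)) e₂
    ...     | ne , e₃ = not-true ne (trans (cong (k ==_) (k-inj i j (is-sound K ag (i , j , k′) e₃))) (==-refl k))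
    conflict-sound K ag c@(i , j , k) e | inj₂ e₁ with any₄-true (clashes K c (value c)) e₁
    ... | i′ , e₂ with ∧-true (not (i == i′)) e₂
    ...   | ne , e₃ with get K (i′ , j , k) in eq
    ...     | just u with any₄-true (λ j′ → any₄ (hits K c (value c) i′ u j′)) e₃
    ...       | j′ , e₄ with any₄-true (hits K c (value c) i′ u j′) e₄
    ...         | k′ , e₅ with ∧-true (is (get K (i , j′ , k′)) (table i j k)) e₅
    ...           | e₆ , e₇ with ∧-true (not ((j == j′) ∧ (k == k′))) e₇
    ...             | ne′ , e₈ = no-4-cycle
      (λ { refl → not-true ne (==-refl i) })
      (λ { (refl , refl) → not-true ne′ (cong₂ _∧_ (==-refl j) (==-refl k)) })
      (sym (is-sound K ag (i , j′ , k′) e₆))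
      (trans (ag (i′ , j , k) eq) (sym (is-sound K ag (i′ , j′ , k′) e₈)))

    set-agrees : ∀ K → Agrees K → ∀ c → Agrees (set K c (value c))
    set-agrees K ag (i , j , k) (i′ , j′ , k′) e with i ≟ i′ | j ≟ j′ | k ≟ k′
    ... | no i≢ | _ | _ = ag (i′ , j′ , k′)
      (trans (cong (λ R → Vec.lookup (Vec.lookup R j′) k′) (sym (Vecₚ.lookup∘updateAt′ i′ i (i≢ ∘ sym) K))) e)
    ... | yes refl | no j≢ | _ = ag (i′ , j′ , k′)
      (trans (cong (λ C → Vec.lookup C k′) (sym (trans (cong (λ R → Vec.lookup R j′) (Vecₚ.lookup∘updateAt i K))
                                                       (Vecₚ.lookup∘updateAt′ j′ j (j≢ ∘ sym) (Vec.lookup K i))))) e)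
    ... | yes refl | yes refl | no k≢ = ag (i′ , j′ , k′)
      (trans (sym (trans (cong (λ C → Vec.lookup C k′) (trans (cong (λ R → Vec.lookup R j) (Vecₚ.lookup∘updateAt i K))
                                                              (Vecₚ.lookup∘updateAt j (Vec.lookup K i))))
                         (Vecₚ.lookup∘updateAt′ k′ k (k≢ ∘ sym) (Vec.lookup (Vec.lookup K i) j)))) e)
    ... | yes refl | yes refl | yes refl = Maybeₚ.just-injective
      (trans (sym (trans (cong (λ C → Vec.lookup C k) (trans (cong (λ R → Vec.lookup R j) (Vecₚ.lookup∘updateAt i K))
                                                             (Vecₚ.lookup∘updateAt j (Vec.lookup K i))))
                         (Vecₚ.lookup∘updateAt k (Vec.lookup (Vec.lookup K i) j)))) e)

    solve-sound : ∀ cs K → Agrees K → solve cs K ≡ true → ∀ c → value c ≡ target c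
    solve-sound [] K ag e (i , j , k) = is-sound K ag (i , j , k)
      (all₄-true (ok i j) (all₄-true (λ j → all₄ (ok i j)) (all₄-true (λ i → all₄ λ j → all₄ (ok i j)) e i) j) k)
      where
      ok : Fin 4 → Fin 4 → Fin 4 → Bool
      ok i j k = is (get K (i , j , k)) (target (i , j , k))
    solve-sound (c ∷ cs) K ag e with ∨-true (conflict K c (value c)) (all₄-true (λ v → conflict K c v ∨ solve cs (set K c v)) e (value c))
    ... | inj₁ bad = ⊥-elim (conflict-sound K ag c bad)
    ... | inj₂ ok  = solve-sound cs (set K c (value c)) (set-agrees K ag c) ok

    start-agrees : (∀ i → table i 1F 0F ≡ i) → (∀ j → table 1F j 0F ≡ j) → Agrees start
    start-agrees col row (i , j , k) e = given-agrees i j k (trans (sym get-start) e)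
      where
      get-start : get start (i , j , k) ≡ given i j k
      get-start = trans (cong (λ R → Vec.lookup (Vec.lookup R j) k) (Vecₚ.lookup∘tabulate (λ i → Vec.tabulate λ j → Vec.tabulate (given i j)) i))
                 (trans (cong (λ C → Vec.lookup C k) (Vecₚ.lookup∘tabulate (λ j → Vec.tabulate (given i j)) j))
                        (Vecₚ.lookup∘tabulate (given i j) k))
      given-agrees : ∀ i j k {v} → given i j k ≡ just v → table i j k ≡ v
      given-agrees 0F j k refl = row₀ j k
      given-agrees (suc i) 0F k refl = col₀ (suc i) k
      given-agrees (suc i) 1F 0F refl = col (suc i)
      given-agrees 1F (suc (suc j)) 0F refl = row (suc (suc j))

  -- The search is run by evaluation: each branch is cut by a conflict or ends in the table k + i j.
  exhausted : solve cells start ≡ true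
  exhausted = refl

  normalised : ∀ (t : Table) → let open Table t in
               (∀ i → table i 1F 0F ≡ i) → (∀ j → table 1F j 0F ≡ j) → ∀ i j k → table i j k ≡ k ⊕ i ⊗ j
  normalised t col row i j k =
    Sound.solve-sound t cells start (Sound.start-agrees t col row) exhausted (i , j , k)

opaque
  injective⇒onto : ∀ {n} {f : Fin n → Fin n} → Injective _≡_ _≡_ f → ∀ z → ∃ λ i → f i ≡ z
  injective⇒onto {n} {f} inj z = support-onto n (λ _ → b1) (∑1 n) f inj (λ _ → refl) z refl

module Normalise (t : Table) where
  open Table t

  -- If rows i and i′ had the same value v at (1, 0), they would also both have v at (0, v), since
  -- column 0 is the identity: a 4-cycle.
  col-inj : Injective _≡_ _≡_ λ i → table i 1F 0F
  col-inj {i} {i′} e with i ≟ i′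
  ... | yes p = p
  ... | no ne = ⊥-elim (no-4-cycle ne (λ { (() , _) })
    (sym (col₀ i (table i 1F 0F))) (trans (sym e) (sym (col₀ i′ (table i 1F 0F)))))

  σ : Fin 4 → Fin 4
  σ i = proj₁ (injective⇒onto col-inj i)

  σ-spec : ∀ i → table (σ i) 1F 0F ≡ i
  σ-spec i = proj₂ (injective⇒onto col-inj i)

  σ-inj : Injective _≡_ _≡_ σ
  σ-inj {i} {i′} e = trans (sym (σ-spec i)) (trans (cong (λ x → table x 1F 0F) e) (σ-spec i′))

  σ₀ : σ 0F ≡ 0F
  σ₀ = col-inj (trans (σ-spec 0F) (sym (row₀ 1F 0F)))

  row-inj : Injective _≡_ _≡_ λ j → table (σ 1F) j 0F
  row-inj {j} {j′} e with j ≟ j′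
  ... | yes p = p
  ... | no ne = ⊥-elim (no-4-cycle {i = σ 1F} {0F}
    (λ σ₁≡0 → contradiction (σ-inj (trans σ₁≡0 (sym σ₀))) λ ()) (ne ∘ proj₁)
    e (trans (row₀ j 0F) (sym (row₀ j′ 0F))))

  τ : Fin 4 → Fin 4
  τ j = proj₁ (injective⇒onto row-inj j)

  τ-spec : ∀ j → table (σ 1F) (τ j) 0F ≡ j
  τ-spec j = proj₂ (injective⇒onto row-inj j)

  τ-inj : Injective _≡_ _≡_ τ
  τ-inj {j} {j′} e = trans (sym (τ-spec j)) (trans (cong (λ x → table (σ 1F) x 0F) e) (τ-spec j′))

  τ₀ : τ 0F ≡ 0F
  τ₀ = row-inj (trans (τ-spec 0F) (sym (col₀ (σ 1F) 0F)))

  -- The renumbering of the columns keeps column 1, so it does not spoil the normalisation already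
  -- achieved by `σ`.
  τ₁ : τ 1F ≡ 1F
  τ₁ = row-inj (trans (τ-spec 1F) (sym (σ-spec 1F)))

  relabelled : Table
  relabelled = record
    { table = λ i j k → table (σ i) (τ j) k
    ; row₀ = λ j k → trans (cong (λ x → table x (τ j) k) σ₀) (row₀ (τ j) k)
    ; col₀ = λ i k → trans (cong (λ y → table (σ i) y k) τ₀) (col₀ (σ i) k)
    ; k-inj = λ i j → k-inj (σ i) (τ j)
    ; no-4-cycle = λ i≢i′ ne → no-4-cycle (i≢i′ ∘ σ-inj) λ (p , q) → ne (τ-inj p , q)
    }

  table-affine : ∀ i j k → table (σ i) (τ j) k ≡ k ⊕ i ⊗ j
  table-affine = Search.normalised relabelled
    (λ i → trans (cong (λ y → table (σ i) y 0F) τ₁) (σ-spec i)) τ-spec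

-- Coordinates for the neighbourhood of a vertex.

module Labelling {n} (Γ : SimpleGraph n) (n≡105 : n ≡ 105) (srg : IsSRG Γ 32 4 12) (o : Fin n) where
  open Structure Γ n≡105 srg public

  -- By `T-near` two elements v, v′ of one fibre would have a common neighbour with x only if the
  -- midpoint y of x v′ were adjacent to v′.
  fibre-unique : ∀ {x y v v′ c} → x ~ v → m x v ≡ y → x ~ v′ → m x v′ ≡ y →
                 x ~ c → v ~ c → v′ ~ c → v ≡ v′
  fibre-unique {x} {y} {v} {v′} xv mv xv′ mv′ xc vc v′c with v ≟ v′
  ... | yes p = p
  ... | no v≢v′ = ⊥-elim (T≡0⇒
    (trans (T-near xv (m⇒Mid xv mv) xv′ (v≢v′ ∘ sym)) (mid-≁ʳ xv′ (m⇒Mid xv′ mv′))) xc vc v′c)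

  -- For two neighbours v, v′ of x the number `T x v v′` is a single entry of A, hence at most 1.
  -- This is the source of `no-4-cycle`.
  two-common : ∀ {x v v′ c c′} → x ~ v → x ~ v′ → v ≢ v′ → c ≢ c′ →
               x ~ c → v ~ c → v′ ~ c → x ~ c′ → v ~ c′ → v′ ~ c′ → ⊥
  two-common {x} {v} {v′} {c} {c′} xv xv′ v≢v′ c≢c′ xc vc v′c xc′ vc′ v′c′ =
    contradiction (ℤₚ.≤-trans (subst (_≤ T x v v′) total (∑-≤ bound)) T≤1) λ { (+≤+ (s≤s ())) }
    where
    T≤1 : T x v v′ ≤ 1ℤ
    T≤1 = ℤₚ.≤-trans (ℤₚ.≤-reflexive (T-near xv (m-mid xv) xv′ (v≢v′ ∘ sym))) (bit-≤1 (A-bit (m x v) v′))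
    total : ∑ (λ w → 1ℤ * δ c w + 1ℤ * δ c′ w) ≡ + 2
    total = trans (∑-lin 1ℤ (δ c) 1ℤ (δ c′)) (cong₂ (λ s u → 1ℤ * s + 1ℤ * u) (∑-δ1 c) (∑-δ1 c′))
    bound : ∀ w → 1ℤ * δ c w + 1ℤ * δ c′ w ≤ A v′ w * N x v w
    bound w with c ≟ w | c′ ≟ w
    ... | yes refl | yes e = contradiction (sym e) c≢c′
    ... | yes refl | no _  = ℤₚ.≤-reflexive (sym (cong₂ _*_ v′c (N≡1 xc vc)))
    ... | no _ | yes refl  = ℤₚ.≤-reflexive (sym (cong₂ _*_ v′c′ (N≡1 xc′ vc′)))
    ... | no _ | no _      = bit-≥0 (T-bit x v v′ w)

  record Fibre (x y : V) : Set where
    field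
      elem     : Fin 4 → V
      elem-inj : Injective _≡_ _≡_ elem
      elem-~   : ∀ i → x ~ elem i
      elem-m   : ∀ i → m x (elem i) ≡ y

  opaque
    enumerate : ∀ {x y} → Sp x y → Fibre x y
    enumerate {x} {y} s = record
      { elem = e
      ; elem-inj = inj
      ; elem-~ = λ i → proj₁ (F≡1⇒ {x} {y} {e i} (on i))
      ; elem-m = λ i → proj₂ (F≡1⇒ {x} {y} {e i} (on i))
      }
      where
      chosen : Σ[ e ∈ (Fin 4 → V) ] Injective _≡_ _≡_ e × (∀ i → F x y (e i) ≡ 1ℤ)
      chosen = support 4 (F-bit x y) (Sp-h s)
      e : Fin 4 → V
      e = proj₁ chosen
      inj : Injective _≡_ _≡_ e
      inj = proj₁ (proj₂ chosen)
      on : ∀ i → F x y (e i) ≡ 1ℤ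
      on = proj₂ (proj₂ chosen)

    fibre-onto : ∀ {x y} → Sp x y → (e : Fin 4 → V) → Injective _≡_ _≡_ e →
                 (∀ i → x ~ e i) → (∀ i → m x (e i) ≡ y) → ∀ {z} → x ~ z → m x z ≡ y → ∃ λ i → e i ≡ z
    fibre-onto {x} {y} s e inj xe me xz mz =
      support-onto 4 (F-bit x y) (Sp-h s) e inj (λ i → ⇒F≡1 (xe i) (me i)) _ (⇒F≡1 xz mz)

    next : ∀ {x y b} → Sp x y → x ~ b → m x b ~ y → ∃ λ v → x ~ v × m x v ≡ y × v ~ b
    next s xb mb~y with cross s xb
    ... | adjacent _ mb≁y = ~∧≁ mb~y mb≁y
    ... | fibre refl = ⊥-elim (~⇒≢ mb~y refl)
    ... | nextFibre v xv mv vb _ = v , xv , mv , vb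

  opaque
    any-Sp : ∃ (Sp o)
    any-Sp = let a , ne = ∑≢0⇒∃ {f = A o} (λ e → contradiction (trans (sym (∑A o)) e) λ ())
             in m o a , Sp-mˡ (bit-≢0 (A-bit o a) ne)

  -- This choice breaks the duality between points and lines. If y₀ is read as a flag sharing its
  -- point with o, the neighbours of y₀ with midpoint o are the flags `ℓ j` sharing the line with o,
  -- and the neighbours of `ℓ zero` with midpoint o are the flags `p i` sharing the point.
  y₀ : V
  y₀ = proj₁ any-Sp

  Sp-oy₀ : Sp o y₀
  Sp-oy₀ = proj₂ any-Sp

  opaque
    ℓ-fibre : Fibre y₀ o
    ℓ-fibre = enumerate (Sp-sym Sp-oy₀)

  module L = Fibre ℓ-fibre

  ℓ : Fin 4 → V
  ℓ = L.elem

  opaque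
    Sp-ℓ : ∀ j → Sp o (ℓ j)
    Sp-ℓ j = Sp-sym (sp (~-sym (L.elem-~ j)) (trans (m-comm (~-sym (L.elem-~ j))) (L.elem-m j)))

  opaque
    p-fibre : Fibre (ℓ zero) o
    p-fibre = enumerate (Sp-sym (Sp-ℓ zero))

  module P = Fibre p-fibre

  p : Fin 4 → V
  p = P.elem

  opaque
    Sp-p : ∀ i → Sp o (p i)
    Sp-p i = Sp-sym (sp (~-sym (P.elem-~ i)) (trans (m-comm (~-sym (P.elem-~ i))) (P.elem-m i)))

  ℓ≁ℓ : ∀ j j′ → ℓ j ≁ ℓ j′
  ℓ≁ℓ j j′ with ~? (ℓ j) (ℓ j′)
  ... | inj₂ e = e
  ... | inj₁ e = ⊥-elim (Sp-triangleFree Sp-oy₀ (Sp-ℓ j) (Sp-ℓ j′) (L.elem-~ j) e (L.elem-~ j′))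

  p~ℓ : ∀ i j → p i ~ ℓ j
  p~ℓ i j with ~? (p i) (ℓ j)
  ... | inj₁ e = e
  ... | inj₂ e = ~∧≁ (P.elem-~ i)
    (≁-sym (Sp-≁-trans (Sp-p i) (Sp-ℓ j) (Sp-ℓ zero) e (ℓ≁ℓ j zero)))

  opaque
    β-fibre : Fibre o (p zero)
    β-fibre = enumerate (Sp-p zero)

  module B₀ = Fibre β-fibre

  -- All third coordinates descend from this numbering of one fibre: `a j k` is the element of the
  -- fibre of `ℓ j` adjacent to `β k`, and `b i l` the element of the fibre of `p i` adjacent to
  -- `a zero l`. This makes row 0 and column 0 of the table trivial.
  β : Fin 4 → V
  β = B₀.elem

  private
    next-a : ∀ j k → ∃ λ v → o ~ v × m o v ≡ ℓ j × v ~ β k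
    next-a j k = next (Sp-ℓ j) (B₀.elem-~ k) (subst (_~ ℓ j) (sym (B₀.elem-m k)) (p~ℓ zero j))

  opaque
    a : Fin 4 → Fin 4 → V
    a j k = proj₁ (next-a j k)

    o~a : ∀ j k → o ~ a j k
    o~a j k = proj₁ (proj₂ (next-a j k))

    m-oa : ∀ j k → m o (a j k) ≡ ℓ j
    m-oa j k = proj₁ (proj₂ (proj₂ (next-a j k)))

    a~β : ∀ j k → a j k ~ β k
    a~β j k = proj₂ (proj₂ (proj₂ (next-a j k)))

  a-inj : ∀ j → Injective _≡_ _≡_ (a j)
  a-inj j {k} {k′} e = B₀.elem-inj (fibre-unique (B₀.elem-~ k) (B₀.elem-m k) (B₀.elem-~ k′) (B₀.elem-m k′)
    (o~a j k) (~-sym (a~β j k)) (subst (β k′ ~_) (sym e) (~-sym (a~β j k′))))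

  private
    next-b : ∀ i l → ∃ λ v → o ~ v × m o v ≡ p i × v ~ a zero l
    next-b i l = next (Sp-p i) (o~a zero l) (subst (_~ p i) (sym (m-oa zero l)) (~-sym (p~ℓ i zero)))

  opaque
    b : Fin 4 → Fin 4 → V
    b i l = proj₁ (next-b i l)

    o~b : ∀ i l → o ~ b i l
    o~b i l = proj₁ (proj₂ (next-b i l))

    m-ob : ∀ i l → m o (b i l) ≡ p i
    m-ob i l = proj₁ (proj₂ (proj₂ (next-b i l)))

    b~a₀ : ∀ i l → b i l ~ a zero l
    b~a₀ i l = proj₂ (proj₂ (proj₂ (next-b i l)))

  b₀≡β : ∀ k → b zero k ≡ β k
  b₀≡β k = fibre-unique (o~b zero k) (m-ob zero k) (B₀.elem-~ k) (B₀.elem-m k)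
    (o~a zero k) (b~a₀ zero k) (~-sym (a~β zero k))

  b-inj : ∀ i → Injective _≡_ _≡_ (b i)
  b-inj i {l} {l′} e = a-inj zero (fibre-unique (o~a zero l) (m-oa zero l) (o~a zero l′) (m-oa zero l′)
    (o~b i l) (~-sym (b~a₀ i l)) (subst (a zero l′ ~_) (sym e) (~-sym (b~a₀ i l′))))

  opaque
    b-onto : ∀ i {z} → o ~ z → m o z ≡ p i → ∃ λ l → b i l ≡ z
    b-onto i = fibre-onto (Sp-p i) (b i) (b-inj i) (o~b i) (m-ob i)

  a≢a : ∀ {j j′ k k′} → ¬ (j ≡ j′ × k ≡ k′) → a j k ≢ a j′ k′
  a≢a {j} {j′} {k} {k′} ne e with L.elem-inj {j} {j′} (trans (sym (m-oa j k)) (trans (cong (m o) e) (m-oa j′ k′)))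
  ... | refl = ne (refl , a-inj j e)

  b≢b : ∀ {i i′ l l′} → i ≢ i′ → b i l ≢ b i′ l′
  b≢b {i} {i′} {l} {l′} ne e = ne (P.elem-inj (trans (sym (m-ob i l)) (trans (cong (m o) e) (m-ob i′ l′))))

  private
    next-π : ∀ i j k → ∃ λ l → b i l ~ a j k
    next-π i j k with next (Sp-p i) (o~a j k) (subst (_~ p i) (sym (m-oa j k)) (~-sym (p~ℓ i j)))
    ... | v , ov , mv , va with b-onto i ov mv
    ...   | l , refl = l , va

  opaque
    π : Fin 4 → Fin 4 → Fin 4 → Fin 4
    π i j k = proj₁ (next-π i j k)

    b~a : ∀ i j k → b i (π i j k) ~ a j k
    b~a i j k = proj₂ (next-π i j k)

  π-unique : ∀ {i j k l} → b i l ~ a j k → π i j k ≡ l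
  π-unique {i} {j} {k} {l} e = b-inj i (fibre-unique (o~b i (π i j k)) (m-ob i (π i j k)) (o~b i l) (m-ob i l)
    (o~a j k) (b~a i j k) e)

  labels : Table
  labels = record
    { table = π
    ; row₀ = λ j k → π-unique (subst (_~ a j k) (sym (b₀≡β k)) (~-sym (a~β j k)))
    ; col₀ = λ i k → π-unique (b~a₀ i k)
    ; k-inj = λ i j {k} {k′} e → a-inj j (fibre-unique (o~a j k) (m-oa j k) (o~a j k′) (m-oa j k′)
        (o~b i (π i j k)) (~-sym (b~a i j k)) (subst (λ l → a j k′ ~ b i l) (sym e) (~-sym (b~a i j k′))))
    ; no-4-cycle = λ {i} {i′} {j} {j′} {k} {k′} i≢i′ ne e e′ →
        two-common (o~a j k) (o~a j′ k′) (a≢a ne) (b≢b i≢i′)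
          (o~b i (π i j k)) (~-sym (b~a i j k)) (subst (λ l → a j′ k′ ~ b i l) (sym e) (~-sym (b~a i j′ k′)))
          (o~b i′ (π i′ j k)) (~-sym (b~a i′ j k)) (subst (λ l → a j′ k′ ~ b i′ l) (sym e′) (~-sym (b~a i′ j′ k′)))
    }

-- The flags of the plane over the field of order 4.

data Point : Set where
  P₀ : Point
  P  : Fin 4 → Point
  R  : Fin 4 → Fin 4 → Point

-- `P j` are the further points of `L₀` and `L i` the further lines through `P₀`. The point `R i l`
-- lies on `L i`, the line `M j k` passes through `P j`, and the affine incidence between these is l
-- = k + i j.
data Line : Set where
  L₀ : Line
  L  : Fin 4 → Line
  M  : Fin 4 → Fin 4 → Line

-- The flags of the projective plane of order 4, in coordinates around the
-- flag f₀ = (P₀ , L₀).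
data Flag : Set where
  f₀    : Flag
  fℓ fp : Fin 4 → Flag
  fa fb : Fin 4 → Fin 4 → Flag
  fc    : Fin 4 → Fin 4 → Fin 4 → Flag

pt : Flag → Point
pt f₀         = P₀
pt (fℓ j)     = P j
pt (fp i)     = P₀
pt (fa j k)   = P j
pt (fb i l)   = R i l
pt (fc j k i) = R i (k ⊕ i ⊗ j)

ln : Flag → Line
ln f₀         = L₀
ln (fℓ j)     = L₀
ln (fp i)     = L i
ln (fa j k)   = M j k
ln (fb i l)   = L i
ln (fc j k i) = M j k

eqᴾ : Point → Point → Bool
eqᴾ P₀      P₀        = true
eqᴾ (P j)   (P j′)    = j == j′
eqᴾ (R i l) (R i′ l′) = (i == i′) ∧ (l == l′)
eqᴾ _       _         = false

eqᴸ : Line → Line → Bool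
eqᴸ L₀      L₀        = true
eqᴸ (L i)   (L i′)    = i == i′
eqᴸ (M j k) (M j′ k′) = (j == j′) ∧ (k == k′)
eqᴸ _       _         = false

eqᴾ⇒≡ : ∀ p q → eqᴾ p q ≡ true → p ≡ q
eqᴾ⇒≡ P₀      P₀        _ = refl
eqᴾ⇒≡ (P j)   (P j′)    e = cong P (==⇒≡ e)
eqᴾ⇒≡ (R i l) (R i′ l′) e = cong₂ R (==⇒≡ (proj₁ (∧-true (i == i′) e))) (==⇒≡ (proj₂ (∧-true (i == i′) e)))

eqᴸ⇒≡ : ∀ p q → eqᴸ p q ≡ true → p ≡ q
eqᴸ⇒≡ L₀      L₀        _ = refl
eqᴸ⇒≡ (L i)   (L i′)    e = cong L (==⇒≡ e)
eqᴸ⇒≡ (M j k) (M j′ k′) e = cong₂ M (==⇒≡ (proj₁ (∧-true (j == j′) e))) (==⇒≡ (proj₂ (∧-true (j == j′) e)))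

eqᴾ-refl : ∀ p → eqᴾ p p ≡ true
eqᴾ-refl P₀      = refl
eqᴾ-refl (P j)   = ==-refl j
eqᴾ-refl (R i l) = cong₂ _∧_ (==-refl i) (==-refl l)

eqᴸ-refl : ∀ p → eqᴸ p p ≡ true
eqᴸ-refl L₀      = refl
eqᴸ-refl (L i)   = ==-refl i
eqᴸ-refl (M j k) = cong₂ _∧_ (==-refl j) (==-refl k)

flag : Point → Line → Maybe Flag
flag P₀      L₀       = just f₀
flag P₀      (L i)    = just (fp i)
flag (P j)   L₀       = just (fℓ j)
flag (P j)   (M j′ k) = if j == j′ then just (fa j′ k) else nothing
flag (R i l) (L i′)   = if i == i′ then just (fb i′ l) else nothing
flag (R i l) (M j k)  = if l == k ⊕ i ⊗ j then just (fc j k i) else nothing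
flag _       _        = nothing

flag-spec : ∀ p l {f} → flag p l ≡ just f → pt f ≡ p × ln f ≡ l
flag-spec P₀      L₀       refl = refl , refl
flag-spec P₀      (L i)    refl = refl , refl
flag-spec (P j)   L₀       refl = refl , refl
flag-spec (P j)   (M j′ k) e with j == j′ in eq | e
... | true | refl = cong P (sym (==⇒≡ eq)) , refl
flag-spec (R i l) (L i′)   e with i == i′ in eq | e
... | true | refl = cong (λ x → R x l) (sym (==⇒≡ eq)) , refl
flag-spec (R i l) (M j k)  e with l == k ⊕ i ⊗ j in eq | e
... | true | refl = cong (R i) (sym (==⇒≡ eq)) , refl

_~ᶠ_ : Flag → Flag → Bool
f ~ᶠ g = not (eqᴾ (pt f) (pt g)) ∧ not (eqᴸ (ln f) (ln g)) ∧
         (is-just (flag (pt f) (ln g)) ∨ is-just (flag (pt g) (ln f)))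

is-just-true : ∀ {a} {A : Set a} (x : Maybe A) → is-just x ≡ true → ∃ λ y → x ≡ just y
is-just-true (just y) _ = y , refl

data Between (f h : Flag) : Set where
  via : ∀ g → f ≢ g → g ≢ h → pt f ≡ pt g → ln g ≡ ln h → Between f h

between : ∀ f h → (f ~ᶠ h) ≡ true → Between f h ⊎ Between h f
between f h e = let e₁ , e₂ = ∧-true (not (eqᴾ (pt f) (pt h))) e
                    e₃ , e₄ = ∧-true (not (eqᴸ (ln f) (ln h))) e₂ in
  found (not-true e₁ ∘ λ p → subst (λ x → eqᴾ (pt f) x ≡ true) p (eqᴾ-refl (pt f)))
        (not-true e₃ ∘ λ p → subst (λ x → eqᴸ (ln f) x ≡ true) p (eqᴸ-refl (ln f)))
        (∨-true (is-just (flag (pt f) (ln h))) e₄)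
  where
  found : pt f ≢ pt h → ln f ≢ ln h →
          is-just (flag (pt f) (ln h)) ≡ true ⊎ is-just (flag (pt h) (ln f)) ≡ true →
          Between f h ⊎ Between h f
  found pt≢ ln≢ (inj₁ e) with is-just-true (flag (pt f) (ln h)) e
  ... | g , eq with flag-spec (pt f) (ln h) eq
  ...   | p , l = inj₁ (via g (λ { refl → ln≢ l }) (λ { refl → pt≢ (sym p) }) (sym p) l)
  found pt≢ ln≢ (inj₂ e) with is-just-true (flag (pt h) (ln f)) e
  ... | g , eq with flag-spec (pt h) (ln f) eq
  ...   | p , l = inj₂ (via g (λ { refl → ln≢ (sym l) }) (λ { refl → pt≢ p }) (sym p) l)

opaque
  flags : Vec Flag 105
  flags = f₀ ∷ (Vec.tabulate fℓ Vec.++ (Vec.tabulate fp Vec.++ (grid fa Vec.++ (grid fb Vec.++ cube))))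
    where
    grid : (Fin 4 → Fin 4 → Flag) → Vec Flag 16
    grid f = Vec.concat (Vec.tabulate λ i → Vec.tabulate (f i))
    cube : Vec Flag 64
    cube = Vec.concat (Vec.tabulate λ j → Vec.concat (Vec.tabulate λ k → Vec.tabulate (fc j k)))

vtx : Fin 105 → Flag
vtx = Vec.lookup flags

-- The position of a flag in `flags`: comparing it with a running counter proves `vtx` injective
-- without comparing all pairs of flags.
index : Flag → ℕ
index f₀         = 0
index (fℓ j)     = 1 ℕ.+ toℕ j
index (fp i)     = 5 ℕ.+ toℕ i
index (fa j k)   = 9 ℕ.+ toℕ j ℕ.* 4 ℕ.+ toℕ k
index (fb i l)   = 25 ℕ.+ toℕ i ℕ.* 4 ℕ.+ toℕ l
index (fc j k i) = 41 ℕ.+ toℕ j ℕ.* 16 ℕ.+ toℕ k ℕ.* 4 ℕ.+ toℕ i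

every : ∀ {a} {A : Set a} {n} → (A → Bool) → Vec A n → Bool
every p []       = true
every p (x ∷ xs) = p x ∧ every p xs

every-true : ∀ {a} {A : Set a} {n} (p : A → Bool) (xs : Vec A n) → every p xs ≡ true →
             ∀ i → p (Vec.lookup xs i) ≡ true
every-true p (x ∷ xs) e zero    = proj₁ (∧-true (p x) e)
every-true p (x ∷ xs) e (suc i) = every-true p xs (proj₂ (∧-true (p x) e)) i

tally : ∀ {a} {A : Set a} {n} → (A → Bool) → Vec A n → ℕ
tally p []       = 0
tally p (x ∷ xs) = if p x then suc (tally p xs) else tally p xs

opaque
  unfolding ∑

  tally-∑ : ∀ {a} {A : Set a} {n} (p : A → Bool) (xs : Vec A n) →
            + tally p xs ≡ ∑ (λ i → χ (p (Vec.lookup xs i)))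
  tally-∑ p []       = refl
  tally-∑ p (x ∷ xs) with p x
  ... | true  = cong (_+_ 1ℤ) (tally-∑ p xs)
  ... | false = trans (tally-∑ p xs) (sym (ℤₚ.+-identityˡ _))

≡ᵇ-true : ∀ m n → (m ℕ.≡ᵇ n) ≡ true → m ≡ n
≡ᵇ-true m n e = ℕₚ.≡ᵇ⇒≡ m n (subst Bool.T (sym e) _)

indexedFrom : ∀ {n} → ℕ → Vec Flag n → Bool
indexedFrom k []       = true
indexedFrom k (f ∷ fs) = (index f ℕ.≡ᵇ k) ∧ indexedFrom (suc k) fs

indexedFrom-true : ∀ {n} k (fs : Vec Flag n) → indexedFrom k fs ≡ true →
                   ∀ i → index (Vec.lookup fs i) ≡ k ℕ.+ toℕ i
indexedFrom-true k (f ∷ fs) e zero    =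
  trans (≡ᵇ-true (index f) k (proj₁ (∧-true (index f ℕ.≡ᵇ k) e))) (sym (ℕₚ.+-identityʳ k))
indexedFrom-true k (f ∷ fs) e (suc i) =
  trans (indexedFrom-true (suc k) fs (proj₂ (∧-true (index f ℕ.≡ᵇ k) e)) i) (sym (ℕₚ.+-suc k (toℕ i)))

opaque
  unfolding flags

  flags-indexed : indexedFrom 0 flags ≡ true
  flags-indexed = refl

vtx-index : ∀ x → index (vtx x) ≡ toℕ x
vtx-index = indexedFrom-true 0 flags flags-indexed

vtx-inj : Injective _≡_ _≡_ vtx
vtx-inj {x} {y} e = Finₚ.toℕ-injective (trans (sym (vtx-index x)) (trans (cong index e) (vtx-index y)))

_~ᴹ_ : Fin 105 → Fin 105 → Bool
x ~ᴹ y = vtx x ~ᶠ vtx y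

degree : Flag → ℕ
degree f = tally (f ~ᶠ_) flags

opaque
  unfolding flags

  degree≡ᵇ32 : every (λ f → degree f ℕ.≡ᵇ 32) flags ≡ true
  degree≡ᵇ32 = refl

~ᴹ-degree : ∀ x → ∑ (λ y → χ (x ~ᴹ y)) ≡ + 32
~ᴹ-degree x = trans (sym (tally-∑ (vtx x ~ᶠ_) flags))
  (cong +_ (≡ᵇ-true (degree (vtx x)) 32 (every-true (λ f → degree f ℕ.≡ᵇ 32) flags degree≡ᵇ32 x)))

pencil : Point → List Flag
pencil P₀      = f₀ ∷ List.map fp (allFin 4)
pencil (P j)   = fℓ j ∷ List.map (fa j) (allFin 4)
pencil (R i l) = fb i l ∷ List.map (λ j → fc j (l ⊕ i ⊗ j) i) (allFin 4)

nearby : Flag → Flag → List Flag → Bool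
nearby f g []       = false
nearby f g (h ∷ hs) = (eqᴾ (pt g) (pt h) ∧ (f ~ᶠ h)) ∨ nearby f g hs

nearby-true : ∀ f g hs → nearby f g hs ≡ true → ∃ λ h → pt g ≡ pt h × (f ~ᶠ h) ≡ true
nearby-true f g (h ∷ hs) e with ∨-true (eqᴾ (pt g) (pt h) ∧ (f ~ᶠ h)) e
... | inj₁ p = h , eqᴾ⇒≡ (pt g) (pt h) (proj₁ (∧-true (eqᴾ (pt g) (pt h)) p)) , proj₂ (∧-true (eqᴾ (pt g) (pt h)) p)
... | inj₂ q = nearby-true f g hs q

-- Injectivity of `φ` has to be shown while `φ` is only known to preserve adjacency and shared
-- points or lines. In the case `near`, f is adjacent to h, whereas g shares its point with h, which
-- makes their images special and so nonadjacent; hence f and g have different images.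
data Separated (f g : Flag) : Set where
  samePt   : pt f ≡ pt g → Separated f g
  sameLn   : ln f ≡ ln g → Separated f g
  adjacent : (f ~ᶠ g) ≡ true → Separated f g
  near     : ∀ h → (f ~ᶠ g) ≡ false → (f ~ᶠ h) ≡ true → pt g ≡ pt h → Separated f g

separatedᵇ : Flag → Flag → Bool
separatedᵇ f g = eqᴾ (pt f) (pt g) ∨ eqᴸ (ln f) (ln g) ∨ (f ~ᶠ g) ∨ nearby f g (pencil (pt g))

separatedᵇ-sound : ∀ f g → separatedᵇ f g ≡ true → Separated f g
separatedᵇ-sound f g e with ∨-true (eqᴾ (pt f) (pt g)) e
... | inj₁ p = samePt (eqᴾ⇒≡ (pt f) (pt g) p)
... | inj₂ e₁ with ∨-true (eqᴸ (ln f) (ln g)) e₁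
...   | inj₁ p = sameLn (eqᴸ⇒≡ (ln f) (ln g) p)
...   | inj₂ e₂ with f ~ᶠ g in eq
...     | true = adjacent eq
...     | false with nearby-true f g (pencil (pt g)) e₂
...       | h , p , q = near h eq q p

opaque
  unfolding flags

  all-separated : every (λ f → every (separatedᵇ f) flags) flags ≡ true
  all-separated = refl

separated : ∀ x y → Separated (vtx x) (vtx y)
separated x y = separatedᵇ-sound (vtx x) (vtx y)
  (every-true (separatedᵇ (vtx x)) flags (every-true (λ f → every (separatedᵇ f) flags) flags all-separated x) y)

-- The isomorphism with the flag graph.

module Uniqueness {n} (Γ : SimpleGraph n) (n≡105 : n ≡ 105) (srg : IsSRG Γ 32 4 12) (o : Fin n) where
  open Labelling Γ n≡105 srg o public
  open Normalise labels public

  φ : Flag → V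
  φ f₀         = o
  φ (fℓ j)     = ℓ (τ j)
  φ (fp i)     = p (σ i)
  φ (fa j k)   = a (τ j) k
  φ (fb i l)   = b (σ i) l
  φ (fc j k i) = m (a (τ j) k) (b (σ i) (k ⊕ i ⊗ j))

  opaque
    a~b : ∀ j k i → a (τ j) k ~ b (σ i) (k ⊕ i ⊗ j)
    a~b j k i = ~-sym (subst (λ l → b (σ i) l ~ a (τ j) k) (table-affine i j k) (b~a (σ i) (τ j) k))

    -- Specials x and z of y that are adjacent to a third special w lie in the same class:
    -- `Sp-triangleFree` makes them nonadjacent and `Sp-trans` special to each other.
    star : ∀ {y w x z} → Sp y w → Sp y x → Sp y z → w ~ x → w ~ z → x ≢ z → Sp x z
    star {x = x} {z} yw yx yz wx wz x≢z with ~? x z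
    ... | inj₁ xz = ⊥-elim (Sp-triangleFree yw yx yz wx xz wz)
    ... | inj₂ xz = Sp-trans yx yz xz x≢z

    Sp-ℓa : ∀ j k → Sp (ℓ j) (a j k)
    Sp-ℓa j k = Sp-sym (subst (Sp (a j k)) (m-oa j k) (Sp-mʳ (o~a j k)))

    Sp-pb : ∀ i l → Sp (p i) (b i l)
    Sp-pb i l = Sp-sym (subst (Sp (b i l)) (m-ob i l) (Sp-mʳ (o~b i l)))

    Sp-ac : ∀ j k i → Sp (φ (fa j k)) (φ (fc j k i))
    Sp-ac j k i = Sp-mˡ (a~b j k i)

    Sp-bc : ∀ j k i → Sp (φ (fb i (k ⊕ i ⊗ j))) (φ (fc j k i))
    Sp-bc j k i = Sp-mʳ (a~b j k i)

    -- Seen from `a (τ j) k`, the vertex o belongs to the fibre of `ℓ (τ j)` and is adjacent to the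
    -- b in question, so `cross-nextFibre` applies to the midpoint of a and b.
    ℓ~c : ∀ j k i → ℓ (τ j) ~ φ (fc j k i)
    ℓ~c j k i = ~-sym (cross-nextFibre (Sp-sym (Sp-ℓa (τ j) k)) (~-sym (o~a (τ j) k))
      (trans (sym (m-comm (o~a (τ j) k))) (m-oa (τ j) k)) (o~b (σ i) (k ⊕ i ⊗ j)) (a~b j k i))

    p~c : ∀ j k i → p (σ i) ~ φ (fc j k i)
    p~c j k i = ~-sym (subst (_~ p (σ i)) (sym (m-comm (a~b j k i)))
      (cross-nextFibre (Sp-sym (Sp-pb (σ i) (k ⊕ i ⊗ j))) (~-sym (o~b (σ i) (k ⊕ i ⊗ j)))
        (trans (sym (m-comm (o~b (σ i) (k ⊕ i ⊗ j)))) (m-ob (σ i) (k ⊕ i ⊗ j)))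
        (o~a (τ j) k) (~-sym (a~b j k i))))

    c-injᵢ : ∀ j k {i i′} → φ (fc j k i) ≡ φ (fc j k i′) → i ≡ i′
    c-injᵢ j k {i} {i′} e with i ≟ i′
    ... | yes q = q
    ... | no i≢ = ⊥-elim (b≢b (i≢ ∘ σ-inj) (fibre-unique (a~b j k i) e (a~b j k i′) refl
      (~-sym (o~a (τ j) k)) (~-sym (o~b (σ i) (k ⊕ i ⊗ j))) (~-sym (o~b (σ i′) (k ⊕ i′ ⊗ j)))))

    c-injⱼ : ∀ {j j′ k k′} i → k ⊕ i ⊗ j ≡ k′ ⊕ i ⊗ j′ → φ (fc j k i) ≡ φ (fc j′ k′ i) → fc j k i ≡ fc j′ k′ i
    c-injⱼ {j} {j′} {k} {k′} i l≡ e with j ≟ j′ | k ≟ k′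
    ... | yes refl | yes refl = refl
    ... | no j≢ | _ = ⊥-elim (same λ q → j≢ (τ-inj (proj₁ q)))
      where
      same : ¬ ¬ (τ j ≡ τ j′ × k ≡ k′)
      same ne = a≢a ne (fibre-unique (~-sym (a~b j k i)) (trans (sym (m-comm (a~b j k i))) e)
        (subst (λ l → b (σ i) l ~ a (τ j′) k′) (sym l≡) (~-sym (a~b j′ k′ i)))
        (trans (cong (λ l → m (b (σ i) l) (a (τ j′) k′)) l≡) (sym (m-comm (a~b j′ k′ i))))
        (~-sym (o~b (σ i) (k ⊕ i ⊗ j))) (~-sym (o~a (τ j) k)) (~-sym (o~a (τ j′) k′)))
    ... | yes refl | no k≢ = ⊥-elim (a≢a (k≢ ∘ proj₂) (fibre-unique (~-sym (a~b j k i)) (trans (sym (m-comm (a~b j k i))) e)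
        (subst (λ l → b (σ i) l ~ a (τ j′) k′) (sym l≡) (~-sym (a~b j′ k′ i)))
        (trans (cong (λ l → m (b (σ i) l) (a (τ j′) k′)) l≡) (sym (m-comm (a~b j′ k′ i))))
        (~-sym (o~b (σ i) (k ⊕ i ⊗ j))) (~-sym (o~a (τ j) k)) (~-sym (o~a (τ j′) k′))))

  Sp-samePt : ∀ f g → f ≢ g → pt f ≡ pt g → Sp (φ f) (φ g)
  Sp-samePt f₀ f₀ ne _ = contradiction refl ne
  Sp-samePt f₀ (fp i) _ _ = Sp-p (σ i)
  Sp-samePt (fp i) f₀ _ _ = Sp-sym (Sp-p (σ i))
  Sp-samePt (fp i) (fp i′) ne _ = star (Sp-ℓ zero) (Sp-p (σ i)) (Sp-p (σ i′))
    (~-sym (p~ℓ (σ i) zero)) (~-sym (p~ℓ (σ i′) zero)) (ne ∘ cong fp ∘ σ-inj ∘ P.elem-inj)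
  Sp-samePt (fℓ j) (fℓ j) ne refl = contradiction refl ne
  Sp-samePt (fℓ j) (fa j k) _ refl = Sp-ℓa (τ j) k
  Sp-samePt (fa j k) (fℓ j) _ refl = Sp-sym (Sp-ℓa (τ j) k)
  Sp-samePt (fa j k) (fa j k′) ne refl = star (Sp-sym (Sp-ℓ (τ j))) (Sp-ℓa (τ j) k) (Sp-ℓa (τ j) k′)
    (o~a (τ j) k) (o~a (τ j) k′) (ne ∘ cong (fa j) ∘ a-inj (τ j))
  Sp-samePt (fb i l) (fb i l) ne refl = contradiction refl ne
  Sp-samePt (fb i l) (fc j k i) _ refl = Sp-bc j k i
  Sp-samePt (fc j k i) (fb i l) _ refl = Sp-sym (Sp-bc j k i)
  Sp-samePt (fc j k i) (fc j′ k′ i′) ne e = go (R-inj e)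
    where
    R-inj : ∀ {i l i′ l′} → R i l ≡ R i′ l′ → i ≡ i′ × l ≡ l′
    R-inj refl = refl , refl
    go : i ≡ i′ × k ⊕ i ⊗ j ≡ k′ ⊕ i′ ⊗ j′ → Sp (φ (fc j k i)) (φ (fc j′ k′ i′))
    go (refl , l≡) = star (Sp-sym (Sp-pb (σ i) (k ⊕ i ⊗ j))) (Sp-bc j k i)
      (subst (λ l → Sp (φ (fb i l)) (φ (fc j′ k′ i))) (sym l≡) (Sp-bc j′ k′ i))
      (p~c j k i) (p~c j′ k′ i) (ne ∘ c-injⱼ i l≡)

  Sp-sameLn : ∀ f g → f ≢ g → ln f ≡ ln g → Sp (φ f) (φ g)
  Sp-sameLn f₀ f₀ ne _ = contradiction refl ne
  Sp-sameLn f₀ (fℓ j) _ _ = Sp-ℓ (τ j)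
  Sp-sameLn (fℓ j) f₀ _ _ = Sp-sym (Sp-ℓ (τ j))
  Sp-sameLn (fℓ j) (fℓ j′) ne _ = star (Sp-p zero) (Sp-ℓ (τ j)) (Sp-ℓ (τ j′))
    (p~ℓ zero (τ j)) (p~ℓ zero (τ j′)) (ne ∘ cong fℓ ∘ τ-inj ∘ L.elem-inj)
  Sp-sameLn (fp i) (fp i) ne refl = contradiction refl ne
  Sp-sameLn (fp i) (fb i l) _ refl = Sp-pb (σ i) l
  Sp-sameLn (fb i l) (fp i) _ refl = Sp-sym (Sp-pb (σ i) l)
  Sp-sameLn (fb i l) (fb i l′) ne refl = star (Sp-sym (Sp-p (σ i))) (Sp-pb (σ i) l) (Sp-pb (σ i) l′)
    (o~b (σ i) l) (o~b (σ i) l′) (ne ∘ cong (fb i) ∘ b-inj (σ i))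
  Sp-sameLn (fa j k) (fa j k) ne refl = contradiction refl ne
  Sp-sameLn (fa j k) (fc j k i) _ refl = Sp-ac j k i
  Sp-sameLn (fc j k i) (fa j k) _ refl = Sp-sym (Sp-ac j k i)
  Sp-sameLn (fc j k i) (fc j k i′) ne refl = star (Sp-sym (Sp-ℓa (τ j) k)) (Sp-ac j k i) (Sp-ac j k i′)
    (ℓ~c j k i) (ℓ~c j k i′) (ne ∘ cong (fc j k) ∘ c-injᵢ j k)

  -- For every flag, one adjacency between its two classes of specials. Since nonadjacency is
  -- transitive on specials, a single pair settles all of them.
  data Opposite (g : Flag) : Set where
    opposite : ∀ f h → pt f ≡ pt g → ln g ≡ ln h → f ≢ g → g ≢ h → φ f ~ φ h → Opposite g

  opposite-pair : ∀ g → Opposite g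
  opposite-pair f₀ = opposite (fp 0F) (fℓ 0F) refl refl (λ ()) (λ ()) (p~ℓ (σ 0F) (τ 0F))
  opposite-pair (fℓ j) = opposite (fa j 0F) f₀ refl refl (λ ()) (λ ()) (~-sym (o~a (τ j) 0F))
  opposite-pair (fp i) = opposite f₀ (fb i 0F) refl refl (λ ()) (λ ()) (o~b (σ i) 0F)
  opposite-pair (fa j k) = opposite (fℓ j) (fc j k 0F) refl refl (λ ()) (λ ()) (ℓ~c j k 0F)
  opposite-pair (fb i l) = opposite (fc 0F l i) (fp i) (cong (R i) (trans (cong (l ⊕_) (i⊗0 i)) (l⊕0 l))) refl (λ ()) (λ ()) (~-sym (p~c 0F l i))
    where
    i⊗0 : ∀ i → i ⊗ 0F ≡ 0F
    i⊗0 0F = refl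
    i⊗0 1F = refl
    i⊗0 2F = refl
    i⊗0 3F = refl
    l⊕0 : ∀ l → l ⊕ 0F ≡ l
    l⊕0 0F = refl
    l⊕0 1F = refl
    l⊕0 2F = refl
    l⊕0 3F = refl
  opposite-pair (fc j k i) = opposite (fb i (k ⊕ i ⊗ j)) (fa j k) refl refl (λ ()) (λ ()) (~-sym (a~b j k i))

  -- Were the images of f and h nonadjacent, the chain f′, f, h, h′ of nonadjacent specials of `φ g`
  -- would make f′ and h′ nonadjacent too.
  Between⇒~ : ∀ {f h} → Between f h → φ f ~ φ h
  Between⇒~ {f} {h} (via g f≢g g≢h p l) with opposite-pair g
  ... | opposite f′ h′ p′ l′ f′≢g g≢h′ f′~h′ with ~? (φ f) (φ h)
  ...   | inj₁ e = e
  ...   | inj₂ e = ~∧≁ f′~h′ (Sp-≁-trans gf′ gf gh′ (≁pt f′ f (trans p′ (sym p)))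
            (Sp-≁-trans gf gh gh′ e (≁ln h h′ (trans (sym l) l′))))
    where
    gf : Sp (φ g) (φ f)
    gf = Sp-samePt g f (f≢g ∘ sym) (sym p)
    gf′ : Sp (φ g) (φ f′)
    gf′ = Sp-samePt g f′ (f′≢g ∘ sym) (sym p′)
    gh : Sp (φ g) (φ h)
    gh = Sp-sameLn g h g≢h l
    gh′ : Sp (φ g) (φ h′)
    gh′ = Sp-sameLn g h′ g≢h′ l′
    ≁pt : ∀ u v → pt u ≡ pt v → φ u ≁ φ v
    ≁pt u v e with ~? (φ u) (φ v)
    ... | inj₂ q = q
    ... | inj₁ q = ~∧≁ q (Sp-≁ (Sp-samePt u v (λ { refl → ~⇒≢ q refl }) e))
    ≁ln : ∀ u v → ln u ≡ ln v → φ u ≁ φ v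
    ≁ln u v e with ~? (φ u) (φ v)
    ... | inj₂ q = q
    ... | inj₁ q = ~∧≁ q (Sp-≁ (Sp-sameLn u v (λ { refl → ~⇒≢ q refl }) e))

  ~ᶠ⇒~ : ∀ f h → (f ~ᶠ h) ≡ true → φ f ~ φ h
  ~ᶠ⇒~ f h e with between f h e
  ... | inj₁ x = Between⇒~ x
  ... | inj₂ x = ~-sym (Between⇒~ x)

  ψ : Fin 105 → V
  ψ x = φ (vtx x)

  ψ-inj : Injective _≡_ _≡_ ψ
  ψ-inj {x} {y} e with x ≟ y
  ... | yes q = q
  ... | no x≢y = ⊥-elim (distinct (separated x y))
    where
    f≢g : vtx x ≢ vtx y
    f≢g = x≢y ∘ vtx-inj
    distinct : Separated (vtx x) (vtx y) → ⊥
    distinct (samePt q) = Sp-≢ (Sp-samePt (vtx x) (vtx y) f≢g q) e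
    distinct (sameLn q) = Sp-≢ (Sp-sameLn (vtx x) (vtx y) f≢g q) e
    distinct (adjacent q) = ~⇒≢ (~ᶠ⇒~ (vtx x) (vtx y) q) e
    distinct (near h n q r) = ~∧≁ (~ᶠ⇒~ (vtx x) h q)
      (subst (_≁ φ h) (sym e) (Sp-≁ (Sp-samePt (vtx y) h (λ { refl → contradiction (trans (sym q) n) λ () }) r)))

  ψ-onto : ∀ z → ∃ λ x → ψ x ≡ z
  ψ-onto z = support-onto 105 {f = λ _ → 1ℤ} (λ _ → b1) ∑1≡105 ψ ψ-inj (λ _ → refl) z refl

  ∑-ψ : ∀ (f : V → ℤ) → ∑ (λ x → f (ψ x)) ≡ ∑ f
  ∑-ψ f = begin
    ∑ (λ x → f (ψ x))                  ≡⟨ ∑-cong (λ x → sym (∑-δ (ψ x) f)) ⟩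
    ∑ (λ x → ∑ λ z → δ (ψ x) z * f z)  ≡⟨ ∑-swap (λ x z → δ (ψ x) z * f z) ⟩
    ∑ (λ z → ∑ λ x → δ (ψ x) z * f z)  ≡⟨ ∑-cong (λ z → trans (∑-cong λ x → ℤₚ.*-comm (δ (ψ x) z) (f z))
                                            (trans (∑-* (f z) (λ x → δ (ψ x) z))
                                            (trans (cong (f z *_) (once z)) (ℤₚ.*-identityʳ (f z))))) ⟩
    ∑ f                                ∎
    where
    open ≡-Reasoning
    once : ∀ z → ∑ (λ x → δ (ψ x) z) ≡ 1ℤ
    once z = let x , e = ψ-onto z in
      trans (∑-cong λ y → trans (cong (δ (ψ y)) (sym e)) (trans (δ-ψ y x) (δ-sym y x))) (∑-δ1 x)
      where
      δ-ψ : ∀ y x → δ (ψ y) (ψ x) ≡ δ y x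
      δ-ψ y x with y ≟ x
      ... | yes refl = δ-refl (ψ y)
      ... | no y≢x = δ-≢ (y≢x ∘ ψ-inj)

  χ-inj : ∀ a b → χ a ≡ χ b → a ≡ b
  χ-inj true  true  _ = refl
  χ-inj false false _ = refl

  -- ψ preserves adjacency, and both graphs are 32-regular.
  ψ-adj : ∀ x y → (x ~ᴹ y) ≡ SimpleGraph.adj Γ (ψ x) (ψ y)
  ψ-adj x y = χ-inj _ _ (≤∧∑≡⇒≡ {f = λ y → χ (x ~ᴹ y)} {g = λ y → A (ψ x) (ψ y)} below
    (trans (~ᴹ-degree x) (sym (trans (∑-ψ (A (ψ x))) (∑A (ψ x))))) y)
    where
    below : ∀ y → χ (x ~ᴹ y) ≤ A (ψ x) (ψ y)
    below y with vtx x ~ᶠ vtx y in eq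
    ... | true  = ℤₚ.≤-reflexive (sym (~ᶠ⇒~ (vtx x) (vtx y) eq))
    ... | false = bit-≥0 (A-bit (ψ x) (ψ y))

-- Homomorphisms and integer combinations in abelian groups.

toAbelian : ∀ {c ℓ} (G : Group c ℓ) → (∀ x y → let open Group G in x ∙ y ≈ y ∙ x) → AbelianGroup c ℓ
toAbelian G comm = record { isAbelianGroup = record { isGroup = Group.isGroup G ; comm = comm } }

record Hom {c ℓ c′ ℓ′} (G : Group c ℓ) (K : Group c′ ℓ′) : Set (c ⊔ ℓ ⊔ c′ ⊔ ℓ′) where
  private
    module G = Group G
    module K = Group K
  field
    fun  : G.Carrier → K.Carrier
    pres : ∀ {x y} → x G.≈ y → fun x K.≈ fun y
    homo : ∀ x y → fun (x G.∙ y) K.≈ fun x K.∙ fun y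

  homo-ε : fun G.ε K.≈ K.ε
  homo-ε = KP.identityˡ-unique (fun G.ε) (fun G.ε)
    (K.trans (K.sym (homo G.ε G.ε)) (pres (G.identityˡ G.ε)))
    where module KP = GroupProps K

  homo-⁻¹ : ∀ x → fun (x G.⁻¹) K.≈ fun x K.⁻¹
  homo-⁻¹ x = KP.inverseˡ-unique (fun (x G.⁻¹)) (fun x)
    (K.trans (K.sym (homo (x G.⁻¹) x)) (K.trans (pres (G.inverseˡ x)) homo-ε))
    where module KP = GroupProps K

module Combination {c ℓ} (K : AbelianGroup c ℓ) where
  open AbelianGroup K hiding (_-_) renaming (refl to ≈-refl; sym to ≈-sym; trans to ≈-trans) public
  open GroupProps group public using (ε⁻¹≈ε; ⁻¹-involutive; x∙y⁻¹≈ε⇒x≈y)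
  open AbelianGroupProps K public using (⁻¹-∙-comm)
  open Mult monoid public using (×-homo-+; ×-congʳ) renaming (_×_ to infixr 8 _⋆_)
  open CommutativeSemigroupProps commutativeSemigroup public using (interchange)
  open SetoidReasoning setoid

  infixr 8 _·_
  _·_ : ℤ → Carrier → Carrier
  (+ n)    · x = n ⋆ x
  -[1+ n ] · x = (suc n ⋆ x) ⁻¹

  ⊖-· : ∀ m n x → (m ⊖ n) · x ≈ (m ⋆ x) ∙ (n ⋆ x) ⁻¹
  ⊖-· zero    zero    x = ≈-sym (≈-trans (identityˡ _) ε⁻¹≈ε)
  ⊖-· zero    (suc n) x = ≈-sym (identityˡ _)
  ⊖-· (suc m) zero    x = ≈-sym (≈-trans (∙-congˡ ε⁻¹≈ε) (identityʳ _))
  ⊖-· (suc m) (suc n) x = begin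
    (suc m ⊖ suc n) · x                   ≡⟨ cong (_· x) (ℤₚ.[1+m]⊖[1+n]≡m⊖n m n) ⟩
    (m ⊖ n) · x                           ≈⟨ ⊖-· m n x ⟩
    (m ⋆ x) ∙ (n ⋆ x) ⁻¹                  ≈⟨ ≈-sym (identityˡ _) ⟩
    ε ∙ ((m ⋆ x) ∙ (n ⋆ x) ⁻¹)            ≈⟨ ∙-congʳ (≈-sym (inverseʳ x)) ⟩
    (x ∙ x ⁻¹) ∙ ((m ⋆ x) ∙ (n ⋆ x) ⁻¹)   ≈⟨ interchange x (x ⁻¹) (m ⋆ x) ((n ⋆ x) ⁻¹) ⟩
    (x ∙ (m ⋆ x)) ∙ (x ⁻¹ ∙ (n ⋆ x) ⁻¹)   ≈⟨ ∙-congˡ (⁻¹-∙-comm x (n ⋆ x)) ⟩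
    (x ∙ (m ⋆ x)) ∙ (x ∙ (n ⋆ x)) ⁻¹      ∎

  +-· : ∀ a b x → (a + b) · x ≈ a · x ∙ b · x
  +-· (+ m)    (+ n)    x = ×-homo-+ x m n
  +-· (+ m)    -[1+ n ] x = ⊖-· m (suc n) x
  +-· -[1+ m ] (+ n)    x = ≈-trans (⊖-· n (suc m) x) (comm _ _)
  +-· -[1+ m ] -[1+ n ] x = begin
    (suc (suc (m ℕ.+ n)) ⋆ x) ⁻¹          ≡⟨ cong (λ k → (suc k ⋆ x) ⁻¹) (sym (ℕₚ.+-suc m n)) ⟩
    ((suc m ℕ.+ suc n) ⋆ x) ⁻¹            ≈⟨ ⁻¹-cong (×-homo-+ x (suc m) (suc n)) ⟩
    ((suc m ⋆ x) ∙ (suc n ⋆ x)) ⁻¹        ≈⟨ ≈-sym (⁻¹-∙-comm (suc m ⋆ x) (suc n ⋆ x)) ⟩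
    (suc m ⋆ x) ⁻¹ ∙ (suc n ⋆ x) ⁻¹       ∎

  neg-· : ∀ a x → (- a) · x ≈ (a · x) ⁻¹
  neg-· (+ zero)  x = ≈-sym ε⁻¹≈ε
  neg-· (+ suc n) x = ≈-refl
  neg-· -[1+ n ]  x = ≈-sym (⁻¹-involutive _)

  ⟦_⟧ : ∀ {n} → Vec ℤ n → (Fin n → Carrier) → Carrier
  ⟦ [] ⟧    s = ε
  ⟦ a ∷ v ⟧ s = a · s zero ∙ ⟦ v ⟧ (s ∘ suc)

_⊞_ : ∀ {n} → Vec ℤ n → Vec ℤ n → Vec ℤ n
_⊞_ = Vec.zipWith _+_

⊟_ : ∀ {n} → Vec ℤ n → Vec ℤ n
⊟_ = Vec.map (λ a → - a)

𝟘 : ∀ {n} → Vec ℤ n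
𝟘 = Vec.replicate _ 0ℤ

unit : ∀ {n} → ℤ → Fin n → Vec ℤ n
unit a zero    = a ∷ 𝟘
unit a (suc i) = 0ℤ ∷ unit a i

-- Iterated addition, so that `Kernel-times` is a plain induction; the coefficients of the
-- certificates lie between -8 and 7.
times : ∀ {n} → ℤ → Vec ℤ n → Vec ℤ n
times (+ zero)     v = 𝟘
times (+ suc n)    v = v ⊞ times (+ n) v
times -[1+ zero ]  v = ⊟ v
times -[1+ suc n ] v = (⊟ v) ⊞ times -[1+ n ] v

combine : ∀ {m n} → Vec ℤ m → Vec (Vec ℤ n) m → Vec ℤ n
combine []       []       = 𝟘
combine (a ∷ as) (v ∷ vs) = times a v ⊞ combine as vs

module _ {c ℓ} (K : AbelianGroup c ℓ) where
  open Combination K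

  ⟦⟧-⊞ : ∀ {n} (u v : Vec ℤ n) s → ⟦ u ⊞ v ⟧ s ≈ ⟦ u ⟧ s ∙ ⟦ v ⟧ s
  ⟦⟧-⊞ []      []      s = ≈-sym (identityˡ ε)
  ⟦⟧-⊞ (a ∷ u) (b ∷ v) s = ≈-trans (∙-cong (+-· a b (s zero)) (⟦⟧-⊞ u v (s ∘ suc)))
    (interchange _ _ _ _)

  ⟦⟧-⊟ : ∀ {n} (u : Vec ℤ n) s → ⟦ ⊟ u ⟧ s ≈ ⟦ u ⟧ s ⁻¹
  ⟦⟧-⊟ []      s = ≈-sym ε⁻¹≈ε
  ⟦⟧-⊟ (a ∷ u) s = ≈-trans (∙-cong (neg-· a (s zero)) (⟦⟧-⊟ u (s ∘ suc))) (⁻¹-∙-comm _ _)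

  ⟦⟧-𝟘 : ∀ {n} s → ⟦ 𝟘 {n} ⟧ s ≈ ε
  ⟦⟧-𝟘 {zero}  s = ≈-refl
  ⟦⟧-𝟘 {suc n} s = ≈-trans (identityˡ _) (⟦⟧-𝟘 (s ∘ suc))

  ⟦⟧-unit : ∀ {n} a (i : Fin n) s → ⟦ unit a i ⟧ s ≈ a · s i
  ⟦⟧-unit a zero    s = ≈-trans (∙-congˡ (⟦⟧-𝟘 (s ∘ suc))) (identityʳ _)
  ⟦⟧-unit a (suc i) s = ≈-trans (identityˡ _) (⟦⟧-unit a i (s ∘ suc))

  ⟦⟧-cong : ∀ {n} (v : Vec ℤ n) {s t} → (∀ i → s i ≈ t i) → ⟦ v ⟧ s ≈ ⟦ v ⟧ t
  ⟦⟧-cong []      e = ≈-refl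
  ⟦⟧-cong (a ∷ v) e = ∙-cong (·-cong a (e zero)) (⟦⟧-cong v (e ∘ suc))
    where
    ·-cong : ∀ a {x y} → x ≈ y → a · x ≈ a · y
    ·-cong (+ n)    e = ×-congʳ n e
    ·-cong -[1+ n ] e = ⁻¹-cong (×-congʳ (suc n) e)

  module _ {n} (s : Fin n → Carrier) where
    Kernel : Vec ℤ n → Set ℓ
    Kernel v = ⟦ v ⟧ s ≈ ε

    Kernel-⊞ : ∀ u v → Kernel u → Kernel v → Kernel (u ⊞ v)
    Kernel-⊞ u v p q = ≈-trans (⟦⟧-⊞ u v s) (≈-trans (∙-cong p q) (identityˡ ε))

    Kernel-⊟ : ∀ u → Kernel u → Kernel (⊟ u)
    Kernel-⊟ u p = ≈-trans (⟦⟧-⊟ u s) (≈-trans (⁻¹-cong p) ε⁻¹≈ε)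

    Kernel-times : ∀ a u → Kernel u → Kernel (times a u)
    Kernel-times (+ zero)     u p = ⟦⟧-𝟘 s
    Kernel-times (+ suc n)    u p = Kernel-⊞ u (times (+ n) u) p (Kernel-times (+ n) u p)
    Kernel-times -[1+ zero ]  u p = Kernel-⊟ u p
    Kernel-times -[1+ suc n ] u p =
      Kernel-⊞ (⊟ u) (times -[1+ n ] u) (Kernel-⊟ u p) (Kernel-times -[1+ n ] u p)

    Kernel-combine : ∀ {m} (as : Vec ℤ m) (vs : Vec (Vec ℤ n) m) →
                     (∀ i → Kernel (Vec.lookup vs i)) → Kernel (combine as vs)
    Kernel-combine []       []       p = ⟦⟧-𝟘 s
    Kernel-combine (a ∷ as) (v ∷ vs) p =
      Kernel-⊞ (times a v) (combine as vs) (Kernel-times a v (p zero)) (Kernel-combine as vs (p ∘ suc))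

module _ {c ℓ c′ ℓ′} (G : AbelianGroup c ℓ) (K : AbelianGroup c′ ℓ′)
         (f : Hom (AbelianGroup.group G) (AbelianGroup.group K)) where
  private
    module G = Combination G
    module K = Combination K
  open Hom f

  fun-· : ∀ a x → fun (a G.· x) K.≈ a K.· fun x
  fun-· (+ n)    x = fun-× n
    where
    fun-× : ∀ n → fun (n G.⋆ x) K.≈ n K.⋆ fun x
    fun-× zero    = homo-ε
    fun-× (suc n) = K.≈-trans (homo _ _) (K.∙-congˡ (fun-× n))
  fun-· -[1+ n ] x = K.≈-trans (homo-⁻¹ _) (K.⁻¹-cong (fun-· (+ suc n) x))

  fun-⟦⟧ : ∀ {n} (v : Vec ℤ n) s → fun (G.⟦ v ⟧ s) K.≈ K.⟦ v ⟧ (fun ∘ s)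
  fun-⟦⟧ []      s = homo-ε
  fun-⟦⟧ (a ∷ v) s = K.≈-trans (homo _ _) (K.∙-cong (fun-· a (s zero)) (fun-⟦⟧ v (s ∘ suc)))

ForAll : ∀ {a b} {A : Set a} {B : Set b} {n} → (A → B → Bool) → Vec A n → Vec B n → Bool
ForAll p []       []       = true
ForAll p (x ∷ xs) (y ∷ ys) = p x y ∧ ForAll p xs ys

ForAll-true : ∀ {a b} {A : Set a} {B : Set b} {n} (p : A → B → Bool) (xs : Vec A n) (ys : Vec B n) →
              ForAll p xs ys ≡ true → ∀ i → p (Vec.lookup xs i) (Vec.lookup ys i) ≡ true
ForAll-true p (x ∷ xs) (y ∷ ys) e zero    = proj₁ (∧-true (p x y) e)
ForAll-true p (x ∷ xs) (y ∷ ys) e (suc i) = ForAll-true p xs ys (proj₂ (∧-true (p x y) e)) i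

-- Propagation of labels over triangles.

Vertex : Set
Vertex = Fin 105

Antisymmetric Additive : ∀ {c ℓ} (K : AbelianGroup c ℓ) → (Vertex → Vertex → AbelianGroup.Carrier K) → Set ℓ
Antisymmetric K e = ∀ x y → (x ~ᴹ y) ≡ true → e y x ≈ e x y ⁻¹
  where open AbelianGroup K
Additive K e = ∀ x y z → (x ~ᴹ y) ≡ true → (y ~ᴹ z) ≡ true → (x ~ᴹ z) ≡ true → e x z ≈ e x y ∙ e y z
  where open AbelianGroup K

-- Labels of arcs are propagated over triangles: once x y and y z are labelled,
-- so is x z.
module Propagate {ℓ} (Lab : Set ℓ) (_⊕_ : Lab → Lab → Lab) (⊖_ : Lab → Lab) where

  Labels : Set ℓ
  Labels = Vec (Vec (Maybe Lab) 105) 105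

  get : Labels → Vertex → Vertex → Maybe Lab
  get t x y = Vec.lookup (Vec.lookup t x) y

  put : Labels → Vertex → Vertex → Lab → Labels
  put t x y v = Vec.updateAt t x λ row → row Vec.[ y ]≔ just v

  -- The guard makes propagation sound for any list of triples: an entry that is no triangle of the
  -- model changes nothing. Completeness of the list matters only for `labels-cover`.
  assign : Vertex → Vertex → Lab → Labels → Labels
  assign x z v t = if x ~ᴹ z then put (put t x z v) z x (⊖ v) else t

  assignAll : ∀ {m} → (Fin m → Vertex × Vertex × Lab) → Labels → Labels
  assignAll {zero}  given t = t
  assignAll {suc m} given t = assignAll (given ∘ suc) (let x , z , v = given zero in assign x z v t)

  extend : Vertex → Vertex → Maybe Lab → Maybe Lab → Labels → Labels
  extend x z (just u) (just v) t = assign x z (u ⊕ v) t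
  extend x z _        _        t = t

  propagate : List (Vertex × Vertex × Vertex) → Labels → Labels
  propagate []                  t = t
  propagate ((x , y , z) ∷ rest) t = propagate rest (extend x z (get t x y) (get t y z) t)

  empty : Labels
  empty = Vec.replicate 105 (Vec.replicate 105 nothing)

  opaque
    run : ∀ {l m} → List (Vertex × Vertex × Vertex) → (Fin l → Vertex × Vertex × Lab) →
          (Fin m → Vertex × Vertex × Lab) → Labels
    run steps given₁ given₂ = propagate steps (assignAll given₂ (assignAll given₁ empty))

  get-empty : ∀ x y → get empty x y ≡ nothing
  get-empty x y = trans (cong (λ r → Vec.lookup r y) (Vecₚ.lookup-replicate x (Vec.replicate 105 nothing)))
                        (Vecₚ.lookup-replicate y nothing)

  get-put : ∀ t x y v x′ y′ → (x ≡ x′ × y ≡ y′ × get (put t x y v) x′ y′ ≡ just v)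
                              ⊎ get (put t x y v) x′ y′ ≡ get t x′ y′
  get-put t x y v x′ y′ with x ≟ x′ | y ≟ y′
  ... | no x≢ | _ = inj₂ (cong (λ r → Vec.lookup r y′) (Vecₚ.lookup∘updateAt′ x′ x (x≢ ∘ sym) t))
  ... | yes refl | no y≢ = inj₂ (trans (cong (λ r → Vec.lookup r y′) (Vecₚ.lookup∘updateAt x t))
                                       (Vecₚ.lookup∘updateAt′ y′ y (y≢ ∘ sym) (Vec.lookup t x)))
  ... | yes refl | yes refl = inj₁ (refl , refl ,
    trans (cong (λ r → Vec.lookup r y) (Vecₚ.lookup∘updateAt x t)) (Vecₚ.lookup∘updateAt y (Vec.lookup t x)))

  module Sound {c ℓ′} (K : AbelianGroup c ℓ′)
    (eval : Lab → AbelianGroup.Carrier K)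
    (eval-⊕ : ∀ u v → AbelianGroup._≈_ K (eval (u ⊕ v)) (AbelianGroup._∙_ K (eval u) (eval v)))
    (eval-⊖ : ∀ u → AbelianGroup._≈_ K (eval (⊖ u)) (AbelianGroup._⁻¹ K (eval u)))
    (e : Vertex → Vertex → AbelianGroup.Carrier K)
    (~ᴹ-sym : ∀ x y → (x ~ᴹ y) ≡ true → (y ~ᴹ x) ≡ true)
    (e-anti : Antisymmetric K e) (e-tri : Additive K e) where
    private
      module K = AbelianGroup K

    Correct : Vertex → Vertex → Lab → Set ℓ′
    Correct x y v = eval v K.≈ e x y

    Valid : Labels → Set (ℓ ⊔ ℓ′)
    Valid t = ∀ x y {v} → get t x y ≡ just v → (x ~ᴹ y) ≡ true × Correct x y v

    put-valid : ∀ t x y v → (x ~ᴹ y) ≡ true → Correct x y v → Valid t → Valid (put t x y v)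
    put-valid t x y v xy ok valid x′ y′ eq with get-put t x y v x′ y′
    ... | inj₂ same = valid x′ y′ (trans (sym same) eq)
    ... | inj₁ (refl , refl , new) with trans (sym new) eq
    ...   | refl = xy , ok

    assign-valid : ∀ x z v t → ((x ~ᴹ z) ≡ true → Correct x z v) → Valid t → Valid (assign x z v t)
    assign-valid x z v t ok valid with x ~ᴹ z in xz
    ... | false = valid
    ... | true  = put-valid (put t x z v) z x (⊖ v) (~ᴹ-sym x z xz)
      (K.trans (eval-⊖ v) (K.trans (K.⁻¹-cong (ok refl)) (K.sym (e-anti x z xz))))
      (put-valid t x z v xz (ok refl) valid)

    assignAll-valid : ∀ {m} (given : Fin m → Vertex × Vertex × Lab) t →
      (∀ i → let x , z , v = given i in (x ~ᴹ z) ≡ true → Correct x z v) → Valid t → Valid (assignAll given t)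
    assignAll-valid {zero}  given t ok valid = valid
    assignAll-valid {suc m} given t ok valid = let x , z , v = given zero in
      assignAll-valid (given ∘ suc) (assign x z v t) (ok ∘ suc) (assign-valid x z v t (ok zero) valid)

    propagate-valid : ∀ steps t → Valid t → Valid (propagate steps t)
    propagate-valid []                   t valid = valid
    propagate-valid ((x , y , z) ∷ rest) t valid =
      propagate-valid rest (extend x z (get t x y) (get t y z) t) (extend-valid (get t x y) (get t y z) refl refl)
      where
      extend-valid : ∀ u v → get t x y ≡ u → get t y z ≡ v → Valid (extend x z u v t)
      extend-valid nothing  v        _ _ = valid
      extend-valid (just u) nothing  _ _ = valid
      extend-valid (just u) (just v) p q = assign-valid x z (u ⊕ v) t
        (λ xz → let xy , ok₁ = valid x y p ; yz , ok₂ = valid y z q in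
          K.trans (eval-⊕ u v) (K.trans (K.∙-cong ok₁ ok₂) (K.sym (e-tri x y z xy yz xz)))) valid

    empty-valid : Valid empty
    empty-valid x y eq = contradiction (trans (sym eq) (get-empty x y)) λ ()

    opaque
      unfolding run

      run-valid : ∀ {l m} steps (given₁ : Fin l → Vertex × Vertex × Lab) (given₂ : Fin m → Vertex × Vertex × Lab) →
        (∀ i → let x , z , v = given₁ i in (x ~ᴹ z) ≡ true → Correct x z v) →
        (∀ i → let x , z , v = given₂ i in (x ~ᴹ z) ≡ true → Correct x z v) →
        Valid (run steps given₁ given₂)
      run-valid steps given₁ given₂ ok₁ ok₂ =
        propagate-valid steps (assignAll given₂ (assignAll given₁ empty))
          (assignAll-valid given₂ (assignAll given₁ empty) ok₂
            (assignAll-valid given₁ empty ok₁ empty-valid))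

-- Numerical certificates.

vertex : ℕ → Vertex
vertex k = k mod 105

-- Least significant digit first.
digits : (b : ℕ) .{{_ : NonZero b}} → ℕ → ℕ → List ℕ
digits b zero    m = []
digits b (suc k) m = m % b ∷ digits b k (m / b)

-- The parents of the vertices in a spanning tree of depth 2 rooted at 0, two
-- hexadecimal digits each, the parent of vertex 0 being the last pair.
parents : Vec Vertex 105
parents = Vec.map vertex (Vec.fromList (digits 256 105
  0x1C1C1E161E1E161E13281E0E0E131E1C1E1E131E16281E1C13131E0E130E1E130E0E1E0E0E0E1E0E28171E1C1E1E0E1E130E1E280E1B1E131E1E171E28161E1C00000000000000000000000000000000000000000000000000000000000000001E1E1C1E0E0E130E00))

parent : Vertex → Vertex
parent = Vec.lookup parents

-- 16 arcs that generate the abelianised fundamental group modulo the tree.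
seeds : Vec (Vertex × Vertex) 16
seeds = (88 ▹ 95) ∷ (14 ▹ 88) ∷ (49 ▹ 103) ∷ (48 ▹ 83) ∷ (66 ▹ 77) ∷ (74 ▹ 96) ∷ (14 ▹ 42) ∷ (79 ▹ 101) ∷
        (29 ▹ 103) ∷ (67 ▹ 94) ∷ (48 ▹ 93) ∷ (55 ▹ 90) ∷ (27 ▹ 93) ∷ (13 ▹ 67) ∷ (12 ▹ 78) ∷ (33 ▹ 47) ∷ []
  where
  _▹_ : ℕ → ℕ → Vertex × Vertex
  x ▹ y = vertex x , vertex y

-- The images of the seeds in C₃², in terms of the last two seeds.
codes : Vec (Z3 × Z3) 16
codes = (c2 , c0) ∷ (c2 , c0) ∷ (c0 , c1) ∷ (c0 , c2) ∷ (c1 , c2) ∷ (c2 , c1) ∷ (c2 , c2) ∷ (c2 , c2) ∷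
        (c1 , c2) ∷ (c0 , c1) ∷ (c0 , c0) ∷ (c1 , c2) ∷ (c1 , c1) ∷ (c1 , c2) ∷ (c1 , c0) ∷ (c0 , c1) ∷ []

triples : List ℕ → List (Vertex × Vertex × Vertex)
triples (x ∷ y ∷ z ∷ rest) = (vertex x , vertex y , vertex z) ∷ triples rest
triples _                  = []

-- Triples x y z (two hexadecimal digits per vertex, read from right to left)
-- in an order in which x y and y z are labelled before x z.
steps : List (Vertex × Vertex × Vertex)
steps = List.concatMap (triples ∘ digits 256 45) (
  0x14001C10001C0C001C2800132200131D00131B001327000E24000E1D000E1A000E17001E14001E0D001E0A001E ∷
  0x0F001B0B001B1200251000250900252500172400171B00170D00280C00282800162100161F00161A001618001C ∷
  0x1900111500271400270B00271500221000220A002218001D09001D11002424000C20000C1400210F0021090021 ∷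
  0x0B00231800260F00262300122000121A001226000A1A000A1500190D001909001910001F0B001F2600111F0011 ∷
  0x461E55361E55051E554A1E633E1E63361E63071E635A1E583E1E58321E58081E580F00202000151800230D0023 ∷
  0x391E5A2F1E5A171E5A421E61321E613C1E360A1E36611E05391E052D1E05611E523C1E522F1E52141E52661E55 ∷
  0x3E1E2D571E420D1E424E1E64461E642A1E64661E30421E30301E4A141E4A641E083C1E08301E084A1E392A1E39 ∷
  0x0A1E325E1E3C171E665E1E57661E3B4E1E3B321E3B571E2A0A1E2A571E073B1E072F1E070D1E3E5E1E2D4E1E2D ∷
  0x480E4D030E4D5C0E04440E4B030E4B430E5D040E5D5C0E47240E47450E37010E37171E5E0D1E46461E2F141E4E ∷
  0x31134F22134F1D135628134C1B134949135B2813501A0E451A0E41410E34010E341D0E3A270E44270E48240E43 ∷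
  0x31135835285813285832585F285F5866173F0C282C2C285F0D28401F16621A1665181C59141C51101C3D0C1C29 ∷
  0x1C67315B58453258455A584331584328583A085803450E58430E583A0E58030E5802133E5A58353E58135B1358 ∷
  0x4F3142310C4242300C3A28300C28306630532853303A58595F583D681C08591C583D1C5808581C58311C0C1C31 ∷
  0x0C3163634A3131134A1D134A394A6013604A57425C31425C6142375C0E42370E421D0E4230424D0E4D420D424F ∷
  0x0A1A315A394F314F1A391A4F1A654F60391A5C0E394B0E391A0E39480E2A430E2A010E2A392A0E3E632C2C0C63 ∷
  0x3C5E103D105E31435E10435E291C48081C48484D1C141C4D1C674D4D3067303A673A1D67102243435A22224F5A ∷
  0x435D301B1759593A17475C252417673A67173F175C25175C575E456731175C3117451A5E25103C175E311A315E ∷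
  0x2A486529480D280D48654F480D4F484F224815226748082267302208302250285D40285D2243304A305D28305D ∷
  0x2C2839053928395C285C315328165C310A535C57166216570A2A531665572A4853572A653E0D29532848352848 ∷
  0x6722455745223117012E17014537220A2237013717225A37175A37610504045D054F392C5D28053528054C2839 ∷
  0x091D32045C0810223F50132A49132A1D673260135708225C3F5C222A01133813013245671322575C5722133101 ∷
  0x2A5067456750103F4A1D4A3F6717505A17504A5D3F505D173F175D2E175D171B5D435D1B5F3209680804640804 ∷
  0x0A324C43244C1F103E60391532674C24674C43102C3E2C101567394C39671C10392C3910392A671A4550394A10 ∷
  0x175E484D485E65574440283748285E442757075727284C3742374C284C5E2D5E4C576027370A4C5E434C271560 ∷
  0x5331235A43294C43291B4329314323290D43230D43491B444C376544651B331B653717651B17656548175A3740 ∷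
  0x240C2F3E291A3E63184853123F66232F5A0C1A0A291823631223536653230C295A505A290A4C290B1B29633123 ∷
  0x251044654C4656132F01132F336558446510462F4C134C2F583E65103E6537653E4C242F651A3E023E180D233F ∷
  0x2B16642816642837072744316731440A31440D4633644616370107314A44336546166546072F013A58334A1044 ∷
  0x3C364F29503B4F65364E643745376450283B6544364B44363A28643728643B07285F2807532807360A44400D33 ∷
  0x083C023F664C134C66511C663D1C66061C6656133C49133C02133C4C29661C2966134F3C253C4F663B290B293B ∷
  0x124802223F2D3813551B13553D664F2C4F661A5E494808022D4C3F5566134F136617665130663D2366065E3C49 ∷
  0x365543104355190D3D5F2C1759172C01172C3F17023A1702052D224F222D431B550D4F3D17662C121A49174802 ∷
  0x49445A27445A394F115A2F44522F3D11244F44102F3D102F4F36243D5F242F011024433624175F102C01452205 ∷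
  0x02123D523D124A14450E373C2512583D58123358124550143C4937585A1253125A142750375A4912495A505A27 ∷
  0x415220604A37470E52410E52030E524F3C5D2E5D3C563C2705452520125237454A523C0E5D0E3C270E3C455825 ∷
  0x665133633E513312513E1A51121A5132614B1A605157603A4B44615117603A1760251760442561173760610525 ∷
  0x5D434E23434E681C2D023F0C592C4E432C4E1C0C2D3F2D0C2C0C4E2D4E0C251040374055105540556640403366 ∷
  0x114F68120242290C3C2E3C0C18593B4C4314511443374E2306234E4F2D683E2D68420C023C020C3B4E59144E43 ∷
  0x523C29253C29630C2E200C2E02183B27144C654C142A43512243516051430B23376537233C3723424F68254F68 ∷
  0x3643600D436061370B4A370B40370B57652353233C083C231D42684525681725680468115742124C4212511242 ∷
  0x4C29255C252905252922632E0B3B02073B0212023B3F4C27324C275214654F6514642A51635122335122052251 ∷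
  0x290B4A304A0B020B403A57232E3C53103C536808232E681D08681D4A45682E1768674C122D4C121D42511B2952 ∷
  0x48273247526521144F1251644822631522635C22330A22334633221D5105280551156036460D603D0D6004610B ∷
  0x091D2E532E1D52126753122D321D513D521B464C253E295C0B295C575C291D052957222E49123B07273F602732 ∷
  0x395C333A330A65361537603D27603D523D60670B0448294A270B3067300B08024063233A06233A3E1053432368 ∷
  0x44572E323B491D3F073B32606132480932484F48322365471565475D4F21424F212C4F210464123548630E4863 ∷
  0x1D0840283A06023A065543682A43683167522267523C52670F1B3D183E5C1C29575A291D3A1D295D2E57092E57 ∷
  0x186335410E63040E631B33394A3933023A0A1915655865151C3D374E373D0A373D50273D12484A5627302A670B ∷
  0x671D07183B605348611C48613548090248095D4F32114F320D23473F5D21055D21374221632C215A12045D0412 ∷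
  0x5F3D0F4E3D0F303D0F335C1826185C07571C181D5A643A291C575D405D57350957202E4461442E1B4932093249 ∷
  0x433056400B2A1F0B2A512A0B561D40321D405E28064202063E02062E685511685525682A492A680A2A683F2252 ∷
  0x2163410C63040763041104630F1B39684A33440A024C65192A65195F581503581549371C103D502A503D20124A ∷
  0x181C611909353E02090A325D5832115132110F213F412105290521092137603721553721162163601835366341 ∷
  0x04680A61523F3B4E0F3A300F611833425C264F5A18445A181B2964181C5D4257350B612E45321B526018261860 ∷
  0x374A20492A1F482A1F0D40561040324B324021065E2642062142061A3E060C2E554655113755111911553B4968 ∷
  0x6437093B60214A63164660351A60355F07045A390F4C390F0802442D4C19512A1922155F141C493B50105F3D2A ∷
  0x305D183E185D6842353B0B2E1F0B2E0F1B450352184A60264360265A35192D3E09261158595811613F0F204105 ∷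
  0x621F4808481F0110326606264A26064E061A4E3711013711283B68683B0F200F3A573A0F3A336103184F08641B ∷
  0x4E1A350A1A35095F04405A0F045A0F464C0F20440846225F2D225F65103B22103B1F2A5F3E37200737205A491F ∷
  0x411A4E594E1A1F114E3E680F593A200D4F035D2E1F484A262C432665582604115948610F3505202E0964684A16 ∷
  0x4368162D681648354E144E35590409200F462C5F4655465F19653B593B22075F1F5C3E20161F5A0D4862406626 ∷
  0x491F0545051F62162D38555F073B193F0D624B4026644E41161A59513E0F4A2059560D03055D1F0A262C050459 ∷
  0x3E582B25582B48222B0A222B250938511D62181D6252412B58592B22592B245F38095F381D3F622B64412B1659 ∷
  0x5E4538503B6239602B50142B49142B5E482B0F482B5D0A2B440A2B4525381451623B186230186260522B14522B ∷
  0x522F0959092F48092F6321563B21560621566744214B44210844215D212F09212F562F21442F21092D502D6250 ∷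
  0x653B56123B562756060356061C06565521671621672A67215E214B29214B14214B6021082C2108580821462F5D ∷
  0x505D461C5D460E5D463809523152090352094C2F593A592F1A592F62482F4D482F26482F405663356356116356 ∷
  0x175E4B64294B3E294B0C294B404B1462144B35144B1F08600408601A60081D082C012C083F21585B5821335821 ∷
  0x4A0603520306611C56391C562D1C563A67551267554D67163C67163267163F212A06212A532A213D5E4B385E4B ∷
  0x1563402540633C56350A35563056111F11563056651D56651765566412562012563E06275A27063227064E0603 ∷
  0x49090318594C424C59274C59102F3A233A2F072F1A451A2F242F6251622F5A2F4D132F4D072F265C262F316340 ∷
  0x114650491C46311C46061C464B0E46340E461D0E466552383F5238205238640931190931433109570903500903 ∷
  0x621D2C30080138010834010835583F11583F623F5842215B29215B16215B5E2133412133092133334650204650 ∷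
  0x394B6230624B1F624B68354B19354B52601F3A601F36601F1360040D60040C046040081A30081A501A084E2C1D ∷
  0x602153412153142153394B38264B38034B1759174B264B6412644B133E4B324B0C034B0C5214404D1440024014 ∷
  0x1A125564164D034D1662163C59163C023C165C1632613216013216642A3F492A3F0C3F2A252A06192A06012A06 ∷
  0x104A030B4A032806522252061B52064356611356615C39562B395640562D5F2D5638553A19553A365512481255 ∷
  0x5330114D30114765300C306536651D051D65275664456456435620683E272C3E27045A0623063215034E0F4E03 ∷
  0x4326076707263D2F5C0B5C2F0F40316640155D40150240150763254C256338256319353C673C35103C3503560A ∷
  0x643A104D2F234F1A075F071A3F071A0C2F4568452F5762243B6224442F51195A4D60134D3E134D1B134D4B2607 ∷
  0x4A31193B19310209433643093043090757031503490D03490549035E4C1803184C2B59421B59420D4259055927 ∷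
  0x2C46495B494602064622464B554634254634531D463B65381665385D3F38273F380D3F385E38204F31645C3119 ∷
  0x2D165B4D5E333C5E336833410D33414E41336633093933092750336133506250202A5020295011631150261150 ∷
  0x1F08341B0834663F35523F11023F114D113F31586225586215586251425B30425B52295B48295B0A295B54165B ∷
  0x2D0C60591A40491A30411A30230850671D4E131D4E3D4E1D0A2C6257622C1830010F30011C0838243808230834 ∷
  0x3A02141B396223684B614B1947521F31521F491F3A333A1F451F360B1F366613045B130467040D620D042B600C ∷
  0x2E53144514535A39384226380A2638511703364B594164262E6426182664200C32550C035B524025404D451402 ∷
  0x533C593D0216475C325416611A16612D16012B16015C3F494E06256225062E01061560535A53411053415C5314 ∷
  0x2C43612443611D562B26402D0B402D3C565F2D193A6248552B48552748552E551A2E644D541603373C6251623C ∷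
  0x3F1D362665052365050405650D56451527680B272C5E06045F3223644E1553100358030B4F030B6828522C2852 ∷
  0x2E634C5163385D3C19083C192467350B67354235100110354D030A2411535E4D114A30470F304725473033650C ∷
  0x2C3E4D203E4D1B43073C67264E3D5C462F0B2015662966152F5D154715023915024202154725072B250741634C ∷
  0x20074F411A5F291A5F2C0C451124574057240E243B493B246651442851441151442C4D193B604D36604D674D3E ∷
  0x5009365E491563154944490D1D185E455E1808034C502B4235421B470D593D27053127050464105F234D05234D ∷
  0x262C4934465B20465B6755340C55346125344F25340925344E5D380B273801380D3A644F244F6455195C454A19 ∷
  0x17485B345B0A360A5B4E2D5B192D5B1C6841176841190D412E093907273341206259202A0111293D506312492C ∷
  0x414E132E1D3D2A01183318015B34235723343F23345A1F34561F343E1F34591B343D1B34345B5118525B27485B ∷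
  0x5A1F472E1F4742311F66331F0F45365C0B360E046610045B07045B146204240C2B0B30412B502347235044674E ∷
  0x012E146653451B45535F3842530A381C593634412658262E41203218035524405B0545022D621B394B23151961 ∷
  0x19552B0D03540C03540803540F513C663D165132470A32473A61543761542561540E012D122D01052D01246206 ∷
  0x1C07471F2E4C4724353E532424474A134A47210F4718235F4715642B580B47522C3361240561245E2D0B66552B ∷
  0x5762412E205B280C34156134144F34475C5547155E2E440D144D5F4A295F340E3B3644285F284463071B012F15 ∷
  0x2237541137544725542A2554122554061C36010F362D50472D4E444A59345E3D34545B27545B360217415B2E39 ∷
  0x2611545D12543B1254545B3954475E54145F544735410D54310C541B08545416662F3A541D3A54143A543E3754 ∷
  [])

-- Triangles that propagation leaves as conditions. Their residues generate all the relations among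
-- the seeds that are used.
triangles : Vec (Vertex × Vertex × Vertex) 28
triangles = Vec.fromList (triples (digits 256 84
  0x310F015E342861371C3E37095A4F345020085B402D65461D3E34093F07024D191168330A5B30274E480F5C5617411C1057450F633A0E671204450C02371C073905025D3E1F3E200F5A41343A290A634A485B4E13))

-- Coefficients of the triangles, as hexadecimal digits with offset 8, in the
-- combinations that give 6 s (for sixfold) and codedRelation (for coded).
coefficients : ℕ → Vec ℤ 28
coefficients m = Vec.map (λ d → d ⊖ 8) (Vec.fromList (digits 16 28 m))

sixfold : Vec ℕ 16
sixfold =
  0x986789787988989677899987877A ∷ 0x88988798978778897986777A9798 ∷
  0xA6D996979979688A9856586A88BA ∷ 0x99667879879698787879B8999787 ∷
  0x98987788988779787877887998A7 ∷ 0x889A78988787597778A7787898B9 ∷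
  0x688989987687888789A886A77777 ∷ 0x7878A9A7977587B8898887A87976 ∷
  0x7889788869877775998789878989 ∷ 0x97B89888978899896879888A9878 ∷
  0xA7A888788A88897787599978878A ∷ 0x88698789799998889789A8978A99 ∷
  0xC96589798A9788567688A99675AA ∷ 0x99789888888698968888A897879A ∷
  0x87979A8797777AA9687886687867 ∷ 0xA889989A9A7868896988798987A8 ∷
  []

coded : Vec ℕ 16
coded =
  0x87879A87787789A8986997865868 ∷ 0x87A8AA8787769AA7787896877769 ∷
  0x989999798979686777978968998A ∷ 0x9899A97B9A78876668888A99978A ∷
  0x9789A98A89677795769969A88788 ∷ 0x789A9899987479A78A6988888877 ∷
  0x777A989B8A7788A7897A78B76796 ∷ 0x9878AA8A886578A7788A88987656 ∷
  0x777A998B7A789795789A79C77787 ∷ 0x8889768A888867679798698998A7 ∷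
  0x8888878889878787A86889888889 ∷ 0xB889988B7A787878888989987599 ∷
  0xA977887A89868877887999888578 ∷ 0xA7AAA88A8A6888A778796989857A ∷
  0x87979A8797777AA9687886687867 ∷ 0xA889989A9A7868896988798987A8 ∷
  []

seed₁ seed₂ : Fin 16 → Vertex
seed₁ i = proj₁ (Vec.lookup seeds i)
seed₂ i = proj₂ (Vec.lookup seeds i)

-- Relations among the seeds over the integers.

module Integral where
  open Propagate (Vec ℤ 16) _⊞_ ⊟_ public

  onTree : Fin 105 → Vertex × Vertex × Vec ℤ 16
  onTree w = parent w , w , 𝟘

  onSeeds : Fin 16 → Vertex × Vertex × Vec ℤ 16
  onSeeds i = seed₁ i , seed₂ i , unit 1ℤ i

  residueOf : Maybe (Vec ℤ 16) → Maybe (Vec ℤ 16) → Maybe (Vec ℤ 16) → Vec ℤ 16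
  residueOf (just u) (just v) (just w) = (u ⊞ v) ⊞ (⊟ w)
  -- Harmless default: the zero combination is a relation in every group.
  residueOf _        _        _        = 𝟘

  residue : Labels → Vertex × Vertex × Vertex → Vec ℤ 16
  residue t (x , y , z) = residueOf (get t x y) (get t y z) (get t x z)

  four : Z3 → ℤ
  four c0 = 0ℤ
  four c1 = + 4
  four c2 = + 8

  -- 2 i + 4 c s + 4 d t for the code (c , d) of i and the last two seeds s and t.
  codedRelation : Fin 16 → Vec ℤ 16
  codedRelation i = (unit (+ 2) i ⊞ unit (four (proj₁ (Vec.lookup codes i))) (# 14)) ⊞
                    unit (four (proj₂ (Vec.lookup codes i))) (# 15)

  eqℤ : ℤ → ℤ → Bool
  eqℤ (+ m)    (+ n)    = m ℕ.≡ᵇ n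
  eqℤ -[1+ m ] -[1+ n ] = m ℕ.≡ᵇ n
  eqℤ _        _        = false

  eqℤ⇒≡ : ∀ a b → eqℤ a b ≡ true → a ≡ b
  eqℤ⇒≡ (+ m)    (+ n)    e = cong +_ (≡ᵇ-true m n e)
  eqℤ⇒≡ -[1+ m ] -[1+ n ] e = cong -[1+_] (≡ᵇ-true m n e)

  eqVec⇒≡ : ∀ {n} (u v : Vec ℤ n) → ForAll eqℤ u v ≡ true → u ≡ v
  eqVec⇒≡ []      []      _ = refl
  eqVec⇒≡ (a ∷ u) (b ∷ v) e =
    cong₂ _∷_ (eqℤ⇒≡ a b (proj₁ (∧-true (eqℤ a b) e))) (eqVec⇒≡ u v (proj₂ (∧-true (eqℤ a b) e)))

  spans : Vec (Vec ℤ 16) 28 → Vec ℕ 16 → (Fin 16 → Vec ℤ 16) → Bool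
  spans rs ms target = ForAll (λ m i → ForAll eqℤ (combine (coefficients m) rs) (target i)) ms (Vec.allFin 16)

  opaque
    -- Validity is transported to this name along `labels-run`, so the table itself is evaluated
    -- only in the checks that unfold it.
    labels : Labels
    labels = run steps onTree onSeeds

    labels-run : run steps onTree onSeeds ≡ labels
    labels-run = refl

  residues : Labels → Vec (Vec ℤ 16) 28
  residues t = Vec.map (residue t) triangles

  opaque
    unfolding flags run labels

    sixfold-ok : spans (residues labels) sixfold (unit (+ 6)) ≡ true
    sixfold-ok = refl

    coded-ok : spans (residues labels) coded codedRelation ≡ true
    coded-ok = refl

-- The target group and the cocycle with values in it.

eqPow : (C : Group 0ℓ 0ℓ) → (Group.Carrier C → Group.Carrier C → Bool) →
        ∀ n → Group.Carrier (C ^ᴳ n) → Group.Carrier (C ^ᴳ n) → Bool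
eqPow C eq zero    _        _        = true
eqPow C eq (suc n) (x , xs) (y , ys) = eq x y ∧ eqPow C eq n xs ys

eqPow⇒≈ : (C : Group 0ℓ 0ℓ) (eq : Group.Carrier C → Group.Carrier C → Bool) →
          (∀ x y → eq x y ≡ true → Group._≈_ C x y) →
          ∀ n x y → eqPow C eq n x y ≡ true → Group._≈_ (C ^ᴳ n) x y
eqPow⇒≈ C eq ok zero    x        y        _ = _
eqPow⇒≈ C eq ok (suc n) (x , xs) (y , ys) e =
  ok x y (proj₁ (∧-true (eq x y) e)) , eqPow⇒≈ C eq ok n xs ys (proj₂ (∧-true (eq x y) e))

Comm : ∀ {c ℓ} → Group c ℓ → Set (c ⊔ ℓ)
Comm G = ∀ x y → x ∙ y ≈ y ∙ x
  where open Group G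

Comm-^ : ∀ {C} → Comm C → ∀ n → Comm (C ^ᴳ n)
Comm-^     comm zero    x        y        = _
Comm-^ {C} comm (suc n) (x , xs) (y , ys) = comm x y , Comm-^ {C} comm n xs ys

C₂-comm : Comm C₂
C₂-comm = Boolₚ.xor-comm

C₃-comm : Comm C₃
C₃-comm c0 c0 = refl
C₃-comm c0 c1 = refl
C₃-comm c0 c2 = refl
C₃-comm c1 c0 = refl
C₃-comm c1 c1 = refl
C₃-comm c1 c2 = refl
C₃-comm c2 c0 = refl
C₃-comm c2 c1 = refl
C₃-comm c2 c2 = refl

𝔾 : Group 0ℓ 0ℓ
𝔾 = (C₂ ^ᴳ 16) ×ᴳ (C₃ ^ᴳ 2)

𝔾-abelian : AbelianGroup 0ℓ 0ℓ
𝔾-abelian = toAbelian 𝔾 λ (x , y) (x′ , y′) → Comm-^ {C₂} C₂-comm 16 x x′ , Comm-^ {C₃} C₃-comm 2 y y′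

eq₂ : Bool → Bool → Bool
eq₂ true  b = b
eq₂ false b = not b

eq₂⇒≡ : ∀ a b → eq₂ a b ≡ true → a ≡ b
eq₂⇒≡ true  true  _ = refl
eq₂⇒≡ false false _ = refl

eq₃ : Z3 → Z3 → Bool
eq₃ c0 c0 = true
eq₃ c1 c1 = true
eq₃ c2 c2 = true
eq₃ _  _  = false

eq₃⇒≡ : ∀ a b → eq₃ a b ≡ true → a ≡ b
eq₃⇒≡ c0 c0 _ = refl
eq₃⇒≡ c1 c1 _ = refl
eq₃⇒≡ c2 c2 _ = refl

module 𝔾 = Group 𝔾

eq𝔾 : 𝔾.Carrier → 𝔾.Carrier → Bool
eq𝔾 (x , y) (x′ , y′) = eqPow C₂ eq₂ 16 x x′ ∧ eqPow C₃ eq₃ 2 y y′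

eq𝔾⇒≈ : ∀ x y → eq𝔾 x y ≡ true → x 𝔾.≈ y
eq𝔾⇒≈ (x , y) (x′ , y′) e =
  eqPow⇒≈ C₂ eq₂ eq₂⇒≡ 16 x x′ (proj₁ (∧-true (eqPow C₂ eq₂ 16 x x′) e)) ,
  eqPow⇒≈ C₃ eq₃ eq₃⇒≡ 2 y y′ (proj₂ (∧-true (eqPow C₂ eq₂ 16 x x′) e))

bit : ∀ n → Fin n → Group.Carrier (C₂ ^ᴳ n)
bit (suc n) zero    = true , Group.ε (C₂ ^ᴳ n)
bit (suc n) (suc i) = false , bit n i

seedLabel : Fin 16 → 𝔾.Carrier
seedLabel i = bit 16 i , proj₁ (Vec.lookup codes i) , proj₂ (Vec.lookup codes i) , _

module Modular where
  open Propagate 𝔾.Carrier 𝔾._∙_ 𝔾._⁻¹ public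

  onTree : Fin 105 → Vertex × Vertex × 𝔾.Carrier
  onTree w = parent w , w , 𝔾.ε

  onSeeds : Fin 16 → Vertex × Vertex × 𝔾.Carrier
  onSeeds i = seed₁ i , seed₂ i , seedLabel i

  is𝔾 : Maybe 𝔾.Carrier → 𝔾.Carrier → Bool
  is𝔾 nothing  v = false
  is𝔾 (just u) v = eq𝔾 u v

  triangleOK : Maybe 𝔾.Carrier → Maybe 𝔾.Carrier → Maybe 𝔾.Carrier → Bool
  triangleOK (just u) (just w) (just v) = eq𝔾 w (u 𝔾.∙ v)
  -- Pairs that are not arcs have no label; for arcs this case is excluded by `labels-cover`.
  triangleOK _        _        _        = true

  coverOK : Flag → Flag → Maybe 𝔾.Carrier → Bool
  coverOK f g l = not (f ~ᶠ g) ∨ is-just l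

  treeOK : Labels → Vertex → Bool
  treeOK t w = (parent w == w) ∨ ((parent w ~ᴹ w) ∧ is𝔾 (get t (parent w) w) 𝔾.ε)

  seedOK : Labels → Fin 16 → Bool
  seedOK t i = (seed₁ i ~ᴹ seed₂ i) ∧ is𝔾 (get t (seed₁ i) (seed₂ i)) (seedLabel i)

  -- In `trianglesOK` the rows of x and y are traversed in parallel, which runs over all z without
  -- looking up any entry.
  coversOK trianglesOK treesOK seedsOK : Labels → Bool
  coversOK t    = ForAll (λ f row → ForAll (coverOK f) flags row) flags t
  trianglesOK t = ForAll (λ _ rx → ForAll (λ uxy ry → ForAll (triangleOK uxy) rx ry) rx t) t t
  treesOK t     = every (treeOK t) (Vec.allFin 105)
  seedsOK t     = every (seedOK t) (Vec.allFin 16)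

  opaque
    labels : Labels
    labels = run steps onTree onSeeds

    labels-run : run steps onTree onSeeds ≡ labels
    labels-run = refl

  opaque
    unfolding flags run labels

    labels-cover : coversOK labels ≡ true
    labels-cover = refl

    labels-triangles : trianglesOK labels ≡ true
    labels-triangles = refl

    labels-tree : treesOK labels ≡ true
    labels-tree = refl

    labels-seeds : seedsOK labels ≡ true
    labels-seeds = refl

    parent-parent-check : every (λ w → parent (parent w) == zero) (Vec.allFin 105) ≡ true
    parent-parent-check = refl

module Cocycle where
  open Modular

  h : Vertex → Vertex → 𝔾.Carrier
  h x y = fromMaybe 𝔾.ε (get labels x y)

  covered : ∀ x y → (x ~ᴹ y) ≡ true → ∃ λ v → get labels x y ≡ just v
  covered x y xy = is-just-true (get labels x y) (or (ForAll-true (coverOK (vtx x)) flags (Vec.lookup labels x)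
    (ForAll-true (λ f row → ForAll (coverOK f) flags row) flags labels labels-cover x) y))
    where
    or : ∀ {b} → not (x ~ᴹ y) ∨ b ≡ true → b ≡ true
    or e rewrite xy = e

  h-tri : ∀ x y z → (x ~ᴹ y) ≡ true → (y ~ᴹ z) ≡ true → (x ~ᴹ z) ≡ true → h x z 𝔾.≈ h x y 𝔾.∙ h y z
  h-tri x y z xy yz xz with get labels x y in p | get labels x z in q | get labels y z in r | ok
    where
    ok : triangleOK (get labels x y) (get labels x z) (get labels y z) ≡ true
    ok = ForAll-true (triangleOK (get labels x y)) (Vec.lookup labels x) (Vec.lookup labels y)
      (ForAll-true (λ uxy ry → ForAll (triangleOK uxy) (Vec.lookup labels x) ry) (Vec.lookup labels x) labels
        (ForAll-true (λ _ rx → ForAll (λ uxy ry → ForAll (triangleOK uxy) rx ry) rx labels) labels labels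
          labels-triangles x) y) z
  ... | just u  | just w  | just v  | e = eq𝔾⇒≈ w (u 𝔾.∙ v) e
  ... | nothing | _       | _       | _ = contradiction (trans (sym p) (proj₂ (covered x y xy))) λ ()
  ... | just _  | nothing | _       | _ = contradiction (trans (sym q) (proj₂ (covered x z xz))) λ ()
  ... | just _  | just _  | nothing | _ = contradiction (trans (sym r) (proj₂ (covered y z yz))) λ ()

  is𝔾⇒≈ : ∀ l v → is𝔾 l v ≡ true → fromMaybe 𝔾.ε l 𝔾.≈ v
  is𝔾⇒≈ (just u) v e = eq𝔾⇒≈ u v e

  every-allFin : ∀ {n} (p : Fin n → Bool) → every p (Vec.allFin n) ≡ true → ∀ i → p i ≡ true
  every-allFin {n} p e i = subst (λ j → p j ≡ true) (Vecₚ.lookup-allFin i) (every-true p (Vec.allFin n) e i)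

  parent-parent : ∀ w → parent (parent w) ≡ zero
  parent-parent w = ==⇒≡ (every-allFin (λ w → parent (parent w) == zero) parent-parent-check w)

  tree-arc : ∀ w → parent w ≡ w ⊎ ((parent w ~ᴹ w) ≡ true × h (parent w) w 𝔾.≈ 𝔾.ε)
  tree-arc w with ∨-true (parent w == w) (every-allFin (treeOK labels) labels-tree w)
  ... | inj₁ e = inj₁ (==⇒≡ e)
  ... | inj₂ e = let e₁ , e₂ = ∧-true (parent w ~ᴹ w) e in
    inj₂ (e₁ , is𝔾⇒≈ (get labels (parent w) w) 𝔾.ε e₂)

  seed-arc : ∀ i → (seed₁ i ~ᴹ seed₂ i) ≡ true × h (seed₁ i) (seed₂ i) 𝔾.≈ seedLabel i
  seed-arc i = let e₁ , e₂ = ∧-true (seed₁ i ~ᴹ seed₂ i) (every-allFin (seedOK labels) labels-seeds i) in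
    e₁ , is𝔾⇒≈ (get labels (seed₁ i) (seed₂ i)) (seedLabel i) e₂

-- Homomorphisms from and into powers of cyclic groups.

module _ {c ℓ} (K : AbelianGroup c ℓ) where
  private
    module K = Combination K
    𝕂 = AbelianGroup.group K

  fromC₂ : ∀ u → u K.∙ u K.≈ K.ε → Hom C₂ 𝕂
  fromC₂ u u² = record { fun = fun ; pres = λ { refl → K.≈-refl } ; homo = homo }
    where
    fun : Bool → K.Carrier
    fun true  = u
    fun false = K.ε
    homo : ∀ x y → fun (x xor y) K.≈ fun x K.∙ fun y
    homo true  true  = K.≈-sym u²
    homo true  false = K.≈-sym (K.identityʳ u)
    homo false y     = K.≈-sym (K.identityˡ (fun y))

  fromC₃ : ∀ t → t K.∙ (t K.∙ t) K.≈ K.ε → Hom C₃ 𝕂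
  fromC₃ t t³ = record { fun = fun ; pres = λ { refl → K.≈-refl } ; homo = homo }
    where
    fun : Z3 → K.Carrier
    fun c0 = K.ε
    fun c1 = t
    fun c2 = t K.∙ t
    homo : ∀ x y → fun (x +3 y) K.≈ fun x K.∙ fun y
    homo c0 y  = K.≈-sym (K.identityˡ (fun y))
    homo c1 c0 = K.≈-sym (K.identityʳ t)
    homo c1 c1 = K.≈-refl
    homo c1 c2 = K.≈-sym t³
    homo c2 c0 = K.≈-sym (K.identityʳ (t K.∙ t))
    homo c2 c1 = K.≈-sym (K.≈-trans (K.assoc t t t) t³)
    homo c2 c2 = K.≈-sym (K.≈-trans (K.assoc t t (t K.∙ t)) (K.≈-trans (K.∙-congˡ t³) (K.identityʳ t)))

  pair : ∀ {a ℓa b ℓb} {A : Group a ℓa} {B : Group b ℓb} → Hom A 𝕂 → Hom B 𝕂 → Hom (DirectProduct.group A B) 𝕂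
  pair f g = record
    { fun  = λ (x , y) → F.fun x K.∙ G.fun y
    ; pres = λ (p , q) → K.∙-cong (F.pres p) (G.pres q)
    ; homo = λ (x , y) (x′ , y′) → K.≈-trans (K.∙-cong (F.homo x x′) (G.homo y y′)) (K.interchange _ _ _ _)
    }
    where
    module F = Hom f
    module G = Hom g

  power : ∀ {C n} → (Fin n → Hom C 𝕂) → Hom (C ^ᴳ n) 𝕂
  power {n = zero}  η = record { fun = λ _ → K.ε ; pres = λ _ → K.≈-refl ; homo = λ _ _ → K.≈-sym (K.identityˡ K.ε) }
  power {n = suc n} η = pair (η zero) (power (η ∘ suc))

  power-cong : ∀ {C} n {η η′ : Fin n → Hom C 𝕂} → (∀ i x → Hom.fun (η i) x K.≈ Hom.fun (η′ i) x) →
               ∀ xs → Hom.fun (power η) xs K.≈ Hom.fun (power η′) xs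
  power-cong zero    e _        = K.≈-refl
  power-cong (suc n) e (x , xs) = K.∙-cong (e zero x) (power-cong n (e ∘ suc) xs)

_∘ᴴ_ : ∀ {a ℓa b ℓb c ℓc} {A : Group a ℓa} {B : Group b ℓb} {C : Group c ℓc} → Hom B C → Hom A B → Hom A C
_∘ᴴ_ {C = C} g f = record
  { fun  = Hom.fun g ∘ Hom.fun f
  ; pres = Hom.pres g ∘ Hom.pres f
  ; homo = λ x y → Group.trans C (Hom.pres g (Hom.homo f x y)) (Hom.homo g _ _)
  }

module _ (A B : Group 0ℓ 0ℓ) where
  private
    module A = Group A
    module B = Group B

  inl : Hom A (DirectProduct.group A B)
  inl = record { fun = λ x → x , B.ε ; pres = λ p → p , B.refl ; homo = λ _ _ → A.refl , B.sym (B.identityˡ B.ε) }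

  inr : Hom B (DirectProduct.group A B)
  inr = record { fun = λ y → A.ε , y ; pres = λ p → A.refl , p ; homo = λ _ _ → A.sym (A.identityˡ A.ε) , B.refl }

insert : ∀ C n → Fin n → Hom C (C ^ᴳ n)
insert C (suc n) zero    = inl C (C ^ᴳ n)
insert C (suc n) (suc i) = inr C (C ^ᴳ n) ∘ᴴ insert C n i

module _ {c ℓ} (K : AbelianGroup c ℓ) where
  private
    module K = Combination K
    𝕂 = AbelianGroup.group K

  power-insert : ∀ {C} n (f : Hom (C ^ᴳ n) 𝕂) xs → Hom.fun (power K (λ i → f ∘ᴴ insert C n i)) xs K.≈ Hom.fun f xs
  power-insert     zero    f _        = K.≈-sym (Hom.homo-ε f)
  power-insert {C} (suc n) f (x , xs) =
    K.≈-trans (K.∙-congˡ (K.≈-trans (power-cong K n (λ i y → K.≈-refl) xs) (power-insert n (f ∘ᴴ inr C (C ^ᴳ n)) xs)))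
    (K.≈-trans (K.≈-sym (Hom.homo f (x , Cⁿ.ε) (C.ε , xs)))
               (Hom.pres f (C.identityʳ x , Cⁿ.identityˡ xs)))
    where
    module C  = Group C
    module Cⁿ = Group (C ^ᴳ n)

  power-bit : ∀ n (η : Fin n → Hom C₂ 𝕂) i → Hom.fun (power K η) (bit n i) K.≈ Hom.fun (η i) true
  power-bit (suc n) η zero    = K.≈-trans (K.∙-congˡ (Hom.homo-ε (power K (η ∘ suc)))) (K.identityʳ _)
  power-bit (suc n) η (suc i) = K.≈-trans (K.∙-cong (Hom.homo-ε (η zero)) (power-bit n (η ∘ suc) i)) (K.identityˡ _)

module _ {c ℓ c′ ℓ′} (K : AbelianGroup c ℓ) (M : AbelianGroup c′ ℓ′)
         (f : Hom (AbelianGroup.group K) (AbelianGroup.group M)) where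
  private
    module M = Combination M

  fun-power : ∀ {C} n (η : Fin n → Hom C (AbelianGroup.group K)) xs →
              Hom.fun f (Hom.fun (power K η) xs) M.≈ Hom.fun (power M (λ i → f ∘ᴴ η i)) xs
  fun-power zero    η _        = Hom.homo-ε f
  fun-power (suc n) η (x , xs) = M.≈-trans (Hom.homo f _ _) (M.∙-congˡ (fun-power n (η ∘ suc) xs))

module _ {c ℓ} (M : AbelianGroup c ℓ) where
  private
    module M = Combination M
    𝕄 = AbelianGroup.group M

  C₂-ext : ∀ (f f′ : Hom C₂ 𝕄) → Hom.fun f true M.≈ Hom.fun f′ true → ∀ x → Hom.fun f x M.≈ Hom.fun f′ x
  C₂-ext f f′ e true  = e
  C₂-ext f f′ e false = M.≈-trans (Hom.homo-ε f) (M.≈-sym (Hom.homo-ε f′))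

  C₃-ext : ∀ (f f′ : Hom C₃ 𝕄) → Hom.fun f c1 M.≈ Hom.fun f′ c1 → ∀ x → Hom.fun f x M.≈ Hom.fun f′ x
  C₃-ext f f′ e c0 = M.≈-trans (Hom.homo-ε f) (M.≈-sym (Hom.homo-ε f′))
  C₃-ext f f′ e c1 = e
  C₃-ext f f′ e c2 = M.≈-trans (Hom.homo f c1 c1) (M.≈-trans (M.∙-cong e e) (M.≈-sym (Hom.homo f′ c1 c1)))

module _ {c ℓ c′ ℓ′} (K : AbelianGroup c ℓ) (M : AbelianGroup c′ ℓ′)
         (f : Hom (AbelianGroup.group K) (AbelianGroup.group M)) where
  private
    module M = Combination M

  fun-power-insert : ∀ {C} n (η : Fin n → Hom C (AbelianGroup.group K)) (g : Hom (C ^ᴳ n) (AbelianGroup.group M)) →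
    (∀ i x → Hom.fun f (Hom.fun (η i) x) M.≈ Hom.fun g (Hom.fun (insert C n i) x)) →
    ∀ xs → Hom.fun f (Hom.fun (power K η) xs) M.≈ Hom.fun g xs
  fun-power-insert {C} n η g e xs = M.≈-trans (fun-power K M f n η xs)
    (M.≈-trans (power-cong M n e xs) (power-insert M n g xs))

-- The result of the classification, and gauge transformations.

record Coordinates {n} (Γ : SimpleGraph n) : Set where
  open SimpleGraph Γ
  field
    ψ      : Vertex → Fin n
    ψ-inj  : Injective _≡_ _≡_ ψ
    ψ-onto : ∀ z → ∃ λ x → ψ x ≡ z
    ψ-adj  : ∀ x y → (x ~ᴹ y) ≡ adj (ψ x) (ψ y)
    common-neighbour : ∀ v w → adj v w ≡ true → ∃ λ u → adj v u ≡ true × adj w u ≡ true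

opaque
  coordinates : ∀ {n} (Γ : SimpleGraph n) → n ≡ 105 → IsSRG Γ 32 4 12 → Fin n → Coordinates Γ
  coordinates Γ n≡105 srg o = record
    { ψ = ψ ; ψ-inj = ψ-inj ; ψ-onto = ψ-onto ; ψ-adj = ψ-adj
    ; common-neighbour = λ v w vw →
        let u , ne = ∑≢0⇒∃ {f = N v w} (λ e → contradiction (trans (sym (∑N-~ (cong χ vw))) e) λ ())
            vu , wu = N≡1⇒~ {v} {w} {u} (bit-≢0 (N-bit v w u) ne)
        in u , χ-inj _ true vu , χ-inj _ true wu
    }
    where open Uniqueness Γ n≡105 srg o

module AbelianSolver {c ℓ} (K : AbelianGroup c ℓ) where
  open Combination K

  infixl 7 _∙ᵉ_
  infix  8 _⁻ᵉ

  data Expr (n : ℕ) : Set where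
    var   : Fin n → Expr n
    εᵉ    : Expr n
    _∙ᵉ_  : Expr n → Expr n → Expr n
    _⁻ᵉ  : Expr n → Expr n

  eval : ∀ {n} → Expr n → (Fin n → Carrier) → Carrier
  eval (var i)    s = s i
  eval εᵉ       s = ε
  eval (d ∙ᵉ e) s = eval d s ∙ eval e s
  eval (e ⁻ᵉ)  s = eval e s ⁻¹

  norm : ∀ {n} → Expr n → Vec ℤ n
  norm (var i)    = unit 1ℤ i
  norm εᵉ       = 𝟘
  norm (d ∙ᵉ e) = norm d ⊞ norm e
  norm (e ⁻ᵉ)  = ⊟ norm e

  correct : ∀ {n} (e : Expr n) s → eval e s ≈ ⟦ norm e ⟧ s
  correct (var i)    s = ≈-sym (≈-trans (⟦⟧-unit K 1ℤ i s) (identityʳ (s i)))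
  correct εᵉ       s = ≈-sym (⟦⟧-𝟘 K s)
  correct (d ∙ᵉ e) s = ≈-trans (∙-cong (correct d s) (correct e s)) (≈-sym (⟦⟧-⊞ K (norm d) (norm e) s))
  correct (e ⁻ᵉ)  s = ≈-trans (⁻¹-cong (correct e s)) (≈-sym (⟦⟧-⊟ K (norm e) s))

  solve : ∀ {n} (d e : Expr n) → norm d ≡ norm e → (as : Vec Carrier n) →
          eval d (Vec.lookup as) ≈ eval e (Vec.lookup as)
  solve d e eq as = ≈-trans (correct d (Vec.lookup as))
    (≈-trans (≈-reflexive (cong (λ v → ⟦ v ⟧ (Vec.lookup as)) eq)) (≈-sym (correct e (Vec.lookup as))))
    where
    ≈-reflexive : ∀ {x y} → x ≡ y → x ≈ y
    ≈-reflexive refl = ≈-refl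

module Gauge {c ℓ} (K : AbelianGroup c ℓ) where
  open Combination K
  open AbelianSolver K

  -- A cochain is changed by a coboundary: a is its value on an arc, p and q are the potentials at
  -- the two ends.
  gauge : Carrier → Carrier → Carrier → Carrier
  gauge p a q = (p ∙ a) ∙ q ⁻¹

  gauge-tri : ∀ p q r {a b d} → d ≈ a ∙ b → gauge p d r ≈ gauge p a q ∙ gauge q b r
  gauge-tri p q r {a} {b} e = ≈-trans (∙-congʳ (∙-congˡ e))
    (solve ((var 0F ∙ᵉ (var 3F ∙ᵉ var 4F)) ∙ᵉ var 2F ⁻ᵉ)
           (((var 0F ∙ᵉ var 3F) ∙ᵉ var 1F ⁻ᵉ) ∙ᵉ ((var 1F ∙ᵉ var 4F) ∙ᵉ var 2F ⁻ᵉ)) refl (p ∷ q ∷ r ∷ a ∷ b ∷ []))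

  gauge-anti : ∀ p q {a b} → b ≈ a ⁻¹ → gauge q b p ≈ gauge p a q ⁻¹
  gauge-anti p q {a} e = ≈-trans (∙-congʳ (∙-congˡ e))
    (solve ((var 1F ∙ᵉ var 2F ⁻ᵉ) ∙ᵉ var 0F ⁻ᵉ) (((var 0F ∙ᵉ var 2F) ∙ᵉ var 1F ⁻ᵉ) ⁻ᵉ) refl (p ∷ q ∷ a ∷ []))

  -- The two triangle equations over an edge, read in both directions with the same third vertex,
  -- already force antisymmetry.
  tri⇒anti : ∀ {a b u v} → u ≈ a ∙ v → v ≈ b ∙ u → b ≈ a ⁻¹
  tri⇒anti {a} {b} {u} {v} e₁ e₂ = ≈-trans
    (solve (var 1F) ((var 1F ∙ᵉ var 2F) ∙ᵉ var 2F ⁻ᵉ) refl (a ∷ b ∷ u ∷ v ∷ []))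
    (≈-trans (∙-cong (≈-sym e₂) (⁻¹-cong e₁))
             (solve (var 3F ∙ᵉ (var 0F ∙ᵉ var 3F) ⁻ᵉ) (var 0F ⁻ᵉ) refl (a ∷ b ∷ u ∷ v ∷ [])))

  closed⇒tri : ∀ {a b u v} → a ∙ (b ∙ v) ≈ ε → v ≈ u ⁻¹ → u ≈ a ∙ b
  closed⇒tri {a} {b} {u} {v} e₁ e₂ = ≈-trans (≈-sym (identityˡ u))
    (≈-trans (∙-cong (≈-sym e₁) ≈-refl)
    (≈-trans (∙-congʳ (∙-congˡ (∙-congˡ e₂)))
             (solve ((var 0F ∙ᵉ (var 1F ∙ᵉ var 2F ⁻ᵉ)) ∙ᵉ var 2F) (var 0F ∙ᵉ var 1F) refl (a ∷ b ∷ u ∷ []))))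

  ∙≈ε⇒⁻¹ : ∀ {a b} → a ∙ b ≈ ε → b ≈ a ⁻¹
  ∙≈ε⇒⁻¹ {a} {b} e = GroupProps.inverseʳ-unique group a b e

  gauge-onTree : ∀ {p a q} → q ≈ p ∙ a → gauge p a q ≈ ε
  gauge-onTree {p} {a} e = ≈-trans (∙-congˡ (⁻¹-cong e)) (inverseʳ (p ∙ a))

  gauge-cong : ∀ {p p′ a a′ q q′} → p ≈ p′ → a ≈ a′ → q ≈ q′ → gauge p a q ≈ gauge p′ a′ q′
  gauge-cong e₁ e₂ e₃ = ∙-cong (∙-cong e₁ e₂) (⁻¹-cong e₃)

  regauge : ∀ r p q {a u v w} → u ≈ r ∙ p ⁻¹ → v ≈ gauge p a q → w ≈ r ∙ q ⁻¹ → gauge u v w ≈ a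
  regauge r p q {a} e₁ e₂ e₃ = ≈-trans (gauge-cong e₁ e₂ e₃)
    (solve (((var 0F ∙ᵉ var 1F ⁻ᵉ) ∙ᵉ ((var 1F ∙ᵉ var 3F) ∙ᵉ var 2F ⁻ᵉ)) ∙ᵉ (var 0F ∙ᵉ var 2F ⁻ᵉ) ⁻ᵉ)
           (var 3F) refl (r ∷ p ∷ q ∷ a ∷ []))

  telescope : ∀ r p q {u v} → u ≈ r ∙ p ⁻¹ → v ≈ p ∙ q ⁻¹ → u ∙ v ≈ r ∙ q ⁻¹
  telescope r p q e₁ e₂ = ≈-trans (∙-cong e₁ e₂)
    (solve ((var 0F ∙ᵉ var 1F ⁻ᵉ) ∙ᵉ (var 1F ∙ᵉ var 2F ⁻ᵉ)) (var 0F ∙ᵉ var 2F ⁻ᵉ) refl (r ∷ p ∷ q ∷ []))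

  gauge-ε : ∀ p q {a} → a ≈ ε → gauge p a q ≈ p ∙ q ⁻¹
  gauge-ε p q e = ∙-congʳ (≈-trans (∙-congˡ e) (identityʳ p))

  -- Two successive gauge changes cancel exactly when the product of their potentials agrees at both
  -- ends.
  gauge-compose : ∀ p p′ q q′ {a k} → k ≈ gauge p a q → p′ ∙ p ≈ q′ ∙ q → gauge p′ k q′ ≈ a
  gauge-compose p p′ q q′ {a} {k} e₁ e₂ = ≈-trans (gauge-cong ≈-refl e₁ ≈-refl)
    (≈-trans (solve ((var 1F ∙ᵉ ((var 0F ∙ᵉ var 4F) ∙ᵉ var 2F ⁻ᵉ)) ∙ᵉ var 3F ⁻ᵉ)
                    (var 4F ∙ᵉ ((var 1F ∙ᵉ var 0F) ∙ᵉ (var 3F ∙ᵉ var 2F) ⁻ᵉ)) refl (p ∷ p′ ∷ q ∷ q′ ∷ a ∷ []))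
    (≈-trans (∙-congˡ (∙-congʳ e₂))
             (solve (var 2F ∙ᵉ ((var 1F ∙ᵉ var 0F) ∙ᵉ (var 1F ∙ᵉ var 0F) ⁻ᵉ)) (var 2F) refl (q ∷ q′ ∷ a ∷ []))))

  gauge-step : ∀ p q q′ {p′ k a} → p′ ≈ q′ ∙ k ⁻¹ → k ≈ gauge p a q → a ≈ ε → p′ ∙ p ≈ q′ ∙ q
  gauge-step p q q′ e₁ e₂ e₃ = ≈-trans (∙-congʳ (≈-trans e₁ (∙-congˡ (⁻¹-cong (≈-trans e₂ (gauge-ε p q e₃))))))
    (solve ((var 2F ∙ᵉ (var 0F ∙ᵉ var 1F ⁻ᵉ) ⁻ᵉ) ∙ᵉ var 0F) (var 2F ∙ᵉ var 1F) refl (p ∷ q ∷ q′ ∷ []))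

module _ {a ℓa b ℓb} {A : Group a ℓa} {B : Group b ℓb} where
  private
    module A = Group A
    module B = Group B

  inverse⇒≅ : (f : Hom A B) (g : Hom B A) → (∀ x → Hom.fun g (Hom.fun f x) A.≈ x) →
              (∀ y → Hom.fun f (Hom.fun g y) B.≈ y) → A ≅ B
  inverse⇒≅ f g gf fg = Hom.fun f , record
    { isGroupMonomorphism = record
      { isGroupHomomorphism = record
        { isMonoidHomomorphism = record
          { isMagmaHomomorphism = record
            { isRelHomomorphism = record { cong = Hom.pres f }
            ; homo = Hom.homo f }
          ; ε-homo = Hom.homo-ε f }
        ; ⁻¹-homo = Hom.homo-⁻¹ f }
      ; injective = λ {x} {y} e → A.trans (A.sym (gf x)) (A.trans (Hom.pres g e) (gf y)) }
    ; surjective = λ y → Hom.fun g y , λ e → B.trans (Hom.pres f e) (fg y)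
    }

module _ {c ℓ} (G : Group c ℓ) where
  open Abelianisation G
  private module G = Group G

  abelianisation-comm : Comm abelianisation
  abelianisation-comm a b = resp eq (comm (a G.⁻¹) (b G.⁻¹))
    where
    open GroupProps G
    eq : ((a G.⁻¹ G.⁻¹ G.∙ b G.⁻¹ G.⁻¹) G.∙ a G.⁻¹) G.∙ b G.⁻¹ G.≈ (a G.∙ b) G.∙ (b G.∙ a) G.⁻¹
    eq = G.trans (G.assoc _ _ _) (G.∙-cong (G.∙-cong (⁻¹-involutive a) (⁻¹-involutive b))
                                           (G.sym (⁻¹-anti-homo-∙ b a)))

  module _ {c′ ℓ′} (K : AbelianGroup c′ ℓ′) (f : Hom G (AbelianGroup.group K)) where
    private module K = Combination K
    open Hom f
    open AbelianSolver K

    kills : ∀ {a} → InComm a → fun a K.≈ K.ε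
    kills (comm x y) = K.≈-trans (homo _ _) (K.≈-trans (K.∙-congʳ (homo _ _))
      (K.≈-trans (K.∙-congʳ (K.∙-congʳ (K.≈-trans (homo _ _) (K.∙-cong (homo-⁻¹ x) (homo-⁻¹ y)))))
        (solve (((var 0F ⁻ᵉ ∙ᵉ var 1F ⁻ᵉ) ∙ᵉ var 0F) ∙ᵉ var 1F) εᵉ refl (fun x ∷ fun y ∷ []))))
    kills unit       = homo-ε
    kills (mul p q)  = K.≈-trans (homo _ _) (K.≈-trans (K.∙-cong (kills p) (kills q)) (K.identityˡ K.ε))
    kills (inv p)    = K.≈-trans (homo-⁻¹ _) (K.≈-trans (K.⁻¹-cong (kills p)) K.ε⁻¹≈ε)
    kills (resp e p) = K.≈-trans (K.≈-sym (pres e)) (kills p)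

    factor : Hom abelianisation (AbelianGroup.group K)
    factor = record
      { fun  = fun
      ; pres = λ {x} {y} p → K.x∙y⁻¹≈ε⇒x≈y (fun x) (fun y)
          (K.≈-trans (K.∙-congˡ (K.≈-sym (homo-⁻¹ y))) (K.≈-trans (K.≈-sym (homo x (y G.⁻¹))) (kills p)))
      ; homo = homo
      }

-- Arcs of the given graph in the abelianised fundamental group.

module Arcs (Γ : SimpleGraph 105) (C : Coordinates Γ) (Tr : SpanningTree Γ) where
  open SimpleGraph Γ public
  open Coordinates C public
  open SpanningTree Tr public using (root; depth; parentAdj; depthDec) renaming (parent to parentᵀ)
  open FundamentalGroup Γ Tr public using (Arc; g; Relator; tree↑; tree↓; edge; tri; π₁)
  open Presentation Arc Relator public
    using (Word; Letter; _≈_; ≈-refl; ≈-sym; ≈-trans; ≈-cong; cancel; relator)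

  private
    module π = Abelianisation π₁

  Hᴬ : AbelianGroup 0ℓ 0ℓ
  Hᴬ = toAbelian (π₁-ab Γ Tr) (abelianisation-comm π₁)

  module H = Combination Hᴬ
  open Gauge Hᴬ
  open Cocycle using (parent-parent)

  V : Set
  V = Fin 105

  adj-comm : ∀ {v w} → adj v w ≡ true → adj w v ≡ true
  adj-comm {v} {w} e = trans (adj-sym w v) e

  adj⇒Adj : ∀ {v w} → adj v w ≡ true → Adj v w
  adj⇒Adj e = subst Bool.T (sym e) _

  inv : V → Vertex
  inv v = proj₁ (ψ-onto v)

  ψ-inv : ∀ v → ψ (inv v) ≡ v
  ψ-inv v = proj₂ (ψ-onto v)

  inv-ψ : ∀ x → inv (ψ x) ≡ x
  inv-ψ x = ψ-inj (ψ-inv (ψ x))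

  inv-adj : ∀ {v w} → adj v w ≡ true → (inv v ~ᴹ inv w) ≡ true
  inv-adj {v} {w} e = trans (ψ-adj (inv v) (inv w)) (trans (cong₂ adj (ψ-inv v) (ψ-inv w)) e)

  ψ-adj′ : ∀ {x y} → (x ~ᴹ y) ≡ true → adj (ψ x) (ψ y) ≡ true
  ψ-adj′ {x} {y} e = trans (sym (ψ-adj x y)) e

  ~ᴹ-sym : ∀ x y → (x ~ᴹ y) ≡ true → (y ~ᴹ x) ≡ true
  ~ᴹ-sym x y e = trans (ψ-adj y x) (adj-comm (ψ-adj′ e))

  tree-induction : ∀ {ℓ} (Q : V → Set ℓ) → Q root → (∀ v → v ≢ root → Q (parentᵀ v) → Q v) → ∀ v → Q v
  tree-induction Q base step v = go (suc (depth v)) v ℕₚ.≤-refl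
    where
    go : ∀ k v → depth v ℕ.< k → Q v
    go (suc k) v (s≤s d≤k) with v ≟ root
    ... | yes refl = base
    ... | no ne    = step v ne (go k (parentᵀ v) (ℕₚ.≤-trans (depthDec v ne) d≤k))

  -- A total function on pairs of vertices, trivial off the edges and in particular on loops; this
  -- is what lets `q` treat vertices of depth 0, 1 and 2 uniformly.
  arcIf : ∀ v w b → adj v w ≡ b → Word
  arcIf v w true  e = g v w (adj⇒Adj e)
  arcIf v w false _ = []

  arc : V → V → Word
  arc v w = arcIf v w (adj v w) refl

  arc-true : ∀ v w (a : Adj v w) → arc v w ≡ g v w a
  arc-true v w a = go (adj v w) refl
    where
    go : ∀ b e → arcIf v w b e ≡ g v w a
    go true  e = cong (g v w) (Boolₚ.T-irrelevant (adj⇒Adj e) a)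
    go false e = ⊥-elim (subst Bool.T e a)

  arc-false : ∀ v w → adj v w ≡ false → arc v w ≡ []
  arc-false v w e = go (adj v w) refl
    where
    go : ∀ b e′ → arcIf v w b e′ ≡ []
    go false _  = refl
    go true  e′ = contradiction (trans (sym e′) e) λ ()

  arc-edge : ∀ {v w} → adj v w ≡ true → (arc v w H.∙ arc w v) H.≈ H.ε
  arc-edge {v} {w} e = subst (H._≈ H.ε) (sym (cong₂ List._++_ (arc-true v w a) (arc-true w v b)))
    (π.≈⇒∼ (relator (edge v w a b)))
    where
    a : Adj v w
    a = adj⇒Adj e
    b : Adj w v
    b = adj⇒Adj (adj-comm e)

  arc-closed : ∀ {u v w} → adj u v ≡ true → adj v w ≡ true → adj w u ≡ true →
               (arc u v H.∙ (arc v w H.∙ arc w u)) H.≈ H.ε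
  arc-closed {u} {v} {w} uv vw wu = subst (H._≈ H.ε)
    (sym (cong₂ List._++_ (arc-true u v a) (cong₂ List._++_ (arc-true v w b) (arc-true w u c))))
    (π.≈⇒∼ (relator (tri u v w a b c)))
    where
    a : Adj u v
    a = adj⇒Adj uv
    b : Adj v w
    b = adj⇒Adj vw
    c : Adj w u
    c = adj⇒Adj wu

  arc-anti : ∀ {v w} → adj v w ≡ true → arc w v H.≈ arc v w H.⁻¹
  arc-anti {v} {w} e = ∙≈ε⇒⁻¹ {arc v w} {arc w v} (arc-edge e)

  arc-tri : ∀ {u v w} → adj u v ≡ true → adj v w ≡ true → adj u w ≡ true → arc u w H.≈ arc u v H.∙ arc v w
  arc-tri {u} {v} {w} uv vw uw = closed⇒tri {arc u v} {arc v w} {arc u w} {arc w u}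
    (arc-closed uv vw (adj-comm uw)) (arc-anti uw)

  arc-tree : ∀ v → v ≢ root → arc v (parentᵀ v) H.≈ H.ε
  arc-tree v ne = subst (H._≈ H.ε) (sym (arc-true v (parentᵀ v) (parentAdj v ne))) (π.≈⇒∼ (relator (tree↑ v ne)))

  e : Vertex → Vertex → Word
  e x y = arc (ψ x) (ψ y)

  e-loop : ∀ x → e x x ≡ []
  e-loop x = arc-false (ψ x) (ψ x) (irrefl (ψ x))

  -- The path from 0 to w in the tree of the model. That tree has depth 2, and the steps missing for
  -- shorter paths are trivial loops.
  q : Vertex → Word
  q w = e zero (parent w) H.∙ e (parent w) w

  -- The arcs of the model, normalised to vanish on its own spanning tree.
  e′ : Vertex → Vertex → Word
  e′ x y = gauge (q x) (e x y) (q y)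

  e′-anti : ∀ x y → (x ~ᴹ y) ≡ true → e′ y x H.≈ e′ x y H.⁻¹
  e′-anti x y xy = gauge-anti (q x) (q y) {e x y} {e y x} (arc-anti (ψ-adj′ xy))

  e′-tri : ∀ x y z → (x ~ᴹ y) ≡ true → (y ~ᴹ z) ≡ true → (x ~ᴹ z) ≡ true → e′ x z H.≈ e′ x y H.∙ e′ y z
  e′-tri x y z xy yz xz = gauge-tri (q x) (q y) (q z) {e x y} {e y z} {e x z} (arc-tri (ψ-adj′ xy) (ψ-adj′ yz) (ψ-adj′ xz))

  e′-tree : ∀ w → e′ (parent w) w H.≈ H.ε
  e′-tree w = gauge-onTree {q (parent w)} {e (parent w) w} {q w}
    (subst (λ u → q w H.≈ u H.∙ e (parent w) w) (sym q-parent) (H.≈-refl {q w}))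
    where
    q-parent : q (parent w) ≡ e zero (parent w)
    q-parent = trans (cong (λ u → e zero u List.++ e u (parent w)) (parent-parent w))
                     (cong (List._++ e zero (parent w)) (e-loop zero))

-- The universal cocycle and the isomorphism.

module 𝔾C = Combination 𝔾-abelian

inl𝔾 : Hom (C₂ ^ᴳ 16) 𝔾
inl𝔾 = inl (C₂ ^ᴳ 16) (C₃ ^ᴳ 2)

inr𝔾 : Hom (C₃ ^ᴳ 2) 𝔾
inr𝔾 = inr (C₂ ^ᴳ 16) (C₃ ^ᴳ 2)

seedOf : Fin 2 → Fin 16
seedOf zero       = # 14
seedOf (suc zero) = # 15

eq𝔾-every : ∀ {n} (a b : Fin n → 𝔾.Carrier) → every (λ i → eq𝔾 (a i) (b i)) (Vec.allFin n) ≡ true →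
            ∀ i → a i 𝔾.≈ b i
eq𝔾-every a b e i = eq𝔾⇒≈ (a i) (b i) (Cocycle.every-allFin (λ i → eq𝔾 (a i) (b i)) e i)

opaque
  -- 3 kills the C₃ coordinates and 4 the C₂ coordinates; the codes of the last two seeds are the
  -- standard generators of C₃².
  order₂-label : ∀ i → 𝔾C.⟦ unit (+ 3) i ⟧ seedLabel 𝔾.≈ Hom.fun inl𝔾 (Hom.fun (insert C₂ 16 i) true)
  order₂-label = eq𝔾-every (λ i → 𝔾C.⟦ unit (+ 3) i ⟧ seedLabel) (λ i → Hom.fun inl𝔾 (Hom.fun (insert C₂ 16 i) true)) refl

  order₃-label : ∀ i → 𝔾C.⟦ unit (+ 4) (seedOf i) ⟧ seedLabel 𝔾.≈ Hom.fun inr𝔾 (Hom.fun (insert C₃ 2 i) c1)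
  order₃-label = eq𝔾-every (λ i → 𝔾C.⟦ unit (+ 4) (seedOf i) ⟧ seedLabel) (λ i → Hom.fun inr𝔾 (Hom.fun (insert C₃ 2 i) c1)) refl

-- Every cocycle e on the model that vanishes on its spanning tree is obtained
-- from the 𝔾-valued cocycle h by a homomorphism.
module Universal {ℓ₁ ℓ} (K : AbelianGroup ℓ₁ ℓ) (e : Vertex → Vertex → AbelianGroup.Carrier K)
  (~ᴹ-sym : ∀ x y → (x ~ᴹ y) ≡ true → (y ~ᴹ x) ≡ true)
  (e-anti : Antisymmetric K e) (e-tri : Additive K e)
  (e-tree : ∀ w → AbelianGroup._≈_ K (e (parent w) w) (AbelianGroup.ε K)) where
  private
    module H = Combination K
  open Cocycle

  s : Fin 16 → H.Carrier
  s i = e (seed₁ i) (seed₂ i)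

  Ker : Vec ℤ 16 → Set ℓ
  Ker = Kernel K s

  module IS = Integral.Sound K (λ v → H.⟦ v ⟧ s) (λ u v → ⟦⟧-⊞ K u v s) (λ u → ⟦⟧-⊟ K u s) e ~ᴹ-sym e-anti e-tri

  integral-valid : IS.Valid Integral.labels
  integral-valid = subst IS.Valid Integral.labels-run (IS.run-valid steps Integral.onTree Integral.onSeeds
    (λ w _ → H.≈-trans (⟦⟧-𝟘 K s) (H.≈-sym (e-tree w)))
    (λ i _ → H.≈-trans (⟦⟧-unit K 1ℤ i s) (H.identityʳ (s i))))

  module _ (t : Integral.Labels) (valid : IS.Valid t) where
    open Integral

    residue-Ker : ∀ x y z → Ker (residue t (x , y , z))
    residue-Ker x y z = go (get t x y) (get t y z) (get t x z) refl refl refl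
      where
      go : ∀ u v w → get t x y ≡ u → get t y z ≡ v → get t x z ≡ w → Ker (residueOf u v w)
      go nothing  _        _        _ _ _ = ⟦⟧-𝟘 K s
      go (just _) nothing  _        _ _ _ = ⟦⟧-𝟘 K s
      go (just _) (just _) nothing  _ _ _ = ⟦⟧-𝟘 K s
      go (just u) (just v) (just w) p q r =
        let xy , eu = valid x y p
            yz , ev = valid y z q
            xz , ew = valid x z r
        in H.≈-trans (⟦⟧-⊞ K (u ⊞ v) (⊟ w) s)
          (H.≈-trans (H.∙-cong (H.≈-trans (⟦⟧-⊞ K u v s) (H.∙-cong eu ev))
                               (H.≈-trans (⟦⟧-⊟ K w s) (H.⁻¹-cong (H.≈-trans ew (e-tri x y z xy yz xz)))))
                     (H.inverseʳ (e x y H.∙ e y z)))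

    residues-Ker : ∀ i → Ker (Vec.lookup (residues t) i)
    residues-Ker i = subst Ker (sym (Vecₚ.lookup-map i (residue t) triangles))
      (let x , y , z = Vec.lookup triangles i in residue-Ker x y z)

    spans-Ker : ∀ ms target → spans (residues t) ms target ≡ true → ∀ i → Ker (target i)
    spans-Ker ms target ok i = subst Ker
      (trans (eqVec⇒≡ (combine (coefficients (Vec.lookup ms i)) (residues t)) (target (Vec.lookup (Vec.allFin 16) i))
               (ForAll-true (λ m i → ForAll eqℤ (combine (coefficients m) (residues t)) (target i)) ms (Vec.allFin 16) ok i))
             (cong target (Vecₚ.lookup-allFin i)))
      (Kernel-combine K s (coefficients (Vec.lookup ms i)) (residues t) residues-Ker)

  Ker-6 : ∀ i → Ker (unit (+ 6) i)
  Ker-6 = spans-Ker Integral.labels integral-valid sixfold (unit (+ 6)) Integral.sixfold-ok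

  Ker-coded : ∀ i → Ker (Integral.codedRelation i)
  Ker-coded = spans-Ker Integral.labels integral-valid coded Integral.codedRelation Integral.coded-ok

  unit-⊞ : ∀ {n} a b (i : Fin n) → unit a i ⊞ unit b i ≡ unit (a + b) i
  unit-⊞ a b zero    = cong (a + b ∷_) 𝟘-⊞
    where
    𝟘-⊞ : ∀ {n} → 𝟘 {n} ⊞ 𝟘 ≡ 𝟘
    𝟘-⊞ {zero}  = refl
    𝟘-⊞ {suc n} = cong (0ℤ ∷_) 𝟘-⊞
  unit-⊞ a b (suc i) = cong (0ℤ ∷_) (unit-⊞ a b i)

  ⟦unit⟧-+ : ∀ a b i → H.⟦ unit (a + b) i ⟧ s H.≈ H.⟦ unit a i ⟧ s H.∙ H.⟦ unit b i ⟧ s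
  ⟦unit⟧-+ a b i = subst (λ v → H.⟦ v ⟧ s H.≈ H.⟦ unit a i ⟧ s H.∙ H.⟦ unit b i ⟧ s) (unit-⊞ a b i)
    (⟦⟧-⊞ K (unit a i) (unit b i) s)

  -- As 6 s = 0, the element 3 s has order dividing 2 and 4 s, named `order₃`, order dividing 3.
  -- These will be the images of the standard generators.
  order₂ : Fin 16 → H.Carrier
  order₂ i = H.⟦ unit (+ 3) i ⟧ s

  order₃ : Fin 16 → H.Carrier
  order₃ i = H.⟦ unit (+ 4) i ⟧ s

  order₂² : ∀ i → order₂ i H.∙ order₂ i H.≈ H.ε
  order₂² i = H.≈-trans (H.≈-sym (⟦unit⟧-+ (+ 3) (+ 3) i)) (Ker-6 i)

  order₃³ : ∀ i → order₃ i H.∙ (order₃ i H.∙ order₃ i) H.≈ H.ε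
  order₃³ i = H.≈-trans (H.∙-congˡ (H.≈-sym (⟦unit⟧-+ (+ 4) (+ 4) i)))
    (H.≈-trans (H.≈-sym (⟦unit⟧-+ (+ 4) (+ 8) i))
    (H.≈-trans (⟦unit⟧-+ (+ 6) (+ 6) i) (H.≈-trans (H.∙-cong (Ker-6 i) (Ker-6 i)) (H.identityˡ H.ε))))

  η₂ : Fin 16 → Hom C₂ (AbelianGroup.group K)
  η₂ i = fromC₂ K (order₂ i) (order₂² i)

  η₃ : Fin 2 → Hom C₃ (AbelianGroup.group K)
  η₃ zero       = fromC₃ K (order₃ (# 14)) (order₃³ (# 14))
  η₃ (suc zero) = fromC₃ K (order₃ (# 15)) (order₃³ (# 15))

  lift : Hom 𝔾 (AbelianGroup.group K)
  lift = pair K (power K η₂) (power K η₃)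

  η₃-four : ∀ i c → Hom.fun (fromC₃ K (order₃ i) (order₃³ i)) c H.≈ H.⟦ unit (Integral.four c) i ⟧ s
  η₃-four i c0 = H.≈-sym (H.≈-trans (⟦⟧-unit K 0ℤ i s) H.≈-refl)
  η₃-four i c1 = H.≈-refl
  η₃-four i c2 = H.≈-sym (⟦unit⟧-+ (+ 4) (+ 4) i)

  -- The image of the label is 3 s plus the combination 4 c s′ + 4 d s″ of the last two seeds, and
  -- `Ker-coded` says that this combination equals -2 s.
  lift-seed : ∀ i → Hom.fun lift (seedLabel i) H.≈ s i
  lift-seed i = H.≈-trans
    (H.∙-cong (H.≈-trans (power-bit K 16 η₂ i) (⟦unit⟧-+ 1ℤ (+ 2) i))
              (H.∙-cong (η₃-four (# 14) c) (H.≈-trans (H.identityʳ _) (η₃-four (# 15) d))))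
    (H.≈-trans (H.assoc _ _ _)
    (H.≈-trans (H.∙-cong (H.≈-trans (⟦⟧-unit K 1ℤ i s) (H.identityʳ (s i)))
                         (H.≈-trans (H.≈-sym (H.assoc _ _ _)) coded-relation))
               (H.identityʳ (s i))))
    where
    c d : Z3
    c = proj₁ (Vec.lookup codes i)
    d = proj₂ (Vec.lookup codes i)
    u v w : Vec ℤ 16
    u = unit (+ 2) i
    v = unit (Integral.four c) (# 14)
    w = unit (Integral.four d) (# 15)
    coded-relation : (H.⟦ u ⟧ s H.∙ H.⟦ v ⟧ s) H.∙ H.⟦ w ⟧ s H.≈ H.ε
    coded-relation = H.≈-trans (H.≈-sym (H.≈-trans (⟦⟧-⊞ K (u ⊞ v) w s) (H.∙-congʳ (⟦⟧-⊞ K u v s)))) (Ker-coded i)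

  module MS = Modular.Sound K (Hom.fun lift) (Hom.homo lift) (Hom.homo-⁻¹ lift) e ~ᴹ-sym e-anti e-tri

  modular-valid : MS.Valid Modular.labels
  modular-valid = subst MS.Valid Modular.labels-run (MS.run-valid steps Modular.onTree Modular.onSeeds
    (λ w _ → H.≈-trans (Hom.homo-ε lift) (H.≈-sym (e-tree w)))
    (λ i _ → lift-seed i))

  -- The same steps are run a second time with labels in 𝔾. Since `lift` respects the rules of
  -- propagation and is right on the tree and the seeds, it is right on every arc.
  lift-h : ∀ x y → (x ~ᴹ y) ≡ true → Hom.fun lift (h x y) H.≈ e x y
  lift-h x y xy = let v , eq = covered x y xy in
    subst (λ l → Hom.fun lift (fromMaybe 𝔾.ε l) H.≈ e x y) (sym eq) (proj₂ (modular-valid x y eq))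

  module _ (f : Hom (AbelianGroup.group K) 𝔾) (f-seed : ∀ i → Hom.fun f (s i) 𝔾.≈ seedLabel i) where

    f-unit : ∀ a i → Hom.fun f (H.⟦ unit a i ⟧ s) 𝔾.≈ 𝔾C.⟦ unit a i ⟧ seedLabel
    f-unit a i = 𝔾.trans (fun-⟦⟧ K 𝔾-abelian f (unit a i) s) (⟦⟧-cong 𝔾-abelian (unit a i) {Hom.fun f ∘ s} {seedLabel} f-seed)

    f∘η₂ : ∀ i x → Hom.fun f (Hom.fun (η₂ i) x) 𝔾.≈ Hom.fun inl𝔾 (Hom.fun (insert C₂ 16 i) x)
    f∘η₂ i = C₂-ext 𝔾-abelian (f ∘ᴴ η₂ i) (inl𝔾 ∘ᴴ insert C₂ 16 i) (𝔾.trans (f-unit (+ 3) i) (order₂-label i))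

    f∘η₃ : ∀ i x → Hom.fun f (Hom.fun (η₃ i) x) 𝔾.≈ Hom.fun inr𝔾 (Hom.fun (insert C₃ 2 i) x)
    f∘η₃ zero       = C₃-ext 𝔾-abelian (f ∘ᴴ η₃ zero) (inr𝔾 ∘ᴴ insert C₃ 2 zero)
      (𝔾.trans (f-unit (+ 4) (# 14)) (order₃-label zero))
    f∘η₃ (suc zero) = C₃-ext 𝔾-abelian (f ∘ᴴ η₃ (suc zero)) (inr𝔾 ∘ᴴ insert C₃ 2 (suc zero))
      (𝔾.trans (f-unit (+ 4) (# 15)) (order₃-label (suc zero)))

    f∘lift : ∀ x → Hom.fun f (Hom.fun lift x) 𝔾.≈ x
    f∘lift (x , y) = 𝔾.trans (Hom.homo f (Hom.fun (power K η₂) x) (Hom.fun (power K η₃) y))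
      (𝔾.trans (𝔾.∙-cong {_} {Hom.fun inl𝔾 x} {_} {Hom.fun inr𝔾 y}
                 (fun-power-insert K 𝔾-abelian f 16 η₂ inl𝔾 f∘η₂ x)
                 (fun-power-insert K 𝔾-abelian f 2 η₃ inr𝔾 f∘η₃ y))
               (Group.identityʳ (C₂ ^ᴳ 16) x , Group.identityˡ (C₃ ^ᴳ 2) y))

-- The homomorphism to M defined by an M-valued cocycle on the model.
module Holonomy (Γ : SimpleGraph 105) (C : Coordinates Γ) (Tr : SpanningTree Γ)
  (M : AbelianGroup 0ℓ 0ℓ) (h : Vertex → Vertex → AbelianGroup.Carrier M)
  (h-tri : Additive M h) where
  open Arcs Γ C Tr
  private
    module G = Combination M
  open Gauge M
  open AbelianSolver M using (solve; var; _∙ᵉ_; _⁻ᵉ; εᵉ)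

  hΓ : V → V → G.Carrier
  hΓ v w = h (inv v) (inv w)

  hΓ-tri : ∀ {u v w} → adj u v ≡ true → adj v w ≡ true → adj u w ≡ true → hΓ u w G.≈ hΓ u v G.∙ hΓ v w
  hΓ-tri uv vw uw = h-tri _ _ _ (inv-adj uv) (inv-adj vw) (inv-adj uw)

  -- Every edge lies in a triangle, so `h-tri` suffices and antisymmetry of the labels need not be
  -- checked.
  hΓ-anti : ∀ {v w} → adj v w ≡ true → hΓ w v G.≈ hΓ v w G.⁻¹
  hΓ-anti {v} {w} vw = let u , vu , wu = common-neighbour v w vw in
    tri⇒anti {hΓ v w} {hΓ w v} {hΓ v u} {hΓ w u}
      (hΓ-tri vw wu vu) (hΓ-tri (adj-comm vw) vu wu)

  -- The value of `hΓ` along the path from the root to v in the given tree. The number is fuel, and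
  -- any amount exceeding the depth gives the same result.
  potential : ℕ → V → G.Carrier
  potential zero    v = G.ε
  potential (suc k) v with v ≟ root
  ... | yes _ = G.ε
  ... | no  _ = potential k (parentᵀ v) G.∙ hΓ v (parentᵀ v) G.⁻¹

  potential-stable : ∀ k k′ v → depth v ℕ.< k → depth v ℕ.< k′ → potential k v ≡ potential k′ v
  potential-stable (suc k) (suc k′) v (s≤s p) (s≤s q) with v ≟ root
  ... | yes _ = refl
  ... | no ne = cong (G._∙ hΓ v (parentᵀ v) G.⁻¹)
    (potential-stable k k′ (parentᵀ v) (ℕₚ.≤-trans (depthDec v ne) p) (ℕₚ.≤-trans (depthDec v ne) q))

  pot : V → G.Carrier
  pot v = potential (suc (depth v)) v

  pot-step : ∀ v → v ≢ root → pot v ≡ pot (parentᵀ v) G.∙ hΓ v (parentᵀ v) G.⁻¹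
  pot-step v ne with v ≟ root
  ... | yes e = contradiction e ne
  ... | no _  = cong (G._∙ hΓ v (parentᵀ v) G.⁻¹)
    (potential-stable (depth v) (suc (depth (parentᵀ v))) (parentᵀ v) (depthDec v ne) ℕₚ.≤-refl)

  -- The cocycle of the model, normalised to vanish on the given spanning tree.
  h′ : V → V → G.Carrier
  h′ v w = gauge (pot v) (hΓ v w) (pot w)

  h′-tri : ∀ {u v w} → adj u v ≡ true → adj v w ≡ true → adj u w ≡ true → h′ u w G.≈ h′ u v G.∙ h′ v w
  h′-tri {u} {v} {w} uv vw uw = gauge-tri (pot u) (pot v) (pot w)
    {hΓ u v} {hΓ v w} {hΓ u w} (hΓ-tri uv vw uw)

  h′-anti : ∀ {v w} → adj v w ≡ true → h′ w v G.≈ h′ v w G.⁻¹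
  h′-anti {v} {w} vw = gauge-anti (pot v) (pot w) {hΓ v w} {hΓ w v} (hΓ-anti vw)

  h′-tree : ∀ v → v ≢ root → h′ v (parentᵀ v) G.≈ G.ε
  h′-tree v ne = subst (λ p → gauge p (hΓ v (parentᵀ v)) (pot (parentᵀ v)) G.≈ G.ε) (sym (pot-step v ne))
    (solve (((var 0F ∙ᵉ var 1F ⁻ᵉ) ∙ᵉ var 1F) ∙ᵉ var 0F ⁻ᵉ) εᵉ refl (pot (parentᵀ v) ∷ hΓ v (parentᵀ v) ∷ []))

  letter : Letter → G.Carrier
  letter (((v , w) , _) , false) = h′ v w
  letter (((v , w) , _) , true)  = h′ v w G.⁻¹

  word : Word → G.Carrier
  word []      = G.ε
  word (l ∷ w) = letter l G.∙ word w

  word-++ : ∀ u v → word (u List.++ v) G.≈ word u G.∙ word v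
  word-++ []      v = G.≈-sym (G.identityˡ (word v))
  word-++ (l ∷ u) v = G.≈-trans (G.∙-congˡ {letter l} (word-++ u v)) (G.≈-sym (G.assoc (letter l) (word u) (word v)))

  word-relator : ∀ {r} → Relator r → word r G.≈ G.ε
  word-relator (tree↑ v ne) = G.≈-trans (G.identityʳ _) (h′-tree v ne)
  word-relator (tree↓ v ne) = G.≈-trans (G.identityʳ (h′ (parentᵀ v) v))
    (G.≈-trans (h′-anti (T⇒≡ (parentAdj v ne)))
    (G.≈-trans (G.⁻¹-cong {h′ v (parentᵀ v)} {G.ε} (h′-tree v ne)) G.ε⁻¹≈ε))
  word-relator (edge v w a b) = G.≈-trans (G.∙-congˡ {h′ v w} (G.≈-trans (G.identityʳ (h′ w v)) (h′-anti (T⇒≡ a))))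
    (G.inverseʳ (h′ v w))
  word-relator (tri x y z a b c) = G.≈-trans
    (G.∙-congˡ {h′ x y} (G.∙-congˡ {h′ y z} (G.≈-trans (G.identityʳ (h′ z x))
      (G.≈-trans (h′-anti (adj-comm (T⇒≡ c)))
               (G.⁻¹-cong {h′ x z} {h′ x y G.∙ h′ y z} (h′-tri (T⇒≡ a) (T⇒≡ b) (adj-comm (T⇒≡ c))))))))
    (solve (var 0F ∙ᵉ (var 1F ∙ᵉ (var 0F ∙ᵉ var 1F) ⁻ᵉ)) εᵉ refl (h′ x y ∷ h′ y z ∷ []))

  word-≈ : ∀ {u v} → u ≈ v → word u G.≈ word v
  word-≈ {u} ≈-refl = G.≈-refl {word u}
  word-≈ (≈-sym p) = G.≈-sym (word-≈ p)
  word-≈ (≈-trans p q) = G.≈-trans (word-≈ p) (word-≈ q)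
  word-≈ (≈-cong {u} {u′} {v} {v′} p q) = G.≈-trans (word-++ u v)
    (G.≈-trans (G.∙-cong {word u} {word u′} {word v} {word v′} (word-≈ p) (word-≈ q)) (G.≈-sym (word-++ u′ v′)))
  word-≈ (cancel (((v , w) , _) , false)) = G.≈-trans (G.∙-congˡ {h′ v w} (G.identityʳ (h′ v w G.⁻¹))) (G.inverseʳ (h′ v w))
  word-≈ (cancel (((v , w) , _) , true))  = G.≈-trans (G.∙-congˡ {h′ v w G.⁻¹} (G.identityʳ (h′ v w))) (G.inverseˡ (h′ v w))
  word-≈ (relator r) = word-relator r

  f : Hom (π₁-ab Γ Tr) (AbelianGroup.group M)
  f = factor π₁ M record { fun = word ; pres = word-≈ ; homo = word-++ }

  f-arc : ∀ {v w} → adj v w ≡ true → word (arc v w) G.≈ h′ v w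
  f-arc {v} {w} e = subst (λ u → word u G.≈ h′ v w) (sym (arc-true v w (adj⇒Adj e))) (G.identityʳ (h′ v w))

  word-e : ∀ x y → (x ~ᴹ y) ≡ true → word (e x y) G.≈ gauge (pot (ψ x)) (h x y) (pot (ψ y))
  word-e x y xy = subst (λ k → word (e x y) G.≈ gauge (pot (ψ x)) k (pot (ψ y)))
    (cong₂ h (inv-ψ x) (inv-ψ y)) (f-arc (ψ-adj′ xy))

  module _ (h-tree : ∀ w → parent w ≡ w ⊎ ((parent w ~ᴹ w) ≡ true × h (parent w) w G.≈ G.ε)) where
    open Cocycle using (parent-parent)

    word-tree : ∀ w → word (e (parent w) w) G.≈ pot (ψ (parent w)) G.∙ pot (ψ w) G.⁻¹
    word-tree w with h-tree w
    ... | inj₂ (pw , h≈ε) = G.≈-trans (word-e (parent w) w pw) (gauge-ε (pot (ψ (parent w))) (pot (ψ w)) h≈ε)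
    ... | inj₁ pw≡w = subst (λ p → word (e p w) G.≈ pot (ψ p) G.∙ pot (ψ w) G.⁻¹) (sym pw≡w)
      (subst (λ u → word u G.≈ pot (ψ w) G.∙ pot (ψ w) G.⁻¹) (sym (e-loop w)) (G.≈-sym (G.inverseʳ (pot (ψ w)))))

    word-q : ∀ w → word (q w) G.≈ pot (ψ zero) G.∙ pot (ψ w) G.⁻¹
    word-q w = G.≈-trans (word-++ (e zero (parent w)) (e (parent w) w))
      (telescope (pot (ψ zero)) (pot (ψ (parent w))) (pot (ψ w))
        (subst (λ r → word (e r (parent w)) G.≈ pot (ψ r) G.∙ pot (ψ (parent w)) G.⁻¹) (parent-parent w) (word-tree (parent w)))
        (word-tree w))

    -- Normalising to the given tree and then back to the tree of the model restores h, because h is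
    -- trivial on the latter.
    word-e′ : ∀ x y → (x ~ᴹ y) ≡ true → word (e′ x y) G.≈ h x y
    word-e′ x y xy = G.≈-trans (Hom.homo f (q x H.∙ e x y) (q y H.⁻¹))
      (G.≈-trans (G.∙-cong (Hom.homo f (q x) (e x y)) (Hom.homo-⁻¹ f (q y)))
        (regauge (pot (ψ zero)) (pot (ψ x)) (pot (ψ y)) (word-q x) (word-e x y xy) (word-q y)))

  module _ (L : Hom (AbelianGroup.group M) (π₁-ab Γ Tr))
           (L-h : ∀ x y → (x ~ᴹ y) ≡ true → Hom.fun L (h x y) H.≈ e′ x y) where
    private
      module HG = Gauge Hᴬ
      module L = Hom L

    L-hΓ : ∀ {v w} → adj v w ≡ true → L.fun (hΓ v w) H.≈ HG.gauge (q (inv v)) (arc v w) (q (inv w))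
    L-hΓ {v} {w} vw = subst (λ u → L.fun (hΓ v w) H.≈ HG.gauge (q (inv v)) u (q (inv w)))
      (cong₂ arc (ψ-inv v) (ψ-inv w)) (L-h (inv v) (inv w) (inv-adj vw))

    -- The potentials of the two normalisations cancel up to a constant: on an arc of the given tree
    -- `arc` is trivial, so passing to the parent does not change the product.
    constant : ∀ v → (L.fun (pot v) H.∙ q (inv v)) H.≈ (L.fun (pot root) H.∙ q (inv root))
    constant = tree-induction _ (H.≈-refl {L.fun (pot root) H.∙ q (inv root)}) λ v ne ih →
      H.≈-trans {L.fun (pot v) H.∙ q (inv v)} {L.fun (pot (parentᵀ v)) H.∙ q (inv (parentᵀ v))}
                {L.fun (pot root) H.∙ q (inv root)}
        (HG.gauge-step (q (inv v)) (q (inv (parentᵀ v))) (L.fun (pot (parentᵀ v)))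
          {L.fun (pot v)} {L.fun (hΓ v (parentᵀ v))} {arc v (parentᵀ v)}
          (L-step v ne) (L-hΓ (T⇒≡ (parentAdj v ne))) (arc-tree v ne))
        ih
      where
      L-step : ∀ v → v ≢ root → L.fun (pot v) H.≈ L.fun (pot (parentᵀ v)) H.∙ L.fun (hΓ v (parentᵀ v)) H.⁻¹
      L-step v ne = subst (λ u → L.fun u H.≈ L.fun (pot (parentᵀ v)) H.∙ L.fun (hΓ v (parentᵀ v)) H.⁻¹) (sym (pot-step v ne))
        (H.≈-trans {L.fun (pot (parentᵀ v) G.∙ hΓ v (parentᵀ v) G.⁻¹)}
                   {L.fun (pot (parentᵀ v)) H.∙ L.fun (hΓ v (parentᵀ v) G.⁻¹)}
                   {L.fun (pot (parentᵀ v)) H.∙ L.fun (hΓ v (parentᵀ v)) H.⁻¹}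
          (L.homo (pot (parentᵀ v)) (hΓ v (parentᵀ v) G.⁻¹))
          (H.∙-congˡ {L.fun (pot (parentᵀ v))} {L.fun (hΓ v (parentᵀ v) G.⁻¹)} {L.fun (hΓ v (parentᵀ v)) H.⁻¹}
            (L.homo-⁻¹ (hΓ v (parentᵀ v)))))

    L-h′ : ∀ {v w} → adj v w ≡ true → L.fun (h′ v w) H.≈ arc v w
    L-h′ {v} {w} vw =
      H.≈-trans {L.fun (h′ v w)} {HG.gauge (L.fun (pot v)) (L.fun (hΓ v w)) (L.fun (pot w))} {arc v w}
        (H.≈-trans {L.fun (h′ v w)} {L.fun (pot v G.∙ hΓ v w) H.∙ L.fun (pot w G.⁻¹)}
                   {HG.gauge (L.fun (pot v)) (L.fun (hΓ v w)) (L.fun (pot w))}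
          (L.homo (pot v G.∙ hΓ v w) (pot w G.⁻¹))
          (H.∙-cong {L.fun (pot v G.∙ hΓ v w)} {L.fun (pot v) H.∙ L.fun (hΓ v w)}
                    {L.fun (pot w G.⁻¹)} {L.fun (pot w) H.⁻¹}
            (L.homo (pot v) (hΓ v w)) (L.homo-⁻¹ (pot w))))
        (HG.gauge-compose (q (inv v)) (L.fun (pot v)) (q (inv w)) (L.fun (pot w)) {arc v w} {L.fun (hΓ v w)}
          (L-hΓ vw)
          (H.≈-trans {L.fun (pot v) H.∙ q (inv v)} {L.fun (pot root) H.∙ q (inv root)} {L.fun (pot w) H.∙ q (inv w)}
            (constant v)
            (H.≈-sym {L.fun (pot w) H.∙ q (inv w)} {L.fun (pot root) H.∙ q (inv root)} (constant w))))

    L-letter : ∀ l → L.fun (letter l) H.≈ (l ∷ [])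
    L-letter (((v , w) , a) , false) = subst (L.fun (h′ v w) H.≈_) (arc-true v w a) (L-h′ (T⇒≡ a))
    L-letter (((v , w) , a) , true)  =
      H.≈-trans {L.fun (h′ v w G.⁻¹)} {L.fun (h′ v w) H.⁻¹} {g v w a H.⁻¹} (L.homo-⁻¹ (h′ v w))
        (H.⁻¹-cong {L.fun (h′ v w)} {g v w a} (L-letter (((v , w) , a) , false)))

    L∘f : ∀ u → L.fun (word u) H.≈ u
    L∘f []      = L.homo-ε
    L∘f (l ∷ u) = H.≈-trans {L.fun (letter l G.∙ word u)} {L.fun (letter l) H.∙ L.fun (word u)} {(l ∷ []) H.∙ u}
      (L.homo (letter l) (word u))
      (H.∙-cong {L.fun (letter l)} {l ∷ []} {L.fun (word u)} {u} (L-letter l) (L∘f u))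

-- `U.lift` carries h to the normalised arcs `e′`, and f carries `e′` back to h. The first fact
-- gives one composite on all letters, the second the other composite on the seeds.
π₁-ab≅𝔾 : (Γ : SimpleGraph 105) → Coordinates Γ → (Tr : SpanningTree Γ) → π₁-ab Γ Tr ≅ 𝔾
π₁-ab≅𝔾 Γ C Tr = inverse⇒≅ f U.lift (L∘f U.lift U.lift-h)
  (U.f∘lift f λ i → 𝔾.trans {word (e′ (seed₁ i) (seed₂ i))} {h (seed₁ i) (seed₂ i)} {seedLabel i}
    (word-e′ tree-arc (seed₁ i) (seed₂ i) (proj₁ (seed-arc i))) (proj₂ (seed-arc i)))
  where
  open Cocycle
  open Arcs Γ C Tr
  open Holonomy Γ C Tr 𝔾-abelian h h-tri
  module U = Universal Hᴬ e′ ~ᴹ-sym e′-anti e′-tri e′-tree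

theorem4p1 : (Δ : SimpleGraph 105) → IsSRG Δ 32 4 12 → (T : SpanningTree Δ) →
    π₁-ab Δ T ≅ ((C₂ ^ᴳ 16) ×ᴳ (C₃ ^ᴳ 2))
theorem4p1 Δ srg = π₁-ab≅𝔾 Δ (coordinates Δ refl srg zero)
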